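{- For every $m,n$, every non-adaptive randomized scheme for batch recovery must make $\Omega(mn)$ linear measurements in the worst case, independently of $k$, even when $\omega=0$.
   Context: For a matrix $A\in\mathbb{R}^{n\times m}$ with columns $A_1,\dots,A_m\in\mathbb{R}^n$, write $\|A\|_1=\sum_{i,j}|A_{ij}|$ and let $\|A\|_0$ be the number of nonzero entries of $A$; $A$ is called $(km)$-sparse if $\|A\|_0\le km$. In batch recovery, the input is a matrix $A\in\mathbb{R}^{n\times m}$ and a parameter $k\in\{1,\dots,n\}$. The goal is to perform linear measurements of columns of $A$, one column in each measurement, and then recover a matrix $A'$ satisfying $\|A-A'\|_1\le C\omega$ for some constant $C\ge 1$, where $\omega=\min\{\|A-A^*\|_1 : A^*\in\mathbb{R}^{n\times m}\text{ is }(km)\text{ -sparse}\}$. In particular, $\omega=0$ is the noise-free case, in which $A$ is $(km)$-sparse and must be recovered exactly. A scheme constructs sensing matrices $S_1,\dots,S_m$, with $S_j\in\mathbb{R}^{t_j\times n}$, together with a recovery algorithm that uses $S_1A_1,\dots,S_mA_m$ to output $A'\in\mathbb{R}^{n\times m}$. The number of linear measurements is $\sum_{j=1}^m t_j$. The scheme is non-adaptive if the sensing matrices are constructed without using the results of any measurements; it is randomized if it may use random choices. A randomized scheme is required to succeed with probability at least $\tfrac12$ on every input.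
   Formalization: For a fixed k the bound is stated under n ≤ km (it fails for m = k = 1); with no relation between m, n, k it is stated for the worst case over inputs including k. The recovered matrix is assumed to depend jointly measurably on the random choices and the input. -}

module Defs where

open import Algebra.Bundles using (CommutativeRing)
open import Data.Bool.Base using (if_then_else_)
open import Data.Fin.Base using (Fin; toℕ)
open import Data.Nat.Base as ℕ using (ℕ)
open import Data.Nat.Properties using (+-0-commutativeMonoid)
open import Data.Product.Base using (∃; _×_; _,_; proj₁; proj₂)
open import Data.Vec.Functional using (Vector)
open import Function.Base using (_∘_)
open import Level using (0ℓ)
open import Relation.Binary.Core using (Rel)
open import Relation.Binary.PropositionalEquality.Core using (_≢_)
open import Relation.Binary.Structures using (IsDecTotalOrder)
open import Relation.Nullary using (¬_; does)
open import Relation.Unary using (Pred; U; ∁; ⋃; _∩_; _≐_; Empty)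

import Algebra.Properties.CommutativeMonoid.Sum as Sum

open Sum +-0-commutativeMonoid using () renaming (sum to sumℕ)

-- The real numbers, given by their axioms: a Dedekind-complete ordered field.
-- Classically there is exactly one up to isomorphism, so a statement about
-- every RealField is a statement about ℝ.  Equality is the setoid equality
-- of the ring.

record RealField : Set₁ where
  infix 4 _≤_
  field
    commutativeRing : CommutativeRing 0ℓ 0ℓ
  open CommutativeRing commutativeRing public renaming (Carrier to ℝ)
  field
    _≤_             : Rel ℝ 0ℓ
    isDecTotalOrder : IsDecTotalOrder _≈_ _≤_
  open IsDecTotalOrder isDecTotalOrder public
    using (_≟_; _≤?_; total; antisym; module Eq)
    renaming (refl to ≤-refl; trans to ≤-trans; reflexive to ≤-reflexive)

  IsUpperBound : Pred ℝ 0ℓ → ℝ → Set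
  IsUpperBound A b = ∀ x → A x → x ≤ b

  IsSupremum : Pred ℝ 0ℓ → ℝ → Set
  IsSupremum A s = IsUpperBound A s × (∀ b → IsUpperBound A b → s ≤ b)

  field
    0≉1      : ¬ (0# ≈ 1#)
    inverse  : ∀ x → ¬ (x ≈ 0#) → ∃ λ y → x * y ≈ 1#
    +-monoˡ  : ∀ {x y} z → x ≤ y → x + z ≤ y + z
    *-nonneg : ∀ {x y} → 0# ≤ x → 0# ≤ y → 0# ≤ x * y
    complete : ∀ A → ∃ A → ∃ (IsUpperBound A) → ∃ (IsSupremum A)

-- The σ-algebra generated by a family of sets.

data Generated {X : Set} (G : Pred X 0ℓ → Set₁) : Pred X 0ℓ → Set₁ where
  generator      : ∀ {A} → G A → Generated G A
  gen-respects   : ∀ {A B} → A ≐ B → Generated G A → Generated G B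
  gen-whole      : Generated G U
  gen-complement : ∀ {A} → Generated G A → Generated G (∁ A)
  gen-union      : ∀ {A : ℕ → Pred X 0ℓ} →
                   (∀ i → Generated G (A i)) → Generated G (⋃ ℕ A)

record MeasurableSpace : Set₂ where
  field
    Point        : Set
    IsMeasurable : Pred Point 0ℓ → Set₁
    respects     : ∀ {A B} → A ≐ B → IsMeasurable A → IsMeasurable B
    whole        : IsMeasurable U
    complement   : ∀ {A} → IsMeasurable A → IsMeasurable (∁ A)
    union        : ∀ {A : ℕ → Pred Point 0ℓ} →
                   (∀ i → IsMeasurable (A i)) → IsMeasurable (⋃ ℕ A)

open MeasurableSpace using (Point; IsMeasurable)

generatedSpace : (X : Set) → (Pred X 0ℓ → Set₁) → MeasurableSpace
generatedSpace X G = record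
  { Point        = X
  ; IsMeasurable = Generated G
  ; respects     = gen-respects
  ; whole        = gen-whole
  ; complement   = gen-complement
  ; union        = gen-union
  }

data Cylinder (M N : MeasurableSpace) : Pred (Point M × Point N) 0ℓ → Set₁ where
  left  : ∀ {A} → IsMeasurable M A → Cylinder M N (A ∘ proj₁)
  right : ∀ {B} → IsMeasurable N B → Cylinder M N (B ∘ proj₂)

infixr 7 _⊗_
_⊗_ : MeasurableSpace → MeasurableSpace → MeasurableSpace
M ⊗ N = generatedSpace (Point M × Point N) (Cylinder M N)

IsMeasurableMap : (M N : MeasurableSpace) → (Point M → Point N) → Set₁
IsMeasurableMap M N f = ∀ {B} → IsMeasurable N B → IsMeasurable M (B ∘ f)

module BatchRecovery (R : RealField) where

  open RealField R
  open Sum +-commutativeMonoid using (sum)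

  ∣_∣ : ℝ → ℝ
  ∣ x ∣ = if does (0# ≤? x) then x else - x

  Matrix : ℕ → ℕ → Set
  Matrix n m = Fin n → Fin m → ℝ

  column : ∀ {n m} → Matrix n m → Fin m → Vector ℝ n
  column A j i = A i j

  infixl 6 _⊖_
  _⊖_ : ∀ {n m} → Matrix n m → Matrix n m → Matrix n m
  (A ⊖ B) i j = A i j - B i j

  infixr 7 _·_
  _·_ : ∀ {t n} → Matrix t n → Vector ℝ n → Vector ℝ t
  (S · x) i = sum λ l → S i l * x l

  ‖_‖₁ : ∀ {n m} → Matrix n m → ℝ
  ‖ A ‖₁ = sum λ i → sum λ j → ∣ A i j ∣

  ‖_‖₀ : ∀ {n m} → Matrix n m → ℕ
  ‖ A ‖₀ = sumℕ λ i → sumℕ λ j → if does (A i j ≟ 0#) then 0 else 1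

  IsSparse : ℕ → ∀ {n m} → Matrix n m → Set
  IsSparse s A = ‖ A ‖₀ ℕ.≤ s

  -- IsBestError k A ω  says  ω = min { ‖A − A*‖₁ : A* is (km)-sparse }.
  IsBestError : ℕ → ∀ {n m} → Matrix n m → ℝ → Set
  IsBestError k {n} {m} A ω =
    (∃ λ (A* : Matrix n m) → IsSparse (k ℕ.* m) A* × ω ≈ ‖ A ⊖ A* ‖₁) ×
    (∀ (A* : Matrix n m) → IsSparse (k ℕ.* m) A* → ω ≤ ‖ A ⊖ A* ‖₁)

  data BorelGenerator (n m : ℕ) : Pred (Matrix n m) 0ℓ → Set₁ where
    entry≤ : ∀ i j r → BorelGenerator n m (λ A → A i j ≤ r)

  Borel : ℕ → ℕ → MeasurableSpace
  Borel n m = generatedSpace (Matrix n m) (BorelGenerator n m)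

  record ProbabilitySpace : Set₂ where
    field
      space : MeasurableSpace
    open MeasurableSpace space public using () renaming (Point to Ω; IsMeasurable to IsEvent)
    field
      -- Only the values on events matter; elsewhere Pr is unconstrained.
      Pr          : Pred Ω 0ℓ → ℝ
      Pr-respects : ∀ {A B} → IsEvent A → A ≐ B → Pr A ≈ Pr B
      Pr-nonneg   : ∀ {A} → IsEvent A → 0# ≤ Pr A
      Pr-whole    : Pr U ≈ 1#
      -- The terms are nonnegative, so the sum of the series is the supremum
      -- of its partial sums.
      Pr-additive : ∀ (A : ℕ → Pred Ω 0ℓ) → (∀ i → IsEvent (A i)) →
                    (∀ i j → i ≢ j → Empty (A i ∩ A j)) →
                    IsSupremum (λ x → ∃ λ N → x ≈ sum {N} (λ i → Pr (A (toℕ i))))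
                               (Pr (⋃ ℕ A))

  -- The scheme for one outcome of the random choices.  Non-adaptivity: t and S
  -- are fixed before any measurement result is seen.
  record DeterministicScheme (n m : ℕ) : Set where
    field
      t : Fin m → ℕ
      S : ∀ j → Matrix (t j) n

    Results : Set
    Results = ∀ j → Vector ℝ (t j)

    field
      recover      : Results → Matrix n m
      -- Without this, recover could extract more than the real numbers
      -- measured from the way they happen to be represented.
      recover-cong : ∀ {y z : Results} → (∀ j i → y j i ≈ z j i) →
                     ∀ i j → recover y i j ≈ recover z i j

    output : Matrix n m → Matrix n m
    output A = recover λ j → S j · column A j

    measurements : ℕ
    measurements = sumℕ t

  -- The output is required to be a random matrix depending measurably on the
  -- random choices and the input together.  This holds whenever the sensing
  -- matrices and the recovery algorithm are measurable.
  record RandomizedScheme (n m : ℕ) : Set₂ where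
    field
      probabilitySpace : ProbabilitySpace
    open ProbabilitySpace probabilitySpace public
    field
      scheme : Ω → DeterministicScheme n m
    open module At (ω : Ω) = DeterministicScheme (scheme ω) public
      using (output; measurements)
    field
      output-measurable :
        IsMeasurableMap (space ⊗ Borel n m) (Borel n m) λ (ω , A) → output ω A

  open RandomizedScheme using (Pr; output; measurements; Ω)

  AtLeastHalf : ℝ → Set
  AtLeastHalf p = 1# ≤ p + p

  -- The event below is measurable, since output is jointly measurable.
  SucceedsOn : ∀ {n m} → ℝ → ℕ → RandomizedScheme n m → Matrix n m → Set
  SucceedsOn C k 𝒮 A = ∀ w → IsBestError k A w →
    AtLeastHalf (Pr 𝒮 λ ω → ‖ A ⊖ output 𝒮 ω A ‖₁ ≤ C * w)

  -- Success is asked for only on the inputs whose best error is 0.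
  SolvesNoiseFree : ∀ {n m} → ℝ → ℕ → RandomizedScheme n m → Set
  SolvesNoiseFree C k 𝒮 = ∀ A → IsBestError k A 0# → SucceedsOn C k 𝒮 A

  WorstCaseAtMost : ∀ {n m} → RandomizedScheme n m → ℕ → Set
  WorstCaseAtMost 𝒮 T = ∀ (ω : Ω 𝒮) → measurements 𝒮 ω ℕ.≤ T

{-# OPTIONS --safe #-}
module Submission where

-- Suppose that, for every outcome ω of the random choices, fewer than a quarter of
-- the columns have t_j ≥ n.  Then for some column j the events on which t_j ≥ n have
-- probability at most 1/4.  Take as input the matrix whose column j is a uniform
-- x ∈ [0,1]ⁿ, given by binary digits, all other entries being 0.  If t_j < n, then
-- S_j has a kernel vector v ≠ 0, and no two recovered x differ by a nonzero multiple
-- of v, so the recovered x form a null set; by Fubini some x is recovered with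
-- probability below one half.
--
-- In place of the Fubini theorem: a jointly measurable set of pairs (ω, x) is
-- approximated by an elementary set F, whose sections depend on finitely many digits
-- of x, up to an increasing union W of elementary sets of small volume.  If F is much
-- larger than W at ω, counting grid points yields, at each scale, two points of F ∖ W
-- that differ by nearly a fixed small multiple of v; a cluster point of these pairs
-- is a pair of recovered inputs that S_j cannot tell apart.

open import Defs
open import Axiom.ExcludedMiddle using (ExcludedMiddle)
open import Data.Bool.Base using (Bool; true; false; if_then_else_)
open import Data.Empty using (⊥)
open import Data.Fin.Base as Fin using (Fin; toℕ; punchIn)
import Data.Fin.Properties as Finₚ
open import Data.List.Base as List using (List; []; _∷_; _++_)
open import Data.Nat.Base as ℕ using (ℕ; zero; suc; z≤n; s≤s)
import Data.Nat.Properties as ℕₚ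
import Data.Nat.Solver as ℕSolver
open import Data.Product.Base using (∃; _×_; _,_; proj₁; proj₂)
open import Data.Sum.Base using (_⊎_; inj₁; inj₂; [_,_]′)
open import Data.Unit.Base using (tt)
open import Data.Vec.Base using (Vec; []; _∷_; lookup)
open import Data.Vec.Relation.Binary.Pointwise.Inductive as Pointwise using (Pointwise; []; _∷_)
open import Function.Base using (_∘_; id; const)
open import Level using (0ℓ)
open import Relation.Binary.Bundles using (DecTotalOrder)
open import Relation.Binary.Definitions using (tri<; tri≈; tri>)
open import Relation.Binary.PropositionalEquality.Core as ≡ using (_≡_; _≢_)
open import Relation.Nullary using (¬_; ¬?; Dec; yes; no; does)
open import Relation.Nullary.Negation using (contradiction)
open import Relation.Unary using (Pred; U; ∅; ∁; ⋃; ⋂; _∩_; _∪_; _⊆_; _≐_; Empty)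

import Algebra.Properties.CommutativeMonoid.Mult as CommutativeMult
import Algebra.Properties.CommutativeMonoid.Sum as Sum
import Algebra.Properties.Monoid.Mult as Mult
import Algebra.Properties.Ring as RingProperties
import Algebra.Properties.Semiring.Sum as SemiringSum
import Algebra.Solver.Ring.NaturalCoefficients.Default as RingSolver
import Relation.Binary.Reasoning.PartialOrder as PosetReasoning

open ℕSolver.+-*-Solver using ()
  renaming (solve to solveℕ; _:+_ to _⊕_; _:*_ to _⊛_; _:=_ to _⊜_; con to conℕ)
open Sum ℕₚ.+-0-commutativeMonoid using () renaming (sum to sumℕ)

-- Only the output is known to be measurable in ω: neither the set of ω with `t_j ≥ n` nor a choice
-- of kernel vector of `S_j` need be measurable. The kernel vector is therefore used at one outcome
-- at a time, and only to prove an inclusion: an intersection of events `Dominates` lies inside the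
-- outcomes with `t_j ≥ n`. That intersection is an event by construction, so it is enough to bound
-- the events contained in `Full j`. Binary digits stand in for Lebesgue measure. Integrals over the
-- inputs are finite averages over digits, and limits come from the compactness of the space of
-- digit sequences. The price is that adding a number to a digit sequence may carry. Hence only
-- those grid points are moved that have a zero digit in front of the digits affected. This costs
-- half of the mass in each coordinate, which is the factor `½^ n`, and the approximation error
-- `½^ (5 ℕ.+ n)` is chosen to be small against it.

-- Ordered-field arithmetic and powers of one half

module OrderedField (R : RealField) where

  open RealField R public hiding (zero)
  open RingProperties ring public using (+-cancelʳ; -‿involutive; -0#≈0#; -‿distribˡ-*; -‿distribʳ-*)
  open Mult +-monoid public using () renaming (_×_ to _•_; ×-homo-+ to •-homo-+; ×-cong to •-cong; ×-assocˡ to •-assocˡ)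

  decTotalOrder : DecTotalOrder _ _ _
  decTotalOrder = record { isDecTotalOrder = isDecTotalOrder }

  open PosetReasoning (DecTotalOrder.poset decTotalOrder) public
  open RingSolver commutativeSemiring public using (solve; _:+_; _:*_; _:=_; con)

  infix 4 _<_
  _<_ : ℝ → ℝ → Set
  x < y = ¬ (y ≤ x)

  <⇒≤ : ∀ {x y} → x < y → x ≤ y
  <⇒≤ {x} {y} x<y with total x y
  ... | inj₁ x≤y = x≤y
  ... | inj₂ y≤x = contradiction y≤x x<y

  ≮⇒≥ : ∀ {x y} → ¬ (x < y) → y ≤ x
  ≮⇒≥ {x} {y} x≮y with y ≤? x
  ... | yes y≤x = y≤x
  ... | no  y≰x = contradiction y≰x x≮y

  +-mono-≤ : ∀ {w x y z} → w ≤ x → y ≤ z → w + y ≤ x + z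
  +-mono-≤ {w} {x} {y} {z} w≤x y≤z = begin
    w + y ≤⟨ +-monoˡ y w≤x ⟩
    x + y ≈⟨ +-comm x y ⟩
    y + x ≤⟨ +-monoˡ x y≤z ⟩
    z + x ≈⟨ +-comm z x ⟩
    x + z ∎

  +-cancelʳ-≤ : ∀ z {x y} → x + z ≤ y + z → x ≤ y
  +-cancelʳ-≤ z {x} {y} x+z≤y+z = begin
    x               ≈⟨ cancel x ⟨
    (x + z) + (- z) ≤⟨ +-monoˡ (- z) x+z≤y+z ⟩
    (y + z) + (- z) ≈⟨ cancel y ⟩
    y               ∎
    where
    cancel : ∀ x → (x + z) + (- z) ≈ x
    cancel x = trans (+-assoc x z (- z)) (trans (+-congˡ (-‿inverseʳ z)) (+-identityʳ x))

  -- Linear arithmetic: the inequality b − a = r − l, moved so that no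
  -- subtraction occurs and the equation is left to the semiring solver.
  linear : ∀ {a b l r} → l ≤ r → a + r ≈ b + l → a ≤ b
  linear {a} {b} {l} {r} l≤r a+r≈b+l = +-cancelʳ-≤ r (begin
    a + r ≈⟨ a+r≈b+l ⟩
    b + l ≤⟨ +-mono-≤ ≤-refl l≤r ⟩
    b + r ∎)

  x≤y⇒0≤y-x : ∀ {x y} → x ≤ y → 0# ≤ y - x
  x≤y⇒0≤y-x {x} {y} x≤y = begin
    0#    ≈⟨ -‿inverseʳ x ⟨
    x - x ≤⟨ +-monoˡ (- x) x≤y ⟩
    y - x ∎

  y-x+x≈y : ∀ x y → (y - x) + x ≈ y
  y-x+x≈y x y = trans (+-assoc y (- x) x) (trans (+-congˡ (-‿inverseˡ x)) (+-identityʳ y))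

  neg-mono : ∀ {x y} → x ≤ y → - y ≤ - x
  neg-mono {x} {y} x≤y = begin
    - y           ≈⟨ +-identityˡ (- y) ⟨
    0# + (- y)    ≤⟨ +-monoˡ (- y) (x≤y⇒0≤y-x x≤y) ⟩
    (y - x) - y   ≈⟨ +-congʳ (+-comm y (- x)) ⟩
    (- x + y) - y ≈⟨ +-assoc (- x) y (- y) ⟩
    - x + (y - y) ≈⟨ +-congˡ (-‿inverseʳ y) ⟩
    - x + 0#      ≈⟨ +-identityʳ (- x) ⟩
    - x           ∎

  *-monoˡ-≤ : ∀ {c x y} → 0# ≤ c → x ≤ y → c * x ≤ c * y
  *-monoˡ-≤ {c} {x} {y} 0≤c x≤y = begin
    c * x               ≈⟨ +-identityˡ (c * x) ⟨
    0# + c * x          ≤⟨ +-monoˡ (c * x) (*-nonneg 0≤c (x≤y⇒0≤y-x x≤y)) ⟩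
    c * (y - x) + c * x ≈⟨ distribˡ c (y - x) x ⟨
    c * ((y - x) + x)   ≈⟨ *-congˡ (y-x+x≈y x y) ⟩
    c * y               ∎

  0≤1 : 0# ≤ 1#
  0≤1 with total 0# 1#
  ... | inj₁ 0≤1 = 0≤1
  ... | inj₂ 1≤0 = begin
    0#          ≤⟨ *-nonneg 0≤-1 0≤-1 ⟩
    - 1# * - 1# ≈⟨ -‿distribˡ-* 1# (- 1#) ⟨
    - (1# * - 1#) ≈⟨ -‿cong (*-identityˡ (- 1#)) ⟩
    - - 1#      ≈⟨ -‿involutive 1# ⟩
    1#          ∎
    where
    0≤-1 : 0# ≤ - 1#
    0≤-1 = begin
      0#   ≈⟨ -0#≈0# ⟨
      - 0# ≤⟨ neg-mono 1≤0 ⟩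
      - 1# ∎

  1≰0 : 0# < 1#
  1≰0 1≤0 = 0≉1 (antisym 0≤1 1≤0)

  +-nonneg : ∀ {x y} → 0# ≤ x → 0# ≤ y → 0# ≤ x + y
  +-nonneg {x} {y} 0≤x 0≤y = begin
    0#      ≈⟨ +-identityˡ 0# ⟨
    0# + 0# ≤⟨ +-mono-≤ 0≤x 0≤y ⟩
    x + y   ∎

  x≤x+y : ∀ {x y} → 0# ≤ y → x ≤ x + y
  x≤x+y {x} {y} 0≤y = begin
    x      ≈⟨ +-identityʳ x ⟨
    x + 0# ≤⟨ +-mono-≤ ≤-refl 0≤y ⟩
    x + y  ∎

  2≉0 : ¬ (1# + 1# ≈ 0#)
  2≉0 2≈0 = 1≰0 (begin
    1#      ≤⟨ x≤x+y 0≤1 ⟩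
    1# + 1# ≈⟨ 2≈0 ⟩
    0#      ∎)

  ½ : ℝ
  ½ = proj₁ (inverse (1# + 1#) 2≉0)

  ½+½≈1 : ½ + ½ ≈ 1#
  ½+½≈1 = trans (solve 1 (λ x → x :+ x := (con 1 :+ con 1) :* x) refl ½)
                (proj₂ (inverse (1# + 1#) 2≉0))

  halve : ∀ x → ½ * x + ½ * x ≈ x
  halve x = trans (sym (distribʳ x ½ ½)) (trans (*-congʳ ½+½≈1) (*-identityˡ x))

  0≤½ : 0# ≤ ½
  0≤½ with total 0# ½
  ... | inj₁ 0≤½ = 0≤½
  ... | inj₂ ½≤0 = contradiction (begin
    1#      ≈⟨ ½+½≈1 ⟨
    ½ + ½   ≤⟨ +-mono-≤ ½≤0 ½≤0 ⟩
    0# + 0# ≈⟨ +-identityˡ 0# ⟩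
    0#      ∎) 1≰0

  ½^ : ℕ → ℝ
  ½^ zero    = 1#
  ½^ (suc k) = ½ * ½^ k

  ½^-double : ∀ k → ½^ (suc k) + ½^ (suc k) ≈ ½^ k
  ½^-double k = halve (½^ k)

  0≤½^ : ∀ k → 0# ≤ ½^ k
  0≤½^ zero    = 0≤1
  0≤½^ (suc k) = *-nonneg 0≤½ (0≤½^ k)

  0<½^ : ∀ k → 0# < ½^ k
  0<½^ zero    = 1≰0
  0<½^ (suc k) p = 0<½^ k (begin
    ½^ k                    ≈⟨ ½^-double k ⟨
    ½^ (suc k) + ½^ (suc k) ≤⟨ +-mono-≤ p p ⟩
    0# + 0#                 ≈⟨ +-identityˡ 0# ⟩
    0#                      ∎)

  ½^-suc-≤ : ∀ k → ½^ (suc k) ≤ ½^ k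
  ½^-suc-≤ k = ≤-trans (x≤x+y (0≤½^ (suc k))) (≤-reflexive (½^-double k))

  ½^-anti : ∀ {j k} → j ℕ.≤ k → ½^ k ≤ ½^ j
  ½^-anti {zero}  {zero}  _ = ≤-refl
  ½^-anti {zero}  {suc k} _ = ≤-trans (½^-suc-≤ k) (½^-anti {zero} {k} ℕ.z≤n)
  ½^-anti {suc j} {suc k} (ℕ.s≤s j≤k) = *-monoˡ-≤ 0≤½ (½^-anti j≤k)

  ½^≤1 : ∀ k → ½^ k ≤ 1#
  ½^≤1 k = ½^-anti {zero} {k} ℕ.z≤n

  ½^-+ : ∀ j k → ½^ (j ℕ.+ k) ≈ ½^ j * ½^ k
  ½^-+ zero    k = sym (*-identityˡ (½^ k))
  ½^-+ (suc j) k = trans (*-congˡ (½^-+ j k)) (sym (*-assoc ½ (½^ j) (½^ k)))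

  doubled : ℕ → ℝ → ℝ
  doubled zero    x = x
  doubled (suc k) x = doubled k x + doubled k x

  doubled-≤ : ∀ k {x M} → x ≤ ½^ k * M → doubled k x ≤ M
  doubled-≤ zero    {x} {M} x≤M = ≤-trans x≤M (≤-reflexive (*-identityˡ M))
  doubled-≤ (suc k) {x} {M} x≤½^M = begin
    doubled k x + doubled k x ≤⟨ +-mono-≤ step step ⟩
    ½ * M + ½ * M             ≈⟨ halve M ⟩
    M                         ∎
    where
    step : doubled k x ≤ ½ * M
    step = doubled-≤ k (≤-trans x≤½^M (≤-reflexive
      (solve 3 (λ a b c → (a :* b) :* c := b :* (a :* c)) refl ½ (½^ k) M)))

  -- The doublings of `x` are bounded by `M`, so completeness gives their supremum `s`. Doubling a
  -- member gives a member, hence `s ≤ ½ * s` and `x ≤ s ≤ 0#`.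
  archimedean : ∀ {x} M → (∀ k → x ≤ ½^ k * M) → x ≤ 0#
  archimedean {x} M x≤½^M = begin
    x  ≤⟨ proj₁ isSup x (0 , refl) ⟩
    s  ≤⟨ s≤0 ⟩
    0# ∎
    where
    A : ℝ → Set
    A y = ∃ λ k → y ≈ doubled k x
    supremum : ∃ (IsSupremum A)
    supremum = complete A (x , 0 , refl)
      (M , λ y (k , y≈) → ≤-trans (≤-reflexive y≈) (doubled-≤ k (x≤½^M k)))
    s = proj₁ supremum
    isSup = proj₂ supremum
    s≤½s : s ≤ ½ * s
    s≤½s = proj₂ isSup (½ * s) λ y (k , y≈) → begin
      y                     ≈⟨ y≈ ⟩
      doubled k x           ≈⟨ halve (doubled k x) ⟨
      ½ * doubled k x + ½ * doubled k x ≈⟨ distribˡ ½ _ _ ⟨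
      ½ * doubled (suc k) x ≤⟨ *-monoˡ-≤ 0≤½ (proj₁ isSup _ (suc k , refl)) ⟩
      ½ * s                 ∎
    s≤0 : s ≤ 0#
    s≤0 = linear (+-mono-≤ s≤½s s≤½s)
      (trans (+-congˡ (halve s)) (trans (+-comm s s) (sym (+-identityˡ (s + s)))))

  archimedean-≤ : ∀ {x y} M → (∀ k → x ≤ y + ½^ k * M) → x ≤ y
  archimedean-≤ {x} {y} M h = begin
    x            ≈⟨ y-x+x≈y y x ⟨
    (x - y) + y  ≤⟨ +-monoˡ y (archimedean M λ k → +-cancelʳ-≤ y (begin
      (x - y) + y  ≈⟨ y-x+x≈y y x ⟩
      x            ≤⟨ h k ⟩
      y + ½^ k * M ≈⟨ +-comm y _ ⟩
      ½^ k * M + y ∎)) ⟩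
    0# + y       ≈⟨ +-identityˡ y ⟩
    y            ∎

-- Digit sequences and agreement of prefixes

Cantor : Set
Cantor = ℕ → Bool

infixr 5 _◂_
_◂_ : Bool → Cantor → Cantor
(b ◂ a) zero    = b
(b ◂ a) (suc l) = a l

Agree₁ : ℕ → Cantor → Cantor → Set
Agree₁ k a b = ∀ l → l ℕ.< k → a l ≡ b l

Agree : ℕ → ∀ {n} → Vec Cantor n → Vec Cantor n → Set
Agree k = Pointwise (Agree₁ k)

Agree₁-refl : ∀ {k a} → Agree₁ k a a
Agree₁-refl _ _ = ≡.refl

Agree₁-sym : ∀ {k a b} → Agree₁ k a b → Agree₁ k b a
Agree₁-sym ag l l<k = ≡.sym (ag l l<k)

Agree₁-anti : ∀ {j k a b} → j ℕ.≤ k → Agree₁ k a b → Agree₁ j a b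
Agree₁-anti j≤k ag l l<j = ag l (ℕₚ.<-≤-trans l<j j≤k)

Agree₁-◂ : ∀ {k} b {x y} → Agree₁ k x y → Agree₁ (suc k) (b ◂ x) (b ◂ y)
Agree₁-◂ b ag zero    _           = ≡.refl
Agree₁-◂ b ag (suc l) (ℕ.s≤s l<k) = ag l l<k

Agree-refl : ∀ {k n} {x : Vec Cantor n} → Agree k x x
Agree-refl {x = []}    = []
Agree-refl {x = a ∷ x} = Agree₁-refl ∷ Agree-refl

Agree-sym : ∀ {k n} {x y : Vec Cantor n} → Agree k x y → Agree k y x
Agree-sym []        = []
Agree-sym (ag ∷ ags) = Agree₁-sym ag ∷ Agree-sym ags

Agree-anti : ∀ {j k n} {x y : Vec Cantor n} → j ℕ.≤ k → Agree k x y → Agree j x y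
Agree-anti j≤k []         = []
Agree-anti j≤k (ag ∷ ags) = Agree₁-anti j≤k ag ∷ Agree-anti j≤k ags

-- Finite averages over digits

module Integration (R : RealField) (em : ∀ {ℓ} → ExcludedMiddle ℓ) where

  open OrderedField R

  -- A positive linear functional on all functions: only finite weighted sums are ever formed, so
  -- integrability is no issue. The total mass is left open because the distribution of shifted
  -- pairs has mass less than 1.
  record Functional (X : Set) : Set where
    field
      ∫       : (X → ℝ) → ℝ
      ∫-mono  : ∀ {φ ψ} → (∀ x → φ x ≤ ψ x) → ∫ φ ≤ ∫ ψ
      ∫-+     : ∀ φ ψ → ∫ (λ x → φ x + ψ x) ≈ ∫ φ + ∫ ψ
      ∫-scale : ∀ c φ → ∫ (λ x → c * φ x) ≈ c * ∫ φ

    ∫-cong : ∀ {φ ψ} → (∀ x → φ x ≈ ψ x) → ∫ φ ≈ ∫ ψ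
    ∫-cong φ≈ψ = antisym (∫-mono (≤-reflexive ∘ φ≈ψ)) (∫-mono (≤-reflexive ∘ sym ∘ φ≈ψ))

    ∫-<⇒∃ : ∀ {φ ψ} → ∫ φ < ∫ ψ → ∃ λ x → φ x < ψ x
    ∫-<⇒∃ {φ} {ψ} ∫φ<∫ψ with em {P = ∃ λ x → φ x < ψ x}
    ... | yes p = p
    ... | no ¬p = contradiction (∫-mono λ x → ≮⇒≥ λ φ<ψ → ¬p (x , φ<ψ)) ∫φ<∫ψ

  open Functional public

  dirac : {X : Set} → X → Functional X
  dirac x = record
    { ∫ = λ φ → φ x ; ∫-mono = λ p → p x
    ; ∫-+ = λ _ _ → refl ; ∫-scale = λ _ _ → refl }

  mapF : {X Y : Set} → (X → Y) → Functional X → Functional Y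
  mapF f I = record
    { ∫ = λ φ → ∫ I (φ ∘ f)
    ; ∫-mono = λ p → ∫-mono I (p ∘ f)
    ; ∫-+ = λ φ ψ → ∫-+ I (φ ∘ f) (ψ ∘ f)
    ; ∫-scale = λ c φ → ∫-scale I c (φ ∘ f) }

  bindF : {X Y : Set} → Functional X → (X → Functional Y) → Functional Y
  bindF I J = record
    { ∫ = λ φ → ∫ I λ x → ∫ (J x) φ
    ; ∫-mono = λ p → ∫-mono I λ x → ∫-mono (J x) p
    ; ∫-+ = λ φ ψ → trans (∫-cong I λ x → ∫-+ (J x) φ ψ) (∫-+ I _ _)
    ; ∫-scale = λ c φ → trans (∫-cong I λ x → ∫-scale (J x) c φ) (∫-scale I c _) }

  scaleF : {X : Set} (c : ℝ) → 0# ≤ c → Functional X → Functional X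
  scaleF c 0≤c I = record
    { ∫ = λ φ → c * ∫ I φ
    ; ∫-mono = λ p → *-monoˡ-≤ 0≤c (∫-mono I p)
    ; ∫-+ = λ φ ψ → trans (*-congˡ (∫-+ I φ ψ)) (distribˡ c _ _)
    ; ∫-scale = λ d φ → trans (*-congˡ (∫-scale I d φ))
        (solve 3 (λ c d x → c :* (d :* x) := d :* (c :* x)) refl c d (∫ I φ)) }

  midpoint : {X : Set} → Functional X → Functional X → Functional X
  midpoint I J = record
    { ∫ = λ φ → ½ * ∫ I φ + ½ * ∫ J φ
    ; ∫-mono = λ p → +-mono-≤ (*-monoˡ-≤ 0≤½ (∫-mono I p)) (*-monoˡ-≤ 0≤½ (∫-mono J p))
    ; ∫-+ = λ φ ψ → trans (+-cong (*-congˡ (∫-+ I φ ψ)) (*-congˡ (∫-+ J φ ψ)))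
        (solve 5 (λ h a b c d → h :* (a :+ b) :+ h :* (c :+ d) := (h :* a :+ h :* c) :+ (h :* b :+ h :* d))
          refl ½ (∫ I φ) (∫ I ψ) (∫ J φ) (∫ J ψ))
    ; ∫-scale = λ d φ → trans (+-cong (*-congˡ (∫-scale I d φ)) (*-congˡ (∫-scale J d φ)))
        (solve 4 (λ h d a b → h :* (d :* a) :+ h :* (d :* b) := d :* (h :* a :+ h :* b))
          refl ½ d (∫ I φ) (∫ J φ)) }

  -- The uniform distribution on the first `k` digits, with later digits `false`. On functions of
  -- the first `k` digits it is the integral for the fair-coin measure.
  avg : ℕ → Functional Cantor
  avg zero    = dirac (λ _ → false)
  avg (suc k) = midpoint (mapF (false ◂_) (avg k)) (mapF (true ◂_) (avg k))

  Avg : ∀ n → ℕ → Functional (Vec Cantor n)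
  Avg zero    k = dirac []
  Avg (suc n) k = bindF (avg k) λ a → mapF (a ∷_) (Avg n k)

  Dep₁ : ℕ → (Cantor → ℝ) → Set
  Dep₁ k φ = ∀ {a b} → Agree₁ k a b → φ a ≈ φ b

  Dep : ℕ → ∀ {n} → (Vec Cantor n → ℝ) → Set
  Dep k φ = ∀ {x y} → Agree k x y → φ x ≈ φ y

  Dep₁-◂ : ∀ {k φ} b → Dep₁ (suc k) φ → Dep₁ k (φ ∘ (b ◂_))
  Dep₁-◂ b dep ag = dep (Agree₁-◂ b ag)

  avg-const : ∀ k c → ∫ (avg k) (λ _ → c) ≈ c
  avg-const zero    c = refl
  avg-const (suc k) c = trans (+-cong (*-congˡ (avg-const k c)) (*-congˡ (avg-const k c))) (halve c)

  Avg-const : ∀ n k c → ∫ (Avg n k) (λ _ → c) ≈ c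
  Avg-const zero    k c = refl
  Avg-const (suc n) k c = trans (∫-cong (avg k) λ _ → Avg-const n k c) (avg-const k c)

  avg-dep₀ : ∀ k {φ} → Dep₁ 0 φ → ∀ a → ∫ (avg k) φ ≈ φ a
  avg-dep₀ k {φ} dep a = trans (∫-cong (avg k) λ _ → dep λ _ ()) (avg-const k (φ a))

  avg-level : ∀ {j k φ} → j ℕ.≤ k → Dep₁ j φ → ∫ (avg j) φ ≈ ∫ (avg k) φ
  avg-level {zero}  {k}     _           dep = sym (avg-dep₀ k dep _)
  avg-level {suc j} {suc k} (ℕ.s≤s j≤k) dep =
    +-cong (*-congˡ (avg-level j≤k (Dep₁-◂ false dep))) (*-congˡ (avg-level j≤k (Dep₁-◂ true dep)))

  Avg-dep : ∀ {j n} k {φ : Vec Cantor (suc n) → ℝ} → Dep j φ → Dep₁ j λ a → ∫ (Avg n k) (φ ∘ (a ∷_))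
  Avg-dep {n = n} k dep ag = ∫-cong (Avg n k) λ x → dep (ag ∷ Agree-refl {x = x})

  Avg-level : ∀ {j k n} {φ : Vec Cantor n → ℝ} → j ℕ.≤ k → Dep j φ → ∫ (Avg n j) φ ≈ ∫ (Avg n k) φ
  Avg-level {n = zero}  _ _ = refl
  Avg-level {j} {k} {n = suc n} {φ} j≤k dep = trans
    (∫-cong (avg j) λ a → Avg-level j≤k (λ ag → dep (Agree₁-refl ∷ ag)))
    (avg-level j≤k (Avg-dep k {φ} dep))

  -- Greedy bisection: one of the two halves keeps all the averages ≤ b, since
  -- otherwise a common later term of the increasing sequence fails on both.
  module Bisection (b : ℝ) (φ : ℕ → Cantor → ℝ) (lev : ℕ → ℕ)
    (inc : ∀ {M N} → M ℕ.≤ N → ∀ a → φ M a ≤ φ N a) (dep : ∀ N → Dep₁ (lev N) (φ N)) where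

    Bounded : (Cantor → Cantor) → Set
    Bounded f = ∀ N k → lev N ℕ.≤ k → ∫ (avg k) (φ N ∘ f) ≤ b

    Shrinks : (Cantor → Cantor) → Set
    Shrinks f = ∀ {k a c} → Agree₁ k a c → Agree₁ k (f a) (f c)

    ◂-shrinks : ∀ {f} c → Shrinks f → Shrinks (f ∘ (c ◂_))
    ◂-shrinks c sh ag = sh λ { zero _ → ≡.refl ; (suc l) (ℕ.s≤s l<k) → ag l (ℕₚ.m<n⇒m<1+n l<k) }

    fails : ∀ {f} → ¬ Bounded f → ∃ λ N → ∃ λ k → lev N ℕ.≤ k × b < ∫ (avg k) (φ N ∘ f)
    fails {f} ¬bd with em {P = ∃ λ N → ∃ λ k → lev N ℕ.≤ k × b < ∫ (avg k) (φ N ∘ f)}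
    ... | yes p = p
    ... | no ¬p = contradiction (λ N k le → ≮⇒≥ λ lt → ¬p (N , k , le , lt)) ¬bd

    raise : ∀ {f M N j k} → Shrinks f → M ℕ.≤ N → lev M ℕ.≤ j → j ℕ.≤ k →
            b < ∫ (avg j) (φ M ∘ f) → b < ∫ (avg k) (φ N ∘ f)
    raise {f} {M} {N} {j} {k} sh M≤N le j≤k lt ≤b = lt (begin
      ∫ (avg j) (φ M ∘ f) ≈⟨ avg-level j≤k (λ ag → dep M (Agree₁-anti le (sh ag))) ⟩
      ∫ (avg k) (φ M ∘ f) ≤⟨ ∫-mono (avg k) (λ a → inc M≤N (f a)) ⟩
      ∫ (avg k) (φ N ∘ f) ≤⟨ ≤b ⟩
      b                   ∎)

    pick : ∀ f → Shrinks f → Bounded f → ∃ λ c → Bounded (f ∘ (c ◂_))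
    pick f sh bd with em {P = Bounded (f ∘ (false ◂_))} | em {P = Bounded (f ∘ (true ◂_))}
    ... | yes p | _     = false , p
    ... | no _  | yes p = true , p
    ... | no ¬p | no ¬q with fails ¬p | fails ¬q
    ... | M , j , le₁ , lt₁ | N , k , le₂ , lt₂ =
      -- By definition the average at level `suc i` is the midpoint of `A` and `B`, the averages of
      -- the two halves at level `i`; the smaller of them would be at most `b`.
      contradiction (bd P (suc i) (ℕₚ.m≤n⇒m≤1+n P≤i)) λ ≤b → case≤ (total A B) ≤b
      where
      P = M ℕ.⊔ N
      i = lev P ℕ.⊔ (j ℕ.⊔ k)
      P≤i = ℕₚ.m≤m⊔n (lev P) (j ℕ.⊔ k)
      A = ∫ (avg i) (φ P ∘ f ∘ (false ◂_))
      B = ∫ (avg i) (φ P ∘ f ∘ (true ◂_))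
      b<A : b < A
      b<A = raise (◂-shrinks false sh) (ℕₚ.m≤m⊔n M N) le₁
        (ℕₚ.≤-trans (ℕₚ.m≤m⊔n j k) (ℕₚ.m≤n⊔m (lev P) _)) lt₁
      b<B : b < B
      b<B = raise (◂-shrinks true sh) (ℕₚ.m≤n⊔m M N) le₂
        (ℕₚ.≤-trans (ℕₚ.m≤n⊔m j k) (ℕₚ.m≤n⊔m (lev P) _)) lt₂
      case≤ : A ≤ B ⊎ B ≤ A → ¬ (½ * A + ½ * B ≤ b)
      case≤ (inj₁ A≤B) h = b<A (begin
        A             ≈⟨ halve A ⟨
        ½ * A + ½ * A ≤⟨ +-mono-≤ ≤-refl (*-monoˡ-≤ 0≤½ A≤B) ⟩
        ½ * A + ½ * B ≤⟨ h ⟩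
        b             ∎)
      case≤ (inj₂ B≤A) h = b<B (begin
        B             ≈⟨ halve B ⟨
        ½ * B + ½ * B ≤⟨ +-mono-≤ (*-monoˡ-≤ 0≤½ B≤A) ≤-refl ⟩
        ½ * A + ½ * B ≤⟨ h ⟩
        b             ∎)

    State : Set
    State = ∃ λ f → Shrinks f × Bounded f

    next : State → Bool × State
    next (f , sh , bd) with pick f sh bd
    ... | c , bd′ = c , f ∘ (c ◂_) , ◂-shrinks c sh , bd′

    module _ (init : Bounded id) where

      state : ℕ → State
      state zero    = id , (λ ag → ag) , init
      state (suc k) = proj₂ (next (state k))

      limit : Cantor
      limit k = proj₁ (next (state k))

      state-tail : ∀ k y l → proj₁ (state k) y (l ℕ.+ k) ≡ y l
      state-tail zero    y l = ≡.cong y (ℕₚ.+-identityʳ l)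
      state-tail (suc k) y l rewrite ℕₚ.+-suc l k = state-tail k (limit k ◂ y) (suc l)

      state-agrees : ∀ k y → Agree₁ k (proj₁ (state k) y) limit
      state-agrees (suc k) y l (ℕ.s≤s l≤k) with ℕₚ.m≤n⇒m<n∨m≡n l≤k
      ... | inj₁ l<k    = state-agrees k (limit k ◂ y) l l<k
      ... | inj₂ ≡.refl = state-tail k (limit k ◂ y) 0

      -- After `lev N` steps every digit on which `φ N` depends is fixed, so the average that is
      -- kept below `b` is the value at the limit.
      limit-bounded : ∀ N → φ N limit ≤ b
      limit-bounded N = begin
        φ N limit                                  ≈⟨ avg-const (lev N) _ ⟨
        ∫ (avg (lev N)) (λ _ → φ N limit)          ≈⟨ ∫-cong (avg (lev N)) (λ y → dep N (state-agrees (lev N) y)) ⟨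
        ∫ (avg (lev N)) (φ N ∘ proj₁ (state (lev N))) ≤⟨ proj₂ (proj₂ (state (lev N))) N (lev N) ℕₚ.≤-refl ⟩
        b                                          ∎

  Avg-mono-level : ∀ {j k n} {φ ψ : Vec Cantor n → ℝ} → Dep j φ → Dep k ψ →
                   (∀ x → φ x ≤ ψ x) → ∫ (Avg n j) φ ≤ ∫ (Avg n k) ψ
  Avg-mono-level {j} {k} {n} {φ} {ψ} depφ depψ φ≤ψ = begin
    ∫ (Avg n j) φ         ≈⟨ Avg-level (ℕₚ.m≤m⊔n j k) depφ ⟩
    ∫ (Avg n (j ℕ.⊔ k)) φ ≤⟨ ∫-mono (Avg n (j ℕ.⊔ k)) φ≤ψ ⟩
    ∫ (Avg n (j ℕ.⊔ k)) ψ ≈⟨ Avg-level (ℕₚ.m≤n⊔m j k) depψ ⟨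
    ∫ (Avg n k) ψ         ∎

  -- One point serves all `N` at once, which replaces monotone convergence. Coordinates are fixed
  -- one by one: averaging over the others leaves an increasing sequence of functions on a single
  -- `Cantor`, to which bisection applies.
  greedy : ∀ {n b} (φ : ℕ → Vec Cantor n → ℝ) (lev : ℕ → ℕ) →
           (∀ {M N} → M ℕ.≤ N → ∀ x → φ M x ≤ φ N x) → (∀ N → Dep (lev N) (φ N)) →
           (∀ N → ∫ (Avg n (lev N)) (φ N) ≤ b) → ∃ λ x → ∀ N → φ N x ≤ b
  greedy {zero}      φ lev inc dep bd = [] , bd
  greedy {suc n} {b} φ lev inc dep bd =
    let x , bdx = greedy (λ N → φ N ∘ (a ∷_)) lev (λ M≤N → inc M≤N ∘ (a ∷_))
                    (λ N ag → dep N (Agree₁-refl ∷ ag)) (limit-bounded init)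
    in a ∷ x , bdx
    where
    Φ : ℕ → Cantor → ℝ
    Φ N a = ∫ (Avg n (lev N)) (φ N ∘ (a ∷_))
    Φ-dep : ∀ N → Dep₁ (lev N) (Φ N)
    Φ-dep N = Avg-dep (lev N) {φ N} (dep N)
    open Bisection b Φ lev
      (λ {M} {N} M≤N a → Avg-mono-level {φ = φ M ∘ (a ∷_)} {ψ = φ N ∘ (a ∷_)}
        (λ ag → dep M (Agree₁-refl ∷ ag)) (λ ag → dep N (Agree₁-refl ∷ ag)) (inc M≤N ∘ (a ∷_)))
      Φ-dep
    init : Bounded id
    init N k le = ≤-trans (≤-reflexive (sym (avg-level le (Φ-dep N)))) (bd N)
    a = limit init


-- Binary numerals

bit : Bool → ℕ
bit false = 0
bit true  = 1

val : ℕ → Cantor → ℕ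
val zero    a = 0
val (suc k) a = bit (a 0) ℕ.* 2 ℕ.^ k ℕ.+ val k (a ∘ suc)

-- The definition of `val` peels off the leading digit, as `avg` does; refining a binary
-- approximation appends a last one.
val-snoc : ∀ k a → val (suc k) a ≡ (val k a ℕ.+ val k a) ℕ.+ bit (a k)
val-snoc zero    a = solveℕ 1 (λ b → b ⊛ conℕ 1 ⊕ conℕ 0 ⊜ b) ≡.refl (bit (a 0))
val-snoc (suc k) a rewrite val-snoc k (a ∘ suc) =
  solveℕ 4 (λ b t v c → b ⊛ (t ⊕ (t ⊕ conℕ 0)) ⊕ (v ⊕ v ⊕ c) ⊜ (b ⊛ t ⊕ v) ⊕ (b ⊛ t ⊕ v) ⊕ c)
    ≡.refl (bit (a 0)) (2 ℕ.^ k) (val k (a ∘ suc)) (bit (a (suc k)))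

val-agree : ∀ {k a b} → Agree₁ k a b → val k a ≡ val k b
val-agree {zero}  ag = ≡.refl
val-agree {suc k} ag = ≡.cong₂ (λ c v → bit c ℕ.* 2 ℕ.^ k ℕ.+ v)
  (ag 0 (ℕ.s≤s ℕ.z≤n)) (val-agree λ l l<k → ag (suc l) (ℕ.s≤s l<k))

bits : ℕ → ℕ → Cantor
bits zero    z = λ _ → false
bits (suc k) z with z ℕₚ.<? 2 ℕ.^ k
... | yes _ = false ◂ bits k z
... | no  _ = true ◂ bits k (z ℕ.∸ 2 ℕ.^ k)

bits-low : ∀ k {z} → z ℕ.< 2 ℕ.^ k → bits (suc k) z ≡ false ◂ bits k z
bits-low k {z} z<2^k with z ℕₚ.<? 2 ℕ.^ k
... | yes _ = ≡.refl
... | no ¬p = contradiction z<2^k ¬p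

bits-high : ∀ k z → bits (suc k) (2 ℕ.^ k ℕ.+ z) ≡ true ◂ bits k z
bits-high k z with (2 ℕ.^ k ℕ.+ z) ℕₚ.<? 2 ℕ.^ k
... | yes p = contradiction p (ℕₚ.m+n≮m (2 ℕ.^ k) z)
... | no _  = ≡.cong (λ y → true ◂ bits k y) (ℕₚ.m+n∸m≡n (2 ℕ.^ k) z)

val-bits : ∀ k {z} → z ℕ.< 2 ℕ.^ k → val k (bits k z) ≡ z
val-bits zero    (ℕ.s≤s ℕ.z≤n) = ≡.refl
val-bits (suc k) {z} z<2^1+k with z ℕₚ.<? 2 ℕ.^ k
... | yes z<2^k = val-bits k z<2^k
... | no  z≮2^k = ≡.trans
  (≡.cong₂ ℕ._+_ (ℕₚ.+-identityʳ (2 ℕ.^ k)) (val-bits k z∸<))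
  (ℕₚ.m+[n∸m]≡n (ℕₚ.≮⇒≥ z≮2^k))
  where
  z∸< : z ℕ.∸ 2 ℕ.^ k ℕ.< 2 ℕ.^ k
  z∸< = ℕₚ.+-cancelˡ-< (2 ℕ.^ k) _ _ (≡.subst₂ ℕ._<_
    (≡.sym (ℕₚ.m+[n∸m]≡n (ℕₚ.≮⇒≥ z≮2^k))) (≡.cong (2 ℕ.^ k ℕ.+_) (ℕₚ.+-identityʳ (2 ℕ.^ k))) z<2^1+k)

-- Compactness of the space of digit sequences

module Compactness (em : ∀ {ℓ} → ExcludedMiddle ℓ) where

  HasClusterPoints : (X : Set) → (ℕ → X → X → Set) → Set
  HasClusterPoints X _~⟨_⟩_ = ∀ (z : ℕ → X) → ∃ λ x → ∀ L M → ∃ λ N → M ℕ.≤ N × (L ~⟨ x ⟩ z N)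

  -- König's lemma. A digit is `true` if infinitely many of the surviving terms have `true` there;
  -- otherwise all but finitely many survivors have `false`.
  cantor-cluster : HasClusterPoints Cantor λ L → Agree₁ L
  cantor-cluster z = limit , λ L M → let N , M≤N , p = infinite L M in N , M≤N , agrees L p
    where
    Infinite : (ℕ → Set) → Set
    Infinite I = ∀ M → ∃ λ N → M ℕ.≤ N × I N

    pick : (ℕ → Set) → ℕ → Bool
    pick I L = does (em {P = Infinite λ N → I N × z N L ≡ true})

    bool-split : ∀ b → b ≢ true → b ≡ false
    bool-split false _ = ≡.refl
    bool-split true  p = contradiction ≡.refl p

    pick-infinite : ∀ I L → Infinite I → Infinite λ N → I N × z N L ≡ pick I L
    pick-infinite I L inf with em {P = Infinite λ N → I N × z N L ≡ true}
    ... | yes p = p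
    ... | no ¬p = λ M → let M₀ , none = bound in
      let N , le , i = inf (M ℕ.⊔ M₀) in
      N , ℕₚ.≤-trans (ℕₚ.m≤m⊔n M M₀) le , i ,
      bool-split (z N L) λ eq → none N (ℕₚ.≤-trans (ℕₚ.m≤n⊔m M M₀) le) (i , eq)
      where
      bound : ∃ λ M₀ → ∀ N → M₀ ℕ.≤ N → ¬ (I N × z N L ≡ true)
      bound with em {P = ∃ λ M₀ → ∀ N → M₀ ℕ.≤ N → ¬ (I N × z N L ≡ true)}
      ... | yes b = b
      ... | no ¬b = contradiction infinite′ ¬p
        where
        infinite′ : Infinite λ N → I N × z N L ≡ true
        infinite′ M with em {P = ∃ λ N → M ℕ.≤ N × I N × z N L ≡ true}
        ... | yes q = q
        ... | no ¬q = contradiction (M , λ N le i → ¬q (N , le , i)) ¬b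

    survivors : ℕ → ℕ → Set
    limit : ℕ → Bool
    -- Any inhabited set would serve here: at the start every index survives.
    survivors zero    N = ℕ
    survivors (suc L) N = survivors L N × z N L ≡ pick (survivors L) L
    limit L = pick (survivors L) L

    infinite : ∀ L → Infinite (survivors L)
    infinite zero    M = M , ℕₚ.≤-refl , 0
    infinite (suc L) = pick-infinite (survivors L) L (infinite L)

    agrees : ∀ L {N} → survivors L N → Agree₁ L limit (z N)
    agrees (suc L) (p , eq) l (ℕ.s≤s l≤L) with ℕₚ.m≤n⇒m<n∨m≡n l≤L
    ... | inj₁ l<L    = agrees L p l l<L
    ... | inj₂ ≡.refl = ≡.sym eq

  -- The term `sub L` agrees with `x` to depth `L`, and `y` is a cluster point of the second
  -- components along `sub`. A late index `L′` gives more agreement with `x` than is asked, which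
  -- `anti` cuts down.
  pair-cluster : ∀ {X Y} A B → HasClusterPoints X A → HasClusterPoints Y B →
                 (∀ {j k x x′} → j ℕ.≤ k → A k x x′ → A j x x′) →
                 HasClusterPoints (X × Y) λ L (x , y) (x′ , y′) → A L x x′ × B L y y′
  pair-cluster A B clX clY anti z =
    let x , near  = clX (proj₁ ∘ z)
        sub       = λ L → proj₁ (near L L)
        y , near′ = clY (λ L → proj₂ (z (sub L)))
    in (x , y) , λ L M →
       let L′ , le , b = near′ L (L ℕ.⊔ M)
           N , L′≤N , a = near L′ L′
       in N , ℕₚ.≤-trans (ℕₚ.m≤n⊔m L M) (ℕₚ.≤-trans le L′≤N) ,
          anti (ℕₚ.≤-trans (ℕₚ.m≤m⊔n L M) le) a , b

  vec-cluster : ∀ n → HasClusterPoints (Vec Cantor n) λ L → Agree L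
  vec-cluster zero    z = [] , λ L M → M , ℕₚ.≤-refl , agree[] (z M)
    where
    agree[] : ∀ {L} (x : Vec Cantor 0) → Agree L [] x
    agree[] [] = []
  vec-cluster (suc n) z =
    let (a , x) , near = pair-cluster (λ L → Agree₁ L) (λ L → Agree L)
          cantor-cluster (vec-cluster n) Agree₁-anti (uncons ∘ z)
    in a ∷ x , λ L M → let N , le , p = near L M in N , le , recons (z N) p
    where
    uncons : Vec Cantor (suc n) → Cantor × Vec Cantor n
    uncons (a ∷ x) = a , x
    recons : ∀ {L a x} y → Agree₁ L a (proj₁ (uncons y)) × Agree L x (proj₂ (uncons y)) → Agree L (a ∷ x) y
    recons (b ∷ y) (p , q) = p ∷ q

-- Counting grid points under translation

module Shift (R : RealField) (em : ∀ {ℓ} → ExcludedMiddle ℓ) where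

  open OrderedField R
  open Integration R em
  open SemiringSum semiring using (sum; ∑-distrib-+; *-distribˡ-sum)

  sum-mono : ∀ N {f g : Fin N → ℝ} → (∀ i → f i ≤ g i) → sum f ≤ sum g
  sum-mono zero    f≤g = ≤-refl
  sum-mono (suc N) f≤g = +-mono-≤ (f≤g Fin.zero) (sum-mono N (f≤g ∘ Fin.suc))

  sumF : ∀ N → Functional (Fin N)
  sumF N = record
    { ∫ = sum
    ; ∫-mono = sum-mono N
    ; ∫-+ = ∑-distrib-+
    ; ∫-scale = λ c f → sym (*-distribˡ-sum c f) }

  Σ< : ℕ → (ℕ → ℝ) → ℝ
  Σ< N f = sum {N} (f ∘ toℕ)

  Σ<-cong : ∀ N {f g : ℕ → ℝ} → (∀ z → z ℕ.< N → f z ≈ g z) → Σ< N f ≈ Σ< N g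
  Σ<-cong N f≈g = ∫-cong (sumF N) λ i → f≈g (toℕ i) (Finₚ.toℕ<n i)

  Σ<-split : ∀ M N f → Σ< (M ℕ.+ N) f ≈ Σ< M f + Σ< N (f ∘ (M ℕ.+_))
  Σ<-split zero    N f = sym (+-identityˡ _)
  Σ<-split (suc M) N f = trans (+-congˡ (Σ<-split M N (f ∘ suc))) (sym (+-assoc _ _ _))

  Σ<-nonneg : ∀ N {f : ℕ → ℝ} → (∀ z → 0# ≤ f z) → 0# ≤ Σ< N f
  Σ<-nonneg zero    f≥0 = ≤-refl
  Σ<-nonneg (suc N) f≥0 = +-nonneg (f≥0 0) (Σ<-nonneg N (f≥0 ∘ suc))

  Σ<-shift : ∀ p {N M} {f : ℕ → ℝ} → (∀ z → 0# ≤ f z) → p ℕ.+ N ℕ.≤ M →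
             Σ< N (f ∘ (p ℕ.+_)) ≤ Σ< M f
  Σ<-shift p {N} {M} {f} f≥0 p+N≤M = begin
    Σ< N (f ∘ (p ℕ.+_))          ≤⟨ x≤x+y (Σ<-nonneg p f≥0) ⟩
    Σ< N (f ∘ (p ℕ.+_)) + Σ< p f ≈⟨ +-comm _ _ ⟩
    Σ< p f + Σ< N (f ∘ (p ℕ.+_)) ≈⟨ Σ<-split p N f ⟨
    Σ< (p ℕ.+ N) f               ≤⟨ x≤x+y (Σ<-nonneg (M ℕ.∸ (p ℕ.+ N)) (λ z → f≥0 ((p ℕ.+ N) ℕ.+ z))) ⟩
    Σ< (p ℕ.+ N) f + Σ< (M ℕ.∸ (p ℕ.+ N)) (f ∘ ((p ℕ.+ N) ℕ.+_)) ≈⟨ Σ<-split (p ℕ.+ N) _ f ⟨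
    Σ< ((p ℕ.+ N) ℕ.+ (M ℕ.∸ (p ℕ.+ N))) f ≡⟨ ≡.cong (λ m → Σ< m f) (ℕₚ.m+[n∸m]≡n p+N≤M) ⟩
    Σ< M f                       ∎

  -- `avg` branches on digits. Listing the same points by the number `z` that they spell turns the
  -- addition of a constant into a shift of the summation index.
  avg-grid : ∀ k g → ∫ (avg k) g ≈ ½^ k * Σ< (2 ℕ.^ k) (g ∘ bits k)
  avg-grid zero    g = sym (trans (*-identityˡ _) (+-identityʳ _))
  avg-grid (suc k) g = begin-equality
    ½ * ∫ (avg k) (g ∘ (false ◂_)) + ½ * ∫ (avg k) (g ∘ (true ◂_))
      ≈⟨ +-cong (*-congˡ (avg-grid k _)) (*-congˡ (avg-grid k _)) ⟩
    ½ * (½^ k * A) + ½ * (½^ k * B)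
      ≈⟨ solve 4 (λ h p a b → h :* (p :* a) :+ h :* (p :* b) := (h :* p) :* (a :+ b)) refl ½ (½^ k) A B ⟩
    ½^ (suc k) * (A + B)
      ≈⟨ *-congˡ (trans (Σ<-split (2 ℕ.^ k) _ (g ∘ bits (suc k))) (+-cong
           (Σ<-cong (2 ℕ.^ k) λ z z< → reflexive (≡.cong g (bits-low k z<)))
           (trans (reflexive (≡.cong (λ m → Σ< m (g ∘ bits (suc k) ∘ (2 ℕ.^ k ℕ.+_))) (ℕₚ.+-identityʳ (2 ℕ.^ k))))
             (Σ<-cong (2 ℕ.^ k) λ z _ → reflexive (≡.cong g (bits-high k z)))))) ⟨
    ½^ (suc k) * Σ< (2 ℕ.^ suc k) (g ∘ bits (suc k)) ∎
    where
    A = Σ< (2 ℕ.^ k) (g ∘ (false ◂_) ∘ bits k)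
    B = Σ< (2 ℕ.^ k) (g ∘ (true ◂_) ∘ bits k)

  Avg-nonneg : ∀ n k {g : Vec Cantor n → ℝ} → (∀ x → 0# ≤ g x) → 0# ≤ ∫ (Avg n k) g
  Avg-nonneg n k g≥0 = ≤-trans (≤-reflexive (sym (Avg-const n k 0#))) (∫-mono (Avg n k) g≥0)

  module GridPairs (k : ℕ) where

    -- The equation is `a - b = p - q` in units of the last digit, arranged to avoid subtraction in
    -- `ℕ`.
    Pair : (k₀ p q : ℕ) → Set
    Pair k₀ p q = ∃ λ ((a , b) : Cantor × Cantor) → Agree₁ k₀ a b ×
      val (k₀ ℕ.+ suc k) a ℕ.+ q ≡ val (k₀ ℕ.+ suc k) b ℕ.+ p

    fstP : ∀ {k₀ p q} → Pair k₀ p q → Cantor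
    fstP = proj₁ ∘ proj₁

    sndP : ∀ {k₀ p q} → Pair k₀ p q → Cantor
    sndP = proj₂ ∘ proj₁

    shift-bound : ∀ {p} y → p ℕ.≤ 2 ℕ.^ k → y ℕ.< 2 ℕ.^ k → p ℕ.+ y ℕ.< 2 ℕ.^ suc k
    shift-bound y p≤ y< rewrite ℕₚ.+-identityʳ (2 ℕ.^ k) = ℕₚ.+-mono-≤-< p≤ y<

    base-pair : ∀ {p q} → p ℕ.≤ 2 ℕ.^ k → q ℕ.≤ 2 ℕ.^ k → Fin (2 ℕ.^ k) → Pair 0 p q
    base-pair {p} {q} p≤ q≤ y = (bits (suc k) (p ℕ.+ toℕ y) , bits (suc k) (q ℕ.+ toℕ y)) , (λ _ ()) ,
      ≡.subst₂ (λ s t → s ℕ.+ q ≡ t ℕ.+ p)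
        (≡.sym (val-bits (suc k) (shift-bound (toℕ y) p≤ (Finₚ.toℕ<n y))))
        (≡.sym (val-bits (suc k) (shift-bound (toℕ y) q≤ (Finₚ.toℕ<n y))))
        (solveℕ 3 (λ p q y → p ⊕ y ⊕ q ⊜ q ⊕ y ⊕ p) ≡.refl p q (toℕ y))

    infixr 5 _◂ᴾ_
    _◂ᴾ_ : ∀ {k₀ p q} → Bool → Pair k₀ p q → Pair (suc k₀) p q
    _◂ᴾ_ {k₀} {p} {q} c ((a , b) , ag , eq) = (c ◂ a , c ◂ b) , Agree₁-◂ c ag ,
      ≡.trans (ℕₚ.+-assoc t _ q) (≡.trans (≡.cong (t ℕ.+_) eq) (≡.sym (ℕₚ.+-assoc t _ p)))
      where t = bit c ℕ.* 2 ℕ.^ (k₀ ℕ.+ suc k)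

    -- The distribution of the pair (x + p, x + q) in units of the last bit, where
    -- x has k₀ + 1 + k random bits, conditioned to have a zero after the first k₀:
    -- this leaves room for the carry.  The factor ½ of the condition is kept.
    pairs₁ : ∀ k₀ {p q} → p ℕ.≤ 2 ℕ.^ k → q ℕ.≤ 2 ℕ.^ k → Functional (Pair k₀ p q)
    pairs₁ zero p≤ q≤ = mapF (base-pair p≤ q≤) (scaleF (½^ (suc k)) (0≤½^ (suc k)) (sumF (2 ℕ.^ k)))
    pairs₁ (suc k₀) p≤ q≤ = midpoint (mapF (false ◂ᴾ_) (pairs₁ k₀ p≤ q≤)) (mapF (true ◂ᴾ_) (pairs₁ k₀ p≤ q≤))

    shifted-≤-avg : ∀ {p} {g : Cantor → ℝ} → p ℕ.≤ 2 ℕ.^ k → (∀ a → 0# ≤ g a) →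
      ½^ (suc k) * Σ< (2 ℕ.^ k) (λ y → g (bits (suc k) (p ℕ.+ y))) ≤ ∫ (avg (suc k)) g
    shifted-≤-avg {p} {g} p≤ g≥0 = begin
      ½^ (suc k) * Σ< (2 ℕ.^ k) (λ y → g (bits (suc k) (p ℕ.+ y)))
        ≤⟨ *-monoˡ-≤ (0≤½^ (suc k)) (Σ<-shift p (λ z → g≥0 (bits (suc k) z)) p+2^k≤) ⟩
      ½^ (suc k) * Σ< (2 ℕ.^ suc k) (g ∘ bits (suc k)) ≈⟨ avg-grid (suc k) g ⟨
      ∫ (avg (suc k)) g ∎
      where
      p+2^k≤ : p ℕ.+ 2 ℕ.^ k ℕ.≤ 2 ℕ.^ suc k
      p+2^k≤ rewrite ℕₚ.+-identityʳ (2 ℕ.^ k) = ℕₚ.+-monoˡ-≤ (2 ℕ.^ k) p≤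

    -- Adding `p` is injective and does not overflow, so no grid point receives more than its
    -- uniform weight.
    pairs₁-fst-≤ : ∀ k₀ {p q} (p≤ : p ℕ.≤ 2 ℕ.^ k) (q≤ : q ℕ.≤ 2 ℕ.^ k) {g : Cantor → ℝ} → (∀ a → 0# ≤ g a) →
                   ∫ (pairs₁ k₀ p≤ q≤) (g ∘ fstP) ≤ ∫ (avg (k₀ ℕ.+ suc k)) g
    pairs₁-fst-≤ zero     p≤ q≤ g≥0 = shifted-≤-avg p≤ g≥0
    pairs₁-fst-≤ (suc k₀) p≤ q≤ g≥0 = +-mono-≤
      (*-monoˡ-≤ 0≤½ (pairs₁-fst-≤ k₀ p≤ q≤ (g≥0 ∘ (false ◂_)))) (*-monoˡ-≤ 0≤½ (pairs₁-fst-≤ k₀ p≤ q≤ (g≥0 ∘ (true ◂_))))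

    pairs₁-snd-≤ : ∀ k₀ {p q} (p≤ : p ℕ.≤ 2 ℕ.^ k) (q≤ : q ℕ.≤ 2 ℕ.^ k) {g : Cantor → ℝ} → (∀ a → 0# ≤ g a) →
                   ∫ (pairs₁ k₀ p≤ q≤) (g ∘ sndP) ≤ ∫ (avg (k₀ ℕ.+ suc k)) g
    pairs₁-snd-≤ zero     p≤ q≤ g≥0 = shifted-≤-avg q≤ g≥0
    pairs₁-snd-≤ (suc k₀) p≤ q≤ g≥0 = +-mono-≤
      (*-monoˡ-≤ 0≤½ (pairs₁-snd-≤ k₀ p≤ q≤ (g≥0 ∘ (false ◂_)))) (*-monoˡ-≤ 0≤½ (pairs₁-snd-≤ k₀ p≤ q≤ (g≥0 ∘ (true ◂_))))

    -- The carry stops at the reserved zero digit, so the first `k₀` digits stay uniform; ½ is the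
    -- mass of the condition on that digit.
    pairs₁-fst-dep : ∀ k₀ {p q} (p≤ : p ℕ.≤ 2 ℕ.^ k) (q≤ : q ℕ.≤ 2 ℕ.^ k) {g : Cantor → ℝ} → Dep₁ k₀ g →
                     ∫ (pairs₁ k₀ p≤ q≤) (g ∘ fstP) ≈ ½ * ∫ (avg k₀) g
    pairs₁-fst-dep zero {p} p≤ q≤ {g} dep = begin-equality
      ½^ (suc k) * Σ< (2 ℕ.^ k) (λ y → g (bits (suc k) (p ℕ.+ y)))
        ≈⟨ *-congˡ (Σ<-cong (2 ℕ.^ k) λ y _ → dep {bits (suc k) (p ℕ.+ y)} λ _ ()) ⟩
      ½^ (suc k) * Σ< (2 ℕ.^ k) (λ _ → c)   ≈⟨ *-assoc ½ (½^ k) _ ⟩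
      ½ * (½^ k * Σ< (2 ℕ.^ k) (λ _ → c))   ≈⟨ *-congˡ (avg-grid k (λ _ → c)) ⟨
      ½ * ∫ (avg k) (λ _ → c)               ≈⟨ *-congˡ (avg-const k c) ⟩
      ½ * c                                 ∎
      where c = g (λ _ → false)
    pairs₁-fst-dep (suc k₀) p≤ q≤ {g} dep = trans
      (+-cong (*-congˡ (pairs₁-fst-dep k₀ p≤ q≤ (Dep₁-◂ false dep))) (*-congˡ (pairs₁-fst-dep k₀ p≤ q≤ (Dep₁-◂ true dep))))
      (sym (distribˡ ½ _ _))

    Pairs : (k₀ : ℕ) → ∀ {n} → (p q : Fin n → ℕ) → Set
    Pairs k₀ {n} p q = ∃ λ ((x , y) : Vec Cantor n × Vec Cantor n) → Agree k₀ x y ×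
      (∀ i → val (k₀ ℕ.+ suc k) (lookup x i) ℕ.+ q i ≡ val (k₀ ℕ.+ suc k) (lookup y i) ℕ.+ p i)

    infixr 5 _∷ᴾ_
    _∷ᴾ_ : ∀ {k₀ n} {p q : Fin (suc n) → ℕ} → Pair k₀ (p Fin.zero) (q Fin.zero) →
           Pairs k₀ (p ∘ Fin.suc) (q ∘ Fin.suc) → Pairs k₀ p q
    ((a , b) , ag , eq) ∷ᴾ ((x , y) , ags , eqs) =
      (a ∷ x , b ∷ y) , ag ∷ ags , λ { Fin.zero → eq ; (Fin.suc i) → eqs i }

    fstV : ∀ {k₀ n} {p q : Fin n → ℕ} → Pairs k₀ p q → Vec Cantor n
    fstV = proj₁ ∘ proj₁

    sndV : ∀ {k₀ n} {p q : Fin n → ℕ} → Pairs k₀ p q → Vec Cantor n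
    sndV = proj₂ ∘ proj₁

    module _ (k₀ : ℕ) where

      pairs : ∀ {n} {p q : Fin n → ℕ} → (∀ i → p i ℕ.≤ 2 ℕ.^ k) → (∀ i → q i ℕ.≤ 2 ℕ.^ k) →
              Functional (Pairs k₀ p q)
      pairs {zero}  p≤ q≤ = dirac (([] , []) , [] , λ ())
      pairs {suc n} {p} {q} p≤ q≤ = bindF (pairs₁ k₀ (p≤ Fin.zero) (q≤ Fin.zero)) λ ab →
        mapF (_∷ᴾ_ {p = p} {q} ab) (pairs (p≤ ∘ Fin.suc) (q≤ ∘ Fin.suc))

      pairs-fst-≤ : ∀ {n} {p q : Fin n → ℕ} (p≤ : ∀ i → p i ℕ.≤ 2 ℕ.^ k) (q≤ : ∀ i → q i ℕ.≤ 2 ℕ.^ k)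
                    {g : Vec Cantor n → ℝ} → (∀ x → 0# ≤ g x) →
                    ∫ (pairs p≤ q≤) (g ∘ fstV) ≤ ∫ (Avg n (k₀ ℕ.+ suc k)) g
      pairs-fst-≤ {zero}  p≤ q≤ g≥0 = ≤-refl
      pairs-fst-≤ {suc n} p≤ q≤ {g} g≥0 = ≤-trans
        (∫-mono (pairs₁ k₀ (p≤ Fin.zero) (q≤ Fin.zero)) λ ab →
          pairs-fst-≤ (p≤ ∘ Fin.suc) (q≤ ∘ Fin.suc) (λ x → g≥0 (fstP ab ∷ x)))
        (pairs₁-fst-≤ k₀ (p≤ Fin.zero) (q≤ Fin.zero) λ a →
          Avg-nonneg n (k₀ ℕ.+ suc k) (λ x → g≥0 (a ∷ x)))

      pairs-snd-≤ : ∀ {n} {p q : Fin n → ℕ} (p≤ : ∀ i → p i ℕ.≤ 2 ℕ.^ k) (q≤ : ∀ i → q i ℕ.≤ 2 ℕ.^ k)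
                    {g : Vec Cantor n → ℝ} → (∀ x → 0# ≤ g x) →
                    ∫ (pairs p≤ q≤) (g ∘ sndV) ≤ ∫ (Avg n (k₀ ℕ.+ suc k)) g
      pairs-snd-≤ {zero}  p≤ q≤ g≥0 = ≤-refl
      pairs-snd-≤ {suc n} p≤ q≤ {g} g≥0 = ≤-trans
        (∫-mono (pairs₁ k₀ (p≤ Fin.zero) (q≤ Fin.zero)) λ ab →
          pairs-snd-≤ (p≤ ∘ Fin.suc) (q≤ ∘ Fin.suc) (λ x → g≥0 (sndP ab ∷ x)))
        (pairs₁-snd-≤ k₀ (p≤ Fin.zero) (q≤ Fin.zero) λ a →
          Avg-nonneg n (k₀ ℕ.+ suc k) (λ x → g≥0 (a ∷ x)))

      pairs-fst-dep : ∀ {n} {p q : Fin n → ℕ} (p≤ : ∀ i → p i ℕ.≤ 2 ℕ.^ k) (q≤ : ∀ i → q i ℕ.≤ 2 ℕ.^ k)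
                      {g : Vec Cantor n → ℝ} → Dep k₀ g →
                      ∫ (pairs p≤ q≤) (g ∘ fstV) ≈ ½^ n * ∫ (Avg n k₀) g
      pairs-fst-dep {zero}  p≤ q≤ {g} dep = sym (*-identityˡ (g []))
      pairs-fst-dep {suc n} p≤ q≤ {g} dep = begin-equality
        ∫ P₁ (λ ab → ∫ (pairs _ _) (g ∘ (fstP ab ∷_) ∘ fstV))
          ≈⟨ ∫-cong P₁ (λ ab → pairs-fst-dep (p≤ ∘ Fin.suc) (q≤ ∘ Fin.suc) (λ ag → dep (Agree₁-refl ∷ ag))) ⟩
        ∫ P₁ (λ ab → ½^ n * h (fstP ab))   ≈⟨ ∫-scale P₁ (½^ n) (h ∘ fstP) ⟩
        ½^ n * ∫ P₁ (h ∘ fstP)             ≈⟨ *-congˡ (pairs₁-fst-dep k₀ _ _ (Avg-dep k₀ {g} dep)) ⟩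
        ½^ n * (½ * ∫ (avg k₀) h)          ≈⟨ solve 3 (λ x y z → x :* (y :* z) := (y :* x) :* z) refl (½^ n) ½ _ ⟩
        ½^ (suc n) * ∫ (Avg (suc n) k₀) g  ∎
        where
        P₁ = pairs₁ k₀ (p≤ Fin.zero) (q≤ Fin.zero)
        h : Cantor → ℝ
        h a = ∫ (Avg n k₀) (g ∘ (a ∷_))

-- Real numbers from binary digits

module BinaryExpansion (R : RealField) where

  open OrderedField R
  open CommutativeMult +-commutativeMonoid using () renaming (×-distrib-+ to •-distrib-+)

  •-nonneg : ∀ m {x} → 0# ≤ x → 0# ≤ m • x
  •-nonneg zero    0≤x = ≤-refl
  •-nonneg (suc m) 0≤x = +-nonneg 0≤x (•-nonneg m 0≤x)

  1•x≈x : ∀ x → 1 • x ≈ x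
  1•x≈x x = +-identityʳ x

  bit•≤ : ∀ c {x} → 0# ≤ x → bit c • x ≤ x
  bit•≤ false 0≤x = 0≤x
  bit•≤ true  0≤x = ≤-reflexive (1•x≈x _)

  lower : ℕ → Cantor → ℝ
  lower k a = val k a • ½^ k

  lower-snoc : ∀ k a → lower (suc k) a ≈ lower k a + bit (a k) • ½^ (suc k)
  lower-snoc k a = begin-equality
    val (suc k) a • h                       ≡⟨ ≡.cong (_• h) (val-snoc k a) ⟩
    ((v ℕ.+ v) ℕ.+ bit (a k)) • h           ≈⟨ •-homo-+ h (v ℕ.+ v) (bit (a k)) ⟩
    (v ℕ.+ v) • h + bit (a k) • h           ≈⟨ +-congʳ (•-homo-+ h v v) ⟩
    (v • h + v • h) + bit (a k) • h         ≈⟨ +-congʳ (•-distrib-+ h h v) ⟨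
    v • (h + h) + bit (a k) • h             ≈⟨ +-congʳ (•-cong (≡.refl {x = v}) (½^-double k)) ⟩
    v • ½^ k + bit (a k) • h                ∎
    where
    v = val k a
    h = ½^ (suc k)

  -- One more digit selects the left or the right half of the dyadic interval from `lower k a` to
  -- `lower k a + ½^ k`, so these intervals are nested.
  lower-inc : ∀ {j k} a → j ℕ.≤ k → lower j a ≤ lower k a × lower k a + ½^ k ≤ lower j a + ½^ j
  lower-inc {j} a j≤k = go (ℕₚ.≤⇒≤′ j≤k)
    where
    go : ∀ {k} → j ℕ.≤′ k → lower j a ≤ lower k a × lower k a + ½^ k ≤ lower j a + ½^ j
    go ℕ.≤′-refl = ≤-refl , ≤-refl
    go (ℕ.≤′-step {k} j≤′k) = (begin
        lower j a                             ≤⟨ proj₁ (go j≤′k) ⟩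
        lower k a                             ≤⟨ x≤x+y (•-nonneg (bit (a k)) (0≤½^ (suc k))) ⟩
        lower k a + bit (a k) • ½^ (suc k)    ≈⟨ lower-snoc k a ⟨
        lower (suc k) a                       ∎) , (begin
        lower (suc k) a + ½^ (suc k)                      ≈⟨ +-congʳ (lower-snoc k a) ⟩
        (lower k a + bit (a k) • ½^ (suc k)) + ½^ (suc k) ≤⟨ +-mono-≤ (+-mono-≤ ≤-refl (bit•≤ (a k) (0≤½^ (suc k)))) ≤-refl ⟩
        (lower k a + ½^ (suc k)) + ½^ (suc k)             ≈⟨ +-assoc _ _ _ ⟩
        lower k a + (½^ (suc k) + ½^ (suc k))             ≈⟨ +-congˡ (½^-double k) ⟩
        lower k a + ½^ k                                  ≤⟨ proj₂ (go j≤′k) ⟩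
        lower j a + ½^ j                                  ∎)

  lower≤upper : ∀ j k a → lower j a ≤ lower k a + ½^ k
  lower≤upper j k a = begin
    lower j a            ≤⟨ proj₁ (lower-inc a (ℕₚ.m≤m⊔n j k)) ⟩
    lower m a            ≤⟨ x≤x+y (0≤½^ m) ⟩
    lower m a + ½^ m     ≤⟨ proj₂ (lower-inc a (ℕₚ.m≤n⊔m j k)) ⟩
    lower k a + ½^ k     ∎
    where m = j ℕ.⊔ k

  private
    supremum : ∀ a → ∃ (IsSupremum λ x → ∃ λ k → x ≈ lower k a)
    supremum a = complete _ (lower 0 a , 0 , refl)
      (lower 0 a + ½^ 0 , λ x (k , x≈) → ≤-trans (≤-reflexive x≈) (lower≤upper k 0 a))

  ρ : Cantor → ℝ
  ρ a = proj₁ (supremum a)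

  lower≤ρ : ∀ k a → lower k a ≤ ρ a
  lower≤ρ k a = proj₁ (proj₂ (supremum a)) (lower k a) (k , refl)

  ρ≤upper : ∀ k a → ρ a ≤ lower k a + ½^ k
  ρ≤upper k a = proj₂ (proj₂ (supremum a)) _ λ x (j , x≈) →
    ≤-trans (≤-reflexive x≈) (lower≤upper j k a)

  ρ-agree : ∀ {k a b} → Agree₁ k a b → ρ a ≤ ρ b + ½^ k
  ρ-agree {k} {a} {b} ag = begin
    ρ a              ≤⟨ ρ≤upper k a ⟩
    lower k a + ½^ k ≡⟨ ≡.cong (λ v → v • ½^ k + ½^ k) (val-agree ag) ⟩
    lower k b + ½^ k ≤⟨ +-monoˡ (½^ k) (lower≤ρ k b) ⟩
    ρ b + ½^ k       ∎

  floor : ∀ {x h} B → 0# ≤ h → 0# ≤ x → x ≤ B • h → ∃ λ a → a ℕ.≤ B × a • h ≤ x × x ≤ a • h + h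
  floor zero    0≤h 0≤x x≤0 = 0 , ℕ.z≤n , 0≤x , ≤-trans x≤0 (x≤x+y 0≤h)
  floor {x} {h} (suc B) 0≤h 0≤x x≤ with (B • h) ≤? x
  ... | yes B≤x = B , ℕₚ.n≤1+n B , B≤x , ≤-trans x≤ (≤-reflexive (+-comm h (B • h)))
  ... | no  B≰x = let a , a≤B , p , q = floor B 0≤h 0≤x (<⇒≤ B≰x) in a , ℕₚ.m≤n⇒m≤1+n a≤B , p , q

  2^•½^ : ∀ k j → (2 ℕ.^ k) • ½^ (j ℕ.+ k) ≈ ½^ j
  2^•½^ zero    j = trans (1•x≈x _) (reflexive (≡.cong ½^ (ℕₚ.+-identityʳ j)))
  2^•½^ (suc k) j = begin-equality
    (2 ℕ.^ suc k) • h                     ≡⟨ ≡.cong (λ m → (2 ℕ.^ k ℕ.+ m) • h) (ℕₚ.+-identityʳ (2 ℕ.^ k)) ⟩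
    (2 ℕ.^ k ℕ.+ 2 ℕ.^ k) • h             ≈⟨ •-homo-+ h (2 ℕ.^ k) (2 ℕ.^ k) ⟩
    (2 ℕ.^ k) • h + (2 ℕ.^ k) • h         ≈⟨ •-distrib-+ h h (2 ℕ.^ k) ⟨
    (2 ℕ.^ k) • (h + h)                   ≡⟨ ≡.cong (λ m → (2 ℕ.^ k) • (½^ m + ½^ m)) (ℕₚ.+-suc j k) ⟩
    (2 ℕ.^ k) • (½^ (suc (j ℕ.+ k)) + ½^ (suc (j ℕ.+ k))) ≈⟨ •-cong (≡.refl {x = 2 ℕ.^ k}) (½^-double (j ℕ.+ k)) ⟩
    (2 ℕ.^ k) • ½^ (j ℕ.+ k)              ≈⟨ 2^•½^ k j ⟩
    ½^ j                                  ∎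
    where h = ½^ (j ℕ.+ suc k)

-- Kernel vectors of matrices with fewer rows than columns

module LinearAlgebra (R : RealField) where

  open OrderedField R
  open SemiringSum semiring using (sum; sum-cong-≋; ∑-distrib-+; *-distribˡ-sum)

  sum-zero : ∀ n {f : Fin n → ℝ} → (∀ i → f i ≈ 0#) → sum f ≈ 0#
  sum-zero zero    f≈0 = refl
  sum-zero (suc n) f≈0 = trans (+-cong (f≈0 Fin.zero) (sum-zero n (f≈0 ∘ Fin.suc))) (+-identityˡ 0#)

  -- Gaussian elimination on the first column.
  kernel-vector : ∀ {t n} → t ℕ.< n → (S : Fin t → Fin n → ℝ) → ∃ λ (v : Fin n → ℝ) →
                  (∃ λ i → ¬ (v i ≈ 0#)) × (∀ r → sum (λ l → S r l * v l) ≈ 0#)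
  kernel-vector {t} {suc n} (ℕ.s≤s t≤n) S with Finₚ.any? (λ r → ¬? (S r Fin.zero ≟ 0#))
  ... | no all-zero = v , (Fin.zero , λ 1≈0 → 0≉1 (sym 1≈0)) , λ r →
    trans (+-cong (trans (*-congʳ (col r)) (zeroˡ 1#)) (sum-zero n λ l → zeroʳ (S r (Fin.suc l)))) (+-identityˡ 0#)
    where
    v : Fin (suc n) → ℝ
    v Fin.zero    = 1#
    v (Fin.suc _) = 0#
    col : ∀ r → S r Fin.zero ≈ 0#
    col r with S r Fin.zero ≟ 0#
    ... | yes p = p
    ... | no ¬p = contradiction (r , ¬p) all-zero
  kernel-vector {suc t} {suc n} (ℕ.s≤s t<n) S | yes (r₀ , pivot≉0) = v , (Fin.suc (proj₁ nz) , proj₂ nz) , rows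
    where
    a = S r₀ Fin.zero
    a⁻¹ = proj₁ (inverse a pivot≉0)
    aa⁻¹≈1 = proj₂ (inverse a pivot≉0)
    w : Fin t → ℝ
    -- The multiple of the pivot row that clears the first entry of the row `punchIn r₀ r`.
    w r = - (S (punchIn r₀ r) Fin.zero * a⁻¹)
    S′ : Fin t → Fin n → ℝ
    S′ r l = S (punchIn r₀ r) (Fin.suc l) + w r * S r₀ (Fin.suc l)
    rec = kernel-vector t<n S′
    v′ = proj₁ rec
    nz = proj₁ (proj₂ rec)
    s₀ = sum λ l → S r₀ (Fin.suc l) * v′ l
    v : Fin (suc n) → ℝ
    -- Back substitution: this entry makes the pivot row vanish on `v`.
    v Fin.zero    = - (a⁻¹ * s₀)
    v (Fin.suc l) = v′ l
    rows : ∀ r → sum (λ l → S r l * v l) ≈ 0#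
    rows r with r₀ Finₚ.≟ r
    ... | yes ≡.refl = begin-equality
      a * - (a⁻¹ * s₀) + s₀   ≈⟨ +-congʳ (-‿distribʳ-* a (a⁻¹ * s₀)) ⟨
      - (a * (a⁻¹ * s₀)) + s₀ ≈⟨ +-congʳ (-‿cong (trans (sym (*-assoc a a⁻¹ s₀)) (trans (*-congʳ aa⁻¹≈1) (*-identityˡ s₀)))) ⟩
      - s₀ + s₀               ≈⟨ -‿inverseˡ s₀ ⟩
      0#                      ∎
    ... | no r₀≢r = ≡.subst (λ r → sum (λ l → S r l * v l) ≈ 0#) (Finₚ.punchIn-punchOut r₀≢r) (begin-equality
      b * - (a⁻¹ * s₀) + s          ≈⟨ +-congʳ (-‿distribʳ-* b (a⁻¹ * s₀)) ⟨
      - (b * (a⁻¹ * s₀)) + s        ≈⟨ +-congʳ (-‿cong (*-assoc b a⁻¹ s₀)) ⟨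
      - ((b * a⁻¹) * s₀) + s        ≈⟨ +-congʳ (-‿distribˡ-* (b * a⁻¹) s₀) ⟩
      w r′ * s₀ + s                 ≈⟨ +-comm _ s ⟩
      s + w r′ * s₀                 ≈⟨ +-congˡ (*-distribˡ-sum (w r′) (λ l → S r₀ (Fin.suc l) * v′ l)) ⟩
      s + sum (λ l → w r′ * (S r₀ (Fin.suc l) * v′ l)) ≈⟨ ∑-distrib-+ (λ l → S (punchIn r₀ r′) (Fin.suc l) * v′ l) _ ⟨
      sum (λ l → S (punchIn r₀ r′) (Fin.suc l) * v′ l + w r′ * (S r₀ (Fin.suc l) * v′ l))
        ≈⟨ sum-cong-≋ (λ l → trans (+-congˡ (sym (*-assoc (w r′) _ _))) (sym (distribʳ (v′ l) _ _))) ⟩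
      sum (λ l → S′ r′ l * v′ l)    ≈⟨ proj₂ (proj₂ rec) r′ ⟩
      0#                            ∎)
      where
      r′ = Fin.punchOut r₀≢r
      b = S (punchIn r₀ r′) Fin.zero
      s = sum λ l → S (punchIn r₀ r′) (Fin.suc l) * v′ l

-- Indicator functions

module Indicator (R : RealField) (em : ∀ {ℓ} → ExcludedMiddle ℓ) where

  open OrderedField R

  𝟙 : Set → ℝ
  𝟙 A = if does (em {P = A}) then 1# else 0#

  𝟙-yes : ∀ {A} → A → 𝟙 A ≈ 1#
  𝟙-yes {A} a with em {P = A}
  ... | yes _ = refl
  ... | no ¬a = contradiction a ¬a

  𝟙-no : ∀ {A} → ¬ A → 𝟙 A ≈ 0#
  𝟙-no {A} ¬a with em {P = A}
  ... | yes a = contradiction a ¬a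
  ... | no _  = refl

  𝟙-nonneg : ∀ A → 0# ≤ 𝟙 A
  𝟙-nonneg A with em {P = A}
  ... | yes _ = 0≤1
  ... | no _  = ≤-refl

  𝟙≤1 : ∀ A → 𝟙 A ≤ 1#
  𝟙≤1 A with em {P = A}
  ... | yes _ = ≤-refl
  ... | no _  = 0≤1

  𝟙-mono : ∀ {A B} → (A → B) → 𝟙 A ≤ 𝟙 B
  𝟙-mono {A} {B} f with em {P = A}
  ... | yes a = ≤-reflexive (sym (𝟙-yes (f a)))
  ... | no _  = 𝟙-nonneg B

  𝟙-cong : ∀ {A B} → (A → B) → (B → A) → 𝟙 A ≈ 𝟙 B
  𝟙-cong f g = antisym (𝟙-mono f) (𝟙-mono g)

-- Two points that differ by a multiple of a given vector

module TwoPoints (R : RealField) (em : ∀ {ℓ} → ExcludedMiddle ℓ) where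

  open OrderedField R
  open Integration R em
  open Compactness em
  open Shift R em
  open BinaryExpansion R
  open Indicator R em

  scale-below : ∀ k x → ∃ λ e → ½^ e * x ≤ ½^ k
  scale-below k x with em {P = ∃ λ e → ½^ e * x ≤ ½^ k}
  ... | yes p = p
  ... | no ¬p = contradiction (archimedean x λ e → <⇒≤ λ le → ¬p (e , le)) (0<½^ k)

  scale-all-below : ∀ {n} k (u : Fin n → ℝ) → (∀ i → 0# ≤ u i) → ∃ λ e → ∀ i → ½^ e * u i ≤ ½^ k
  scale-all-below {zero}  k u u≥0 = 0 , λ ()
  scale-all-below {suc n} k u u≥0 =
    let e , p = scale-below k (u Fin.zero)
        e′ , q = scale-all-below k (u ∘ Fin.suc) (u≥0 ∘ Fin.suc)
    in e ℕ.⊔ e′ , λ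
      { Fin.zero    → ≤-trans (shrink (ℕₚ.m≤m⊔n e e′) (u≥0 Fin.zero)) p
      ; (Fin.suc i) → ≤-trans (shrink (ℕₚ.m≤n⊔m e e′) (u≥0 (Fin.suc i))) (q i) }
    where
    shrink : ∀ {j k x} → j ℕ.≤ k → 0# ≤ x → ½^ k * x ≤ ½^ j * x
    shrink {j} {k} {x} j≤k 0≤x = begin
      ½^ k * x ≈⟨ *-comm (½^ k) x ⟩
      x * ½^ k ≤⟨ *-monoˡ-≤ 0≤x (½^-anti j≤k) ⟩
      x * ½^ j ≈⟨ *-comm x (½^ j) ⟩
      ½^ j * x ∎

  pos-neg : ∀ x → ∃ λ p → ∃ λ q → 0# ≤ p × 0# ≤ q × p ≈ q + x
  pos-neg x with total 0# x
  ... | inj₁ 0≤x = x , 0# , 0≤x , ≤-refl , sym (+-identityˡ x)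
  ... | inj₂ x≤0 = 0# , - x , ≤-refl , 0≤-x , sym (-‿inverseˡ x)
    where
    0≤-x : 0# ≤ - x
    0≤-x = ≤-trans (≤-reflexive (sym -0#≈0#)) (neg-mono x≤0)

  -- Grid points are moved by natural numbers, so the small multiple `½^ e * v` is written as a
  -- difference of nonnegative shifts. With the bound `½^ (suc k₀)` both shifts fit below the first
  -- `k₀` digits and the zero digit that follows them.
  record SmallDifference (k : ℕ) {n : ℕ} (v : Fin n → ℝ) : Set where
    field
      P Q : Fin n → ℝ
      e   : ℕ
      0≤P : ∀ i → 0# ≤ P i
      0≤Q : ∀ i → 0# ≤ Q i
      P≤  : ∀ i → P i ≤ ½^ k
      Q≤  : ∀ i → Q i ≤ ½^ k
      P≈  : ∀ i → P i ≈ Q i + ½^ e * v i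

  small-difference : ∀ k {n} (v : Fin n → ℝ) → SmallDifference k v
  small-difference k v = record
    { P = λ i → ½^ e * p i
    ; Q = λ i → ½^ e * q i
    ; e = e
    ; 0≤P = λ i → *-nonneg (0≤½^ e) (0≤p i)
    ; 0≤Q = λ i → *-nonneg (0≤½^ e) (0≤q i)
    ; P≤ = λ i → ≤-trans (*-monoˡ-≤ (0≤½^ e) (x≤x+y (0≤q i))) (proj₂ small i)
    ; Q≤ = λ i → ≤-trans (*-monoˡ-≤ (0≤½^ e) (≤-trans (x≤x+y (0≤p i)) (≤-reflexive (+-comm _ _)))) (proj₂ small i)
    ; P≈ = λ i → trans (*-congˡ (p≈ i)) (distribˡ (½^ e) (q i) (v i))
    }
    where
    p q : Fin _ → ℝ
    p i = proj₁ (pos-neg (v i))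
    q i = proj₁ (proj₂ (pos-neg (v i)))
    0≤p : ∀ i → 0# ≤ p i
    0≤p i = proj₁ (proj₂ (proj₂ (pos-neg (v i))))
    0≤q : ∀ i → 0# ≤ q i
    0≤q i = proj₁ (proj₂ (proj₂ (proj₂ (pos-neg (v i)))))
    p≈ : ∀ i → p i ≈ q i + v i
    p≈ i = proj₂ (proj₂ (proj₂ (proj₂ (pos-neg (v i)))))
    small = scale-all-below k (λ i → p i + q i) (λ i → +-nonneg (0≤p i) (0≤q i))
    e = proj₁ small

  Decides : ∀ k {n} → (Vec Cantor n → Set) → Set
  Decides k A = ∀ {x y} → Agree k x y → A x → A y

  𝟙-dep : ∀ {k n} {A : Vec Cantor n → Set} → Decides k A → Dep k (𝟙 ∘ A)
  𝟙-dep dec ag = 𝟙-cong (dec ag) (dec (Agree-sym ag))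

  lookup-agree : ∀ {k n} {x y : Vec Cantor n} → Agree k x y → ∀ i → Agree₁ k (lookup x i) (lookup y i)
  lookup-agree = Pointwise.lookup

  -- These are sections at one outcome: `F` of the elementary approximation, `W N` of the cover of
  -- its errors. In `sparse` there is one average of `W N` for each point of a pair, and `½^ n` is
  -- the mass of the distribution of pairs.
  module _ {n k₀} {F : Vec Cantor n → Set} (F-dec : Decides k₀ F)
           {W : ℕ → Vec Cantor n → Set} (lev : ℕ → ℕ) (W-dec : ∀ N → Decides (lev N) (W N))
           (W-inc : ∀ {M N x} → M ℕ.≤ N → W M x → W N x)
           (sparse : ∀ N → ∫ (Avg n (lev N)) (𝟙 ∘ W N) + ∫ (Avg n (lev N)) (𝟙 ∘ W N) <
                           ½^ n * ∫ (Avg n k₀) (𝟙 ∘ F))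
           (v : Fin n → ℝ) where

    open SmallDifference (small-difference (suc k₀) v)

    -- Coordinatewise `x - y = P - Q` up to two errors `½^ N`: one from truncating the digits of a
    -- point, one from rounding a shift to the grid.
    Near : ℕ → Vec Cantor n → Vec Cantor n → Set
    Near N x y = ∀ i → (ρ (lookup x i) + Q i ≤ (ρ (lookup y i) + P i) + (½^ N + ½^ N)) ×
                       (ρ (lookup y i) + P i ≤ (ρ (lookup x i) + Q i) + (½^ N + ½^ N))

    close : ∀ {L N p q a b} {S T : ℝ} → N ℕ.≤ L → val L a ℕ.+ q ≡ val L b ℕ.+ p →
            T ≤ q • ½^ L + ½^ L → p • ½^ L ≤ S → ρ a + T ≤ (ρ b + S) + (½^ N + ½^ N)
    close {L} {N} {p} {q} {a} {b} {S} {T} N≤L eq T≤ ≤S = begin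
      ρ a + T                                           ≤⟨ +-mono-≤ (ρ≤upper L a) T≤ ⟩
      (val L a • h + h) + (q • h + h)                   ≈⟨ solve 3 (λ x y h → (x :+ h) :+ (y :+ h) := (x :+ y) :+ (h :+ h)) refl _ _ h ⟩
      (val L a • h + q • h) + (h + h)                   ≈⟨ +-congʳ (•-homo-+ h (val L a) q) ⟨
      (val L a ℕ.+ q) • h + (h + h)                     ≡⟨ ≡.cong (λ m → m • h + (h + h)) eq ⟩
      (val L b ℕ.+ p) • h + (h + h)                     ≈⟨ +-congʳ (•-homo-+ h (val L b) p) ⟩
      (val L b • h + p • h) + (h + h)                   ≤⟨ +-mono-≤ (+-mono-≤ (lower≤ρ L b) ≤S) (+-mono-≤ (½^-anti N≤L) (½^-anti N≤L)) ⟩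
      (ρ b + S) + (½^ N + ½^ N)                         ∎
      where h = ½^ L

    GoodPair : ℕ → Vec Cantor n × Vec Cantor n → Set
    GoodPair N (x , y) = Agree k₀ x y × F x × ¬ W N x × ¬ W N y × Near N x y

    module _ (k : ℕ) where

      open GridPairs k

      -- First-moment method: by `sparse`, the indicators of `W N` at both points have together a
      -- smaller integral than that of `F` at the first point. At a pair where the sum of the former
      -- is less than the latter, the sum is below 1, hence both indicators vanish and `F` holds.
      uncovered-pair : ∀ N {p q : Fin n → ℕ} → (∀ i → p i ℕ.≤ 2 ℕ.^ k) → (∀ i → q i ℕ.≤ 2 ℕ.^ k) →
                       lev N ℕ.≤ k₀ ℕ.+ suc k →
                       ∃ λ (z : Pairs k₀ p q) → F (fstV z) × ¬ W N (fstV z) × ¬ W N (sndV z)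
      uncovered-pair N {p} {q} p≤ q≤ lev≤L = pair , Fx , ¬Wx , ¬Wy
        where
        L = k₀ ℕ.+ suc k
        I : Functional (Pairs k₀ p q)
        I = pairs k₀ p≤ q≤
        w : Vec Cantor n → ℝ
        w = 𝟙 ∘ W N
        less : ∫ I (λ z → w (fstV z) + w (sndV z)) < ∫ I (𝟙 ∘ F ∘ fstV)
        less le = sparse N (begin
          ½^ n * ∫ (Avg n k₀) (𝟙 ∘ F)                ≈⟨ pairs-fst-dep k₀ p≤ q≤ (𝟙-dep F-dec) ⟨
          ∫ I (𝟙 ∘ F ∘ fstV)                         ≤⟨ le ⟩
          ∫ I (λ z → w (fstV z) + w (sndV z))        ≈⟨ ∫-+ I (w ∘ fstV) (w ∘ sndV) ⟩
          ∫ I (w ∘ fstV) + ∫ I (w ∘ sndV)            ≤⟨ +-mono-≤ (pairs-fst-≤ k₀ p≤ q≤ (𝟙-nonneg ∘ W N)) (pairs-snd-≤ k₀ p≤ q≤ (𝟙-nonneg ∘ W N)) ⟩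
          ∫ (Avg n L) w + ∫ (Avg n L) w              ≈⟨ +-cong (Avg-level lev≤L (𝟙-dep (W-dec N))) (Avg-level lev≤L (𝟙-dep (W-dec N))) ⟨
          ∫ (Avg n (lev N)) w + ∫ (Avg n (lev N)) w  ∎)
        found : ∃ λ z → w (fstV z) + w (sndV z) < 𝟙 (F (fstV z))
        found = ∫-<⇒∃ I less
        pair : Pairs k₀ p q
        pair = proj₁ found
        x = fstV pair
        y = sndV pair
        Fx : F x
        Fx with em {P = F x}
        ... | yes p = p
        ... | no ¬p = contradiction (≤-trans (≤-reflexive (𝟙-no ¬p)) (+-nonneg (𝟙-nonneg (W N x)) (𝟙-nonneg (W N y)))) (proj₂ found)
        ¬Wx : ¬ W N x
        ¬Wx Wx = proj₂ found (≤-trans (𝟙≤1 (F x)) (≤-trans (≤-reflexive (sym (𝟙-yes Wx))) (x≤x+y (𝟙-nonneg (W N y)))))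
        ¬Wy : ¬ W N y
        ¬Wy Wy = proj₂ found (≤-trans (𝟙≤1 (F x)) (≤-trans (≤-reflexive (sym (𝟙-yes Wy)))
          (≤-trans (x≤x+y (𝟙-nonneg (W N x))) (≤-reflexive (+-comm (w y) (w x))))))

    Rounds : ∀ (k : ℕ) → (Fin n → ℝ) → (Fin n → ℕ) → Set
    Rounds k T p = ∀ i → p i ℕ.≤ 2 ℕ.^ k × p i • ½^ (k₀ ℕ.+ suc k) ≤ T i ×
                         T i ≤ p i • ½^ (k₀ ℕ.+ suc k) + ½^ (k₀ ℕ.+ suc k)

    rounding : ∀ k {T : Fin n → ℝ} → (∀ i → 0# ≤ T i) → (∀ i → T i ≤ ½^ (suc k₀)) → ∃ (Rounds k T)
    rounding k {T} 0≤T T≤ = (λ i → proj₁ (rounded i)) , λ i → proj₂ (rounded i)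
      where
      L = k₀ ℕ.+ suc k
      rounded : ∀ i → ∃ λ a → a ℕ.≤ 2 ℕ.^ k × a • ½^ L ≤ T i × T i ≤ a • ½^ L + ½^ L
      rounded i = floor (2 ℕ.^ k) (0≤½^ L) (0≤T i) (≤-trans (T≤ i) (≤-reflexive (sym (trans
        (reflexive (≡.cong (λ m → (2 ℕ.^ k) • ½^ m) (ℕₚ.+-suc k₀ k))) (2^•½^ k (suc k₀))))))

    rounded-pair : ∀ N k → lev N ℕ.≤ k → N ℕ.≤ k → ∃ (Rounds k P) → ∃ (Rounds k Q) → ∃ (GoodPair N)
    rounded-pair N k lev≤k N≤k (p , roundP) (q , roundQ) =
      let (xy , ag , eq) , Fx , ¬Wx , ¬Wy =
            uncovered-pair k N (proj₁ ∘ roundP) (proj₁ ∘ roundQ) (ℕₚ.≤-trans lev≤k k≤L)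
      in xy , ag , Fx , ¬Wx , ¬Wy , λ i →
        close (ℕₚ.≤-trans N≤k k≤L) (eq i) (proj₂ (proj₂ (roundQ i))) (proj₁ (proj₂ (roundP i))) ,
        close (ℕₚ.≤-trans N≤k k≤L) (≡.sym (eq i)) (proj₂ (proj₂ (roundP i))) (proj₁ (proj₂ (roundQ i)))
      where
      k≤L : k ℕ.≤ k₀ ℕ.+ suc k
      k≤L = ℕₚ.≤-trans (ℕₚ.n≤1+n k) (ℕₚ.m≤n+m (suc k) k₀)

    approximate : ∀ N → ∃ (GoodPair N)
    approximate N = rounded-pair N k (ℕₚ.m≤m⊔n (lev N) N) (ℕₚ.m≤n⊔m (lev N) N)
                      (rounding k 0≤P P≤) (rounding k 0≤Q Q≤)
      -- So fine a grid sees every digit on which `W N` depends and has rounding errors of at most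
      -- `½^ N`.
      where k = lev N ℕ.⊔ N

    -- The shift `½^ e * v` is the same for all `N`, so it persists at a cluster point of the
    -- approximate pairs, where the errors vanish. Each `W M` depends on finitely many digits and is
    -- contained in the later `W N`; a cluster point in `W M` would put some late term into `W N`.
    two-points : ∃ λ x → ∃ λ y → F x × F y × (∀ N → ¬ W N x) × (∀ N → ¬ W N y) ×
                 ∃ λ e → ∀ i → ρ (lookup x i) ≈ ρ (lookup y i) + ½^ e * v i
    two-points = x , y , Fx , Fy , ¬Wx , ¬Wy , e , λ i → +-cancelʳ (Q i) _ _ (begin-equality
        ρ (lookup x i) + Q i                      ≈⟨ equal i ⟩
        ρ (lookup y i) + P i                      ≈⟨ +-congˡ (P≈ i) ⟩
        ρ (lookup y i) + (Q i + ½^ e * v i)       ≈⟨ solve 3 (λ a b c → a :+ (b :+ c) := (a :+ c) :+ b) refl _ _ _ ⟩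
        (ρ (lookup y i) + ½^ e * v i) + Q i       ∎)
      where
      z : ℕ → Vec Cantor n × Vec Cantor n
      z N = proj₁ (approximate N)
      clustered = pair-cluster (λ L → Agree L) (λ L → Agree L) (vec-cluster n) (vec-cluster n) Agree-anti z
      x = proj₁ (proj₁ clustered)
      y = proj₂ (proj₁ clustered)
      near = proj₂ clustered
      F-both : F x × F y
      F-both = let N , _ , agx , agy = near k₀ 0
                   xy , FxN , _ = proj₂ (approximate N)
               -- The points of a pair agree in the first `k₀` digits, so `F` passes from the first
               -- to the second.
               in F-dec (Agree-sym agx) FxN , F-dec (Agree-sym agy) (F-dec xy FxN)
      Fx = proj₁ F-both
      Fy = proj₂ F-both
      ¬Wx : ∀ M → ¬ W M x
      ¬Wx M WMx = let N , M≤N , agx , _ = near (lev M) M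
                      _ , _ , ¬WN , _ = proj₂ (approximate N)
                  in ¬WN (W-inc M≤N (W-dec M agx WMx))
      ¬Wy : ∀ M → ¬ W M y
      ¬Wy M WMy = let N , M≤N , _ , agy = near (lev M) M
                      _ , _ , _ , ¬WN , _ = proj₂ (approximate N)
                  in ¬WN (W-inc M≤N (W-dec M agy WMy))
      chain : ∀ {a b c d h h′} {S T : ℝ} → a ≤ c + h → d ≤ b + h → h′ ≤ h → c + T ≤ (d + S) + (h′ + h′) →
              a + T ≤ (b + S) + h * ((1# + 1#) + (1# + 1#))
      chain {a} {b} {c} {d} {h} {h′} {S} {T} a≤ d≤ h′≤ c≤ = begin
        a + T                              ≤⟨ +-mono-≤ a≤ ≤-refl ⟩
        (c + h) + T                        ≈⟨ solve 3 (λ c h t → (c :+ h) :+ t := (c :+ t) :+ h) refl c h T ⟩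
        (c + T) + h                        ≤⟨ +-monoˡ h c≤ ⟩
        ((d + S) + (h′ + h′)) + h          ≤⟨ +-monoˡ h (+-mono-≤ (+-monoˡ S d≤) (+-mono-≤ h′≤ h′≤)) ⟩
        (((b + h) + S) + (h + h)) + h      ≈⟨ solve 3 (λ b s h → (((b :+ h) :+ s) :+ (h :+ h)) :+ h :=
                                                (b :+ s) :+ h :* ((con 1 :+ con 1) :+ (con 1 :+ con 1))) refl b S h ⟩
        (b + S) + h * ((1# + 1#) + (1# + 1#)) ∎
      equal : ∀ i → ρ (lookup x i) + Q i ≈ ρ (lookup y i) + P i
      equal i = antisym
        (archimedean-≤ _ λ k →
          let N , k≤N , agx , agy = near k k
              _ , _ , _ , _ , xy-near = proj₂ (approximate N)
          in chain (ρ-agree (lookup-agree agx i)) (ρ-agree (Agree₁-sym (lookup-agree agy i)))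
               (½^-anti k≤N) (proj₁ (xy-near i)))
        (archimedean-≤ _ λ k →
          let N , k≤N , agx , agy = near k k
              _ , _ , _ , _ , xy-near = proj₂ (approximate N)
          in chain (ρ-agree (lookup-agree agy i)) (ρ-agree (Agree₁-sym (lookup-agree agx i)))
               (½^-anti k≤N) (proj₂ (xy-near i)))

-- Closure properties of a σ-algebra

module Events (em : ∀ {ℓ} → ExcludedMiddle ℓ) (M : MeasurableSpace) where

  open MeasurableSpace M

  stable : {A : Set} → ¬ ¬ A → A
  stable {A} ¬¬a with em {P = A}
  ... | yes a = a
  ... | no ¬a = contradiction ¬a ¬¬a

  ∪-event : ∀ {A B} → IsMeasurable A → IsMeasurable B → IsMeasurable (A ∪ B)
  ∪-event {A} {B} a b = respects (to , from) (union {family} λ { zero → a ; (suc _) → b })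
    where
    family : ℕ → Pred Point 0ℓ
    family zero    = A
    family (suc _) = B
    to : ⋃ ℕ family ⊆ A ∪ B
    to (zero  , p) = inj₁ p
    to (suc _ , p) = inj₂ p
    from : A ∪ B ⊆ ⋃ ℕ family
    from (inj₁ p) = 0 , p
    from (inj₂ p) = 1 , p

  ⋂-event : ∀ {A : ℕ → Pred Point 0ℓ} → (∀ i → IsMeasurable (A i)) → IsMeasurable (⋂ ℕ A)
  ⋂-event a = respects
    ((λ ¬some i → stable λ ¬Ai → ¬some (i , ¬Ai)) , λ all (i , ¬Ai) → ¬Ai (all i))
    (complement (union λ i → complement (a i)))

  ∩-event : ∀ {A B} → IsMeasurable A → IsMeasurable B → IsMeasurable (A ∩ B)
  ∩-event {A} {B} a b = respects
    ((λ ¬or → stable (¬or ∘ inj₁) , stable (¬or ∘ inj₂)) , λ (p , q) → [ (λ ¬p → ¬p p) , (λ ¬q → ¬q q) ]′)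
    (complement (∪-event (complement a) (complement b)))

  const-event : ∀ A → IsMeasurable (const A)
  const-event A with em {P = A}
  ... | yes a = respects ((λ _ → a) , λ _ → tt) whole
  ... | no ¬a = respects ((λ ¬⊤ → contradiction tt ¬⊤) , λ a → contradiction a ¬a) (complement whole)

-- Continuity of probability; expectation of simple functions

module Probability (R : RealField) (em : ∀ {ℓ} → ExcludedMiddle ℓ)
                   (PS : BatchRecovery.ProbabilitySpace R) where

  open OrderedField R
  open Integration R em
  open LinearAlgebra R using (sum-zero)
  open Shift R em using (Σ<)
  open Indicator R em
  open BatchRecovery.ProbabilitySpace PS public
  open MeasurableSpace space public using (respects; whole; complement; union)
  open Events em space public
  open SemiringSum semiring using (sum)

  Σ<-snoc : ∀ N f → Σ< (suc N) f ≈ Σ< N f + f N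
  Σ<-snoc zero    f = trans (+-identityʳ (f 0)) (sym (+-identityˡ (f 0)))
  Σ<-snoc (suc N) f = trans (+-congˡ (Σ<-snoc N (f ∘ suc))) (sym (+-assoc (f 0) _ _))

  ∅-event : IsEvent ∅
  ∅-event = const-event ⊥

  Pr-∅ : Pr ∅ ≈ 0#
  Pr-∅ = antisym Pr∅≤0 (Pr-nonneg ∅-event)
    where
    2Pr∅≤ : Pr ∅ + (Pr ∅ + 0#) ≤ Pr ∅
    2Pr∅≤ = ≤-trans
      (proj₁ (Pr-additive (λ _ → ∅) (λ _ → ∅-event) (λ _ _ _ _ ())) _ (2 , refl))
      (≤-reflexive (Pr-respects (union λ _ → ∅-event) ((λ ()) , λ ())))
    Pr∅≤0 : Pr ∅ ≤ 0#
    Pr∅≤0 = linear 2Pr∅≤ (solve 1 (λ x → x :+ x := con 0 :+ (x :+ (x :+ con 0))) refl (Pr ∅))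

  Pr-+ : ∀ {A B} → IsEvent A → IsEvent B → Empty (A ∩ B) → Pr (A ∪ B) ≈ Pr A + Pr B
  Pr-+ {A} {B} a b A∩B=∅ = trans (Pr-respects (∪-event a b) (to , from))
    (antisym (proj₂ additive _ bound) (proj₁ additive _ (2 , +-congˡ (sym (+-identityʳ (Pr B))))))
    where
    E : ℕ → Pred Ω 0ℓ
    E zero          = A
    E (suc zero)    = B
    E (suc (suc _)) = ∅
    E-event : ∀ i → IsEvent (E i)
    E-event zero          = a
    E-event (suc zero)    = b
    E-event (suc (suc _)) = ∅-event
    disjoint : ∀ i j → i ≢ j → Empty (E i ∩ E j)
    disjoint zero       zero       0≢0 = contradiction ≡.refl 0≢0
    disjoint zero       (suc zero) _ ω p = A∩B=∅ ω p
    disjoint (suc zero) zero       _ ω (p , q) = A∩B=∅ ω (q , p)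
    disjoint (suc zero) (suc zero) 1≢1 = contradiction ≡.refl 1≢1
    disjoint zero          (suc (suc _)) _ ω (_ , ())
    disjoint (suc zero)    (suc (suc _)) _ ω (_ , ())
    disjoint (suc (suc _)) _             _ ω (() , _)
    additive = Pr-additive E E-event disjoint
    bound : ∀ x → (∃ λ N → x ≈ sum {N} (λ i → Pr (E (toℕ i)))) → x ≤ Pr A + Pr B
    bound x (zero , x≈0) = ≤-trans (≤-reflexive x≈0) (+-nonneg (Pr-nonneg a) (Pr-nonneg b))
    bound x (suc zero , x≈) = ≤-trans (≤-reflexive (trans x≈ (+-identityʳ (Pr A)))) (x≤x+y (Pr-nonneg b))
    bound x (suc (suc N) , x≈) = ≤-reflexive (trans x≈ (+-congˡ (trans (+-congˡ (sum-zero N λ _ → Pr-∅)) (+-identityʳ (Pr B)))))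
    to : A ∪ B ⊆ ⋃ ℕ E
    to (inj₁ p) = 0 , p
    to (inj₂ q) = 1 , q
    from : ⋃ ℕ E ⊆ A ∪ B
    from (zero , p)     = inj₁ p
    from (suc zero , q) = inj₂ q

  Pr-split : ∀ {A B} → IsEvent A → IsEvent B → Pr B ≈ Pr (B ∩ A) + Pr (B ∩ ∁ A)
  Pr-split {A} {B} a b = trans
    (Pr-respects b (to , [ proj₁ , proj₁ ]′))
    (Pr-+ (∩-event b a) (∩-event b (complement a)) λ ω ((_ , p) , (_ , ¬p)) → ¬p p)
    where
    to : B ⊆ (B ∩ A) ∪ (B ∩ ∁ A)
    to {ω} q with em {P = A ω}
    ... | yes p = inj₁ (q , p)
    ... | no ¬p = inj₂ (q , ¬p)

  Pr-mono : ∀ {A B} → IsEvent A → IsEvent B → A ⊆ B → Pr A ≤ Pr B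
  Pr-mono {A} {B} a b A⊆B = begin
    Pr A                        ≈⟨ Pr-respects a ((λ p → A⊆B p , p) , proj₂) ⟩
    Pr (B ∩ A)                  ≤⟨ x≤x+y (Pr-nonneg (∩-event b (complement a))) ⟩
    Pr (B ∩ A) + Pr (B ∩ ∁ A)   ≈⟨ Pr-split a b ⟨
    Pr B                        ∎

  Pr-∪ : ∀ {A B} → IsEvent A → IsEvent B → Pr (A ∪ B) ≤ Pr A + Pr B
  Pr-∪ {A} {B} a b = begin
    Pr (A ∪ B)                                  ≈⟨ Pr-split a (∪-event a b) ⟩
    Pr ((A ∪ B) ∩ A) + Pr ((A ∪ B) ∩ ∁ A)       ≤⟨ +-mono-≤ (Pr-mono (∩-event (∪-event a b) a) a proj₂)
                                                     (Pr-mono (∩-event (∪-event a b) (complement a)) b only-b) ⟩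
    Pr A + Pr B                                 ∎
    where
    only-b : (A ∪ B) ∩ ∁ A ⊆ B
    only-b (inj₁ p , ¬p) = contradiction p ¬p
    only-b (inj₂ q , _)  = q

  Pr-∁ : ∀ {A} → IsEvent A → Pr A + Pr (∁ A) ≈ 1#
  Pr-∁ {A} a = trans (sym (Pr-+ a (complement a) λ ω (p , ¬p) → ¬p p))
    (trans (Pr-respects (∪-event a (complement a)) ((λ _ → tt) , λ {ω} _ → lem ω)) Pr-whole)
    where
    lem : ∀ ω → A ω ⊎ ¬ A ω
    lem ω with em {P = A ω}
    ... | yes p = inj₁ p
    ... | no ¬p = inj₂ ¬p

  Pr≤1 : ∀ {A} → IsEvent A → Pr A ≤ 1#
  Pr≤1 a = ≤-trans (x≤x+y (Pr-nonneg (complement a))) (≤-reflexive (Pr-∁ a))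

  -- Continuity from below. The increments `D N` are disjoint, as countable additivity demands, and
  -- their partial sums telescope to `Pr (A N)`.
  Pr-sup : ∀ {A : ℕ → Pred Ω 0ℓ} {b} → (∀ N → IsEvent (A N)) → (∀ {M N} → M ℕ.≤ N → A M ⊆ A N) →
           (∀ N → Pr (A N) ≤ b) → Pr (⋃ ℕ A) ≤ b
  Pr-sup {A} {b} ev inc bd = ≤-trans
    (≤-reflexive (Pr-respects (union ev) ((λ (N , p) → first N p) , λ (N , p) → N , D⊆A N p)))
    (proj₂ (Pr-additive D D-event disjoint) b λ x (N , x≈) → ≤-trans (≤-reflexive x≈) (partial N))
    where
    D : ℕ → Pred Ω 0ℓ
    D zero    = A 0
    D (suc N) = A (suc N) ∩ ∁ (A N)
    D-event : ∀ N → IsEvent (D N)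
    D-event zero    = ev 0
    D-event (suc N) = ∩-event (ev (suc N)) (complement (ev N))
    D⊆A : ∀ N → D N ⊆ A N
    D⊆A zero    p = p
    D⊆A (suc N) p = proj₁ p
    apart : ∀ {i j} → i ℕ.< j → Empty (D i ∩ D j)
    apart {i} {suc j} (ℕ.s≤s i≤j) ω (p , _ , ¬q) = ¬q (inc i≤j (D⊆A i p))
    disjoint : ∀ i j → i ≢ j → Empty (D i ∩ D j)
    disjoint i j i≢j ω (p , q) with ℕₚ.<-cmp i j
    ... | tri< i<j _ _ = apart i<j ω (p , q)
    ... | tri≈ _ i≡j _ = i≢j i≡j
    ... | tri> _ _ j<i = apart j<i ω (q , p)
    first : ∀ N → A N ⊆ ⋃ ℕ D
    first zero    p = 0 , p
    first (suc N) {ω} p with em {P = A N ω}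
    ... | yes q = first N q
    ... | no ¬q = suc N , p , ¬q
    total-D : ∀ N → Σ< (suc N) (Pr ∘ D) ≈ Pr (A N)
    total-D zero    = +-identityʳ (Pr (A 0))
    total-D (suc N) = begin-equality
      Σ< (suc (suc N)) (Pr ∘ D)                     ≈⟨ Σ<-snoc (suc N) (Pr ∘ D) ⟩
      Σ< (suc N) (Pr ∘ D) + Pr (D (suc N))          ≈⟨ +-congʳ (total-D N) ⟩
      Pr (A N) + Pr (D (suc N))                     ≈⟨ +-congʳ (Pr-respects (ev N) ((λ p → inc (ℕₚ.n≤1+n N) p , p) , proj₂)) ⟩
      Pr (A (suc N) ∩ A N) + Pr (A (suc N) ∩ ∁ (A N)) ≈⟨ Pr-split (ev N) (ev (suc N)) ⟨
      Pr (A (suc N))                                ∎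
    partial : ∀ N → Σ< N (Pr ∘ D) ≤ b
    partial zero    = ≤-trans (Pr-nonneg (ev 0)) (bd 0)
    partial (suc N) = ≤-trans (≤-reflexive (total-D N)) (bd N)

  Pr-⋃-approx : ∀ {A : ℕ → Pred Ω 0ℓ} → (∀ N → IsEvent (A N)) → (∀ {M N} → M ℕ.≤ N → A M ⊆ A N) →
                ∀ q → ∃ λ N → Pr (⋃ ℕ A) ≤ Pr (A N) + ½^ q
  Pr-⋃-approx {A} ev inc q with em {P = ∃ λ N → Pr (⋃ ℕ A) ≤ Pr (A N) + ½^ q}
  ... | yes p = p
  ... | no ¬p = contradiction (+-cancelʳ-≤ S (begin
      ½^ q + S            ≤⟨ +-mono-≤ ≤-refl S≤ ⟩
      ½^ q + (S - ½^ q)   ≈⟨ trans (+-comm _ _) (y-x+x≈y (½^ q) S) ⟩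
      S                   ≈⟨ +-identityˡ S ⟨
      0# + S              ∎)) (0<½^ q)
    where
    S = Pr (⋃ ℕ A)
    S≤ : S ≤ S - ½^ q
    S≤ = Pr-sup ev inc λ N → +-cancelʳ-≤ (½^ q) (begin
      Pr (A N) + ½^ q     ≤⟨ <⇒≤ (λ le → ¬p (N , le)) ⟩
      S                   ≈⟨ y-x+x≈y (½^ q) S ⟨
      (S - ½^ q) + ½^ q   ∎)

  Pr-⋂-approx : ∀ {B : ℕ → Pred Ω 0ℓ} → (∀ N → IsEvent (B N)) → (∀ {M N} → M ℕ.≤ N → B N ⊆ B M) →
                ∀ q → ∃ λ N → Pr (B N) ≤ Pr (⋂ ℕ B) + ½^ q
  Pr-⋂-approx {B} ev dec q =
    let N , le = Pr-⋃-approx (complement ∘ ev) (λ M≤N ¬p p → ¬p (dec M≤N p)) q in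
    N , linear (≤-trans (Pr-mono (complement (⋂-event ev)) (union (complement ∘ ev)) some) le)
      (begin-equality
        Pr (B N) + (Pr (∁ (B N)) + ½^ q)             ≈⟨ +-assoc _ _ _ ⟨
        (Pr (B N) + Pr (∁ (B N))) + ½^ q             ≈⟨ +-congʳ (trans (Pr-∁ (ev N)) (sym (Pr-∁ (⋂-event ev)))) ⟩
        (Pr (⋂ ℕ B) + Pr (∁ (⋂ ℕ B))) + ½^ q         ≈⟨ solve 3 (λ x y z → (x :+ y) :+ z := (x :+ z) :+ y) refl _ _ _ ⟩
        (Pr (⋂ ℕ B) + ½^ q) + Pr (∁ (⋂ ℕ B))         ∎)
    where
    some : ∁ (⋂ ℕ B) ⊆ ⋃ ℕ (∁ ∘ B)
    some ¬all = stable λ ¬some → ¬all λ N → stable λ ¬BN → ¬some (N , ¬BN)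

  -- A list rather than a function, so that the expectation can be read off the terms; by `𝔼-mono`
  -- it does not depend on the list that represents a function.
  Simple : Set₁
  Simple = List (ℝ × ∃ IsEvent)

  eval : Simple → Ω → ℝ
  eval []                  ω = 0#
  eval ((c , A , _) ∷ s) ω = c * 𝟙 (A ω) + eval s ω

  𝔼on : (B : Pred Ω 0ℓ) → Simple → ℝ
  𝔼on B []                = 0#
  𝔼on B ((c , A , _) ∷ s) = c * Pr (B ∩ A) + 𝔼on B s

  𝔼 : Simple → ℝ
  𝔼 []                = 0#
  𝔼 ((c , A , _) ∷ s) = c * Pr A + 𝔼 s

  scaleS : ℝ → Simple → Simple
  scaleS d = List.map λ (c , A) → d * c , A

  eval-++ : ∀ s t ω → eval (s ++ t) ω ≈ eval s ω + eval t ω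
  eval-++ []      t ω = sym (+-identityˡ _)
  eval-++ (_ ∷ s) t ω = trans (+-congˡ (eval-++ s t ω)) (sym (+-assoc _ _ _))

  𝔼-++ : ∀ s t → 𝔼 (s ++ t) ≈ 𝔼 s + 𝔼 t
  𝔼-++ []      t = sym (+-identityˡ _)
  𝔼-++ (_ ∷ s) t = trans (+-congˡ (𝔼-++ s t)) (sym (+-assoc _ _ _))

  eval-scale : ∀ d s ω → eval (scaleS d s) ω ≈ d * eval s ω
  eval-scale d []                ω = sym (zeroʳ d)
  eval-scale d ((c , A , _) ∷ s) ω =
    trans (+-cong (*-assoc d c _) (eval-scale d s ω)) (sym (distribˡ d _ _))

  𝔼-scale : ∀ d s → 𝔼 (scaleS d s) ≈ d * 𝔼 s
  𝔼-scale d []                = sym (zeroʳ d)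
  𝔼-scale d ((c , A , _) ∷ s) = trans (+-cong (*-assoc d c _) (𝔼-scale d s)) (sym (distribˡ d _ _))

  𝔼on-U : ∀ s → 𝔼on U s ≈ 𝔼 s
  𝔼on-U []                = refl
  𝔼on-U ((c , A , a) ∷ s) = +-cong (*-congˡ (Pr-respects (∩-event whole a) (proj₂ , (λ p → tt , p)))) (𝔼on-U s)

  𝔼on-split : ∀ {A B} → IsEvent A → IsEvent B → ∀ s → 𝔼on B s ≈ 𝔼on (B ∩ A) s + 𝔼on (B ∩ ∁ A) s
  𝔼on-split a b [] = sym (+-identityˡ 0#)
  𝔼on-split {A} {B} a b ((c , C , e) ∷ s) = begin-equality
    c * Pr (B ∩ C) + 𝔼on B s
      ≈⟨ +-cong (*-congˡ (trans (Pr-split a (∩-event b e)) (+-cong (swap a) (swap (complement a))))) (𝔼on-split a b s) ⟩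
    c * (Pr ((B ∩ A) ∩ C) + Pr ((B ∩ ∁ A) ∩ C)) + (𝔼on (B ∩ A) s + 𝔼on (B ∩ ∁ A) s)
      ≈⟨ solve 5 (λ c x y u v → c :* (x :+ y) :+ (u :+ v) := (c :* x :+ u) :+ (c :* y :+ v)) refl c _ _ _ _ ⟩
    (c * Pr ((B ∩ A) ∩ C) + 𝔼on (B ∩ A) s) + (c * Pr ((B ∩ ∁ A) ∩ C) + 𝔼on (B ∩ ∁ A) s) ∎
    where
    swap : ∀ {A} → IsEvent A → Pr ((B ∩ C) ∩ A) ≈ Pr ((B ∩ A) ∩ C)
    swap a = Pr-respects (∩-event (∩-event b e) a)
      ((λ ((x , y) , z) → (x , z) , y) , (λ ((x , z) , y) → (x , y) , z))

  -- Splitting `B` along the first event of a list makes its indicator constant on each part, where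
  -- the coefficient is absorbed by `c` or `d`. Once both lists are empty, two constants are
  -- compared.
  𝔼on-mono : ∀ {B} → IsEvent B → ∀ c d s t → (∀ {ω} → B ω → c + eval s ω ≤ d + eval t ω) →
             c * Pr B + 𝔼on B s ≤ d * Pr B + 𝔼on B t
  𝔼on-mono {B} b c d [] [] c≤d with em {P = ∃ B}
  ... | yes (ω , p) = +-monoˡ 0# (begin
    c * Pr B ≈⟨ *-comm c (Pr B) ⟩
    Pr B * c ≤⟨ *-monoˡ-≤ (Pr-nonneg b) (+-cancelʳ-≤ 0# (c≤d p)) ⟩
    Pr B * d ≈⟨ *-comm (Pr B) d ⟩
    d * Pr B ∎)
  -- On an empty `B` the hypothesis says nothing about `c` and `d`, but both sides have probability
  -- 0 as a factor.
  ... | no ¬p = ≤-reflexive (+-congʳ (trans (null c) (sym (null d))))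
    where
    null : ∀ c → c * Pr B ≈ 0#
    null c = trans (*-congˡ (trans (Pr-respects b ((λ p → contradiction (_ , p) ¬p) , λ ())) Pr-∅)) (zeroʳ c)
  𝔼on-mono {B} b c d [] ((e , A , a) ∷ t) h = begin
    c * Pr B + 0#
      ≈⟨ trans (+-identityʳ _) (trans (*-congˡ (Pr-split a b)) (distribˡ c _ _)) ⟩
    c * Pr (B ∩ A) + c * Pr (B ∩ ∁ A)
      ≈⟨ +-cong (+-identityʳ _) (+-identityʳ _) ⟨
    (c * Pr (B ∩ A) + 0#) + (c * Pr (B ∩ ∁ A) + 0#)
      ≤⟨ +-mono-≤
           (𝔼on-mono (∩-event b a) c (d + e) [] t λ (p , q) → ≤-trans (h p) (≤-reflexive
             (trans (+-congˡ (+-congʳ (trans (*-congˡ (𝟙-yes q)) (*-identityʳ e)))) (sym (+-assoc d e _)))))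
           (𝔼on-mono (∩-event b (complement a)) c d [] t λ (p , ¬q) → ≤-trans (h p) (≤-reflexive
             (+-congˡ (trans (+-congʳ (trans (*-congˡ (𝟙-no ¬q)) (zeroʳ e))) (+-identityˡ _))))) ⟩
    ((d + e) * Pr (B ∩ A) + 𝔼on (B ∩ A) t) + (d * Pr (B ∩ ∁ A) + 𝔼on (B ∩ ∁ A) t)
      ≈⟨ solve 6 (λ d e x y u v → ((d :+ e) :* x :+ u) :+ (d :* y :+ v) := d :* (x :+ y) :+ (e :* x :+ (u :+ v))) refl d e _ _ _ _ ⟩
    d * (Pr (B ∩ A) + Pr (B ∩ ∁ A)) + (e * Pr (B ∩ A) + (𝔼on (B ∩ A) t + 𝔼on (B ∩ ∁ A) t))
      ≈⟨ +-cong (*-congˡ (Pr-split a b)) (+-congˡ (𝔼on-split a b t)) ⟨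
    d * Pr B + (e * Pr (B ∩ A) + 𝔼on B t) ∎
  𝔼on-mono {B} b c d ((e , A , a) ∷ s) t h = begin
    c * Pr B + (e * Pr (B ∩ A) + 𝔼on B s)
      ≈⟨ +-cong (*-congˡ (Pr-split a b)) (+-congˡ (𝔼on-split a b s)) ⟩
    c * (Pr (B ∩ A) + Pr (B ∩ ∁ A)) + (e * Pr (B ∩ A) + (𝔼on (B ∩ A) s + 𝔼on (B ∩ ∁ A) s))
      ≈⟨ solve 6 (λ d e x y u v → ((d :+ e) :* x :+ u) :+ (d :* y :+ v) := d :* (x :+ y) :+ (e :* x :+ (u :+ v))) refl c e _ _ _ _ ⟨
    ((c + e) * Pr (B ∩ A) + 𝔼on (B ∩ A) s) + (c * Pr (B ∩ ∁ A) + 𝔼on (B ∩ ∁ A) s)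
      ≤⟨ +-mono-≤
           (𝔼on-mono (∩-event b a) (c + e) d s t λ (p , q) → ≤-trans (≤-reflexive
             (trans (+-assoc c e _) (+-congˡ (+-congʳ (sym (trans (*-congˡ (𝟙-yes q)) (*-identityʳ e))))))) (h p))
           (𝔼on-mono (∩-event b (complement a)) c d s t λ (p , ¬q) → ≤-trans (≤-reflexive
             (+-congˡ (sym (trans (+-congʳ (trans (*-congˡ (𝟙-no ¬q)) (zeroʳ e))) (+-identityˡ _))))) (h p)) ⟩
    (d * Pr (B ∩ A) + 𝔼on (B ∩ A) t) + (d * Pr (B ∩ ∁ A) + 𝔼on (B ∩ ∁ A) t)
      ≈⟨ solve 5 (λ d x y u v → (d :* x :+ u) :+ (d :* y :+ v) := d :* (x :+ y) :+ (u :+ v)) refl d _ _ _ _ ⟩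
    d * (Pr (B ∩ A) + Pr (B ∩ ∁ A)) + (𝔼on (B ∩ A) t + 𝔼on (B ∩ ∁ A) t)
      ≈⟨ +-cong (*-congˡ (Pr-split a b)) (𝔼on-split a b t) ⟨
    d * Pr B + 𝔼on B t ∎

  𝔼-mono : ∀ s t → (∀ ω → eval s ω ≤ eval t ω) → 𝔼 s ≤ 𝔼 t
  𝔼-mono s t s≤t = begin
    𝔼 s                    ≈⟨ drop0 s ⟨
    0# * Pr U + 𝔼on U s    ≤⟨ 𝔼on-mono whole 0# 0# s t (λ {ω} _ → +-mono-≤ ≤-refl (s≤t ω)) ⟩
    0# * Pr U + 𝔼on U t    ≈⟨ drop0 t ⟩
    𝔼 t                    ∎
    where
    drop0 : ∀ s → 0# * Pr U + 𝔼on U s ≈ 𝔼 s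
    drop0 s = trans (+-congʳ (zeroˡ (Pr U))) (trans (+-identityˡ _) (𝔼on-U s))

  -- On each cell cut out by the events of the list the simple function is constant, and the
  -- condition there is `p` at a constant. Since `p` may depend on ω, the lemma can be nested, which
  -- compares two simple functions.
  level-event : ∀ (p : ℝ → Pred Ω 0ℓ) → (∀ r → IsEvent (p r)) → (∀ {r r′} → r ≈ r′ → p r ⊆ p r′) →
                ∀ s c → IsEvent λ ω → p (c + eval s ω) ω
  level-event p p-event p-resp [] c =
    respects (p-resp (sym (+-identityʳ c)) , p-resp (+-identityʳ c)) (p-event c)
  level-event p p-event p-resp ((e , A , a) ∷ s) c = respects (to , from)
    (∪-event (∩-event a (level-event p p-event p-resp s (c + e)))
             (∩-event (complement a) (level-event p p-event p-resp s c)))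
    where
    on : ∀ {ω} → A ω → (c + e) + eval s ω ≈ c + (e * 𝟙 (A ω) + eval s ω)
    on q = trans (+-assoc c e _) (+-congˡ (+-congʳ (sym (trans (*-congˡ (𝟙-yes q)) (*-identityʳ e)))))
    off : ∀ {ω} → ¬ A ω → c + eval s ω ≈ c + (e * 𝟙 (A ω) + eval s ω)
    off ¬q = +-congˡ (sym (trans (+-congʳ (trans (*-congˡ (𝟙-no ¬q)) (zeroʳ e))) (+-identityˡ _)))
    cases whole-level : Pred Ω 0ℓ
    cases = (A ∩ λ ω → p ((c + e) + eval s ω) ω) ∪ (∁ A ∩ λ ω → p (c + eval s ω) ω)
    whole-level ω = p (c + eval ((e , A , a) ∷ s) ω) ω
    to : cases ⊆ whole-level
    to {ω} (inj₁ (q , r))  = p-resp (on {ω} q) r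
    to {ω} (inj₂ (¬q , r)) = p-resp (off {ω} ¬q) r
    from : whole-level ⊆ cases
    from {ω} r = decide em
      where
      decide : Dec (A ω) → cases ω
      decide (yes q) = inj₁ (q , p-resp (sym (on {ω} q)) r)
      decide (no ¬q) = inj₂ (¬q , p-resp (sym (off {ω} ¬q)) r)

  <-event : ∀ s t → IsEvent λ ω → eval s ω < eval t ω
  <-event s t = respects
    ((λ lt le → lt (≤-trans (≤-reflexive (+-identityˡ _)) (≤-trans le (≤-reflexive (sym (+-identityˡ _)))))) ,
     (λ lt le → lt (≤-trans (≤-reflexive (sym (+-identityˡ _))) (≤-trans le (≤-reflexive (+-identityˡ _))))))
    (level-event (λ r ω → r < 0# + eval t ω)
      (λ r → level-event (λ r′ _ → r < r′) (λ r′ → const-event (r < r′))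
        (λ r≈ lt le → lt (≤-trans (≤-reflexive r≈) le)) t 0#)
      (λ r≈ lt le → lt (≤-trans le (≤-reflexive (sym r≈)))) s 0#)

  -- Averaging over finitely many digits keeps a function of ω simple. Exchanging this average with
  -- the expectation is then linearity, the finite case of Fubini.
  avgS : ℕ → (Cantor → Simple) → Simple
  avgS zero    σ = σ λ _ → false
  avgS (suc k) σ = scaleS ½ (avgS k (σ ∘ (false ◂_))) ++ scaleS ½ (avgS k (σ ∘ (true ◂_)))

  eval-avgS : ∀ k σ ω → eval (avgS k σ) ω ≈ ∫ (avg k) (λ a → eval (σ a) ω)
  eval-avgS zero    σ ω = refl
  eval-avgS (suc k) σ ω = trans (eval-++ (scaleS ½ (half false)) (scaleS ½ (half true)) ω)
    (+-cong (each false) (each true))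
    where
    half : Bool → Simple
    half b = avgS k (σ ∘ (b ◂_))
    each : ∀ b → eval (scaleS ½ (half b)) ω ≈ ½ * ∫ (avg k) (λ a → eval (σ (b ◂ a)) ω)
    each b = trans (eval-scale ½ (half b) ω) (*-congˡ (eval-avgS k (σ ∘ (b ◂_)) ω))

  𝔼-avgS : ∀ k σ → 𝔼 (avgS k σ) ≈ ∫ (avg k) (𝔼 ∘ σ)
  𝔼-avgS zero    σ = refl
  𝔼-avgS (suc k) σ = trans (𝔼-++ (scaleS ½ (half false)) (scaleS ½ (half true)))
    (+-cong (each false) (each true))
    where
    half : Bool → Simple
    half b = avgS k (σ ∘ (b ◂_))
    each : ∀ b → 𝔼 (scaleS ½ (half b)) ≈ ½ * ∫ (avg k) (𝔼 ∘ σ ∘ (b ◂_))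
    each b = trans (𝔼-scale ½ (half b)) (*-congˡ (𝔼-avgS k (σ ∘ (b ◂_))))

  AvgS : ∀ n → ℕ → (Vec Cantor n → Simple) → Simple
  AvgS zero    k σ = σ []
  AvgS (suc n) k σ = avgS k λ a → AvgS n k (σ ∘ (a ∷_))

  eval-AvgS : ∀ n k (σ : Vec Cantor n → Simple) ω → eval (AvgS n k σ) ω ≈ ∫ (Avg n k) (λ x → eval (σ x) ω)
  eval-AvgS zero    k σ ω = refl
  eval-AvgS (suc n) k σ ω = trans (eval-avgS k (λ a → AvgS n k (σ ∘ (a ∷_))) ω)
    (∫-cong (avg k) λ a → eval-AvgS n k (σ ∘ (a ∷_)) ω)

  𝔼-AvgS : ∀ n k (σ : Vec Cantor n → Simple) → 𝔼 (AvgS n k σ) ≈ ∫ (Avg n k) (𝔼 ∘ σ)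
  𝔼-AvgS zero    k σ = refl
  𝔼-AvgS (suc n) k σ = trans (𝔼-avgS k (λ a → AvgS n k (σ ∘ (a ∷_))))
    (∫-cong (avg k) λ a → 𝔼-AvgS n k (σ ∘ (a ∷_)))

-- Approximating regions by elementary sets

module Approximation (R : RealField) (em : ∀ {ℓ} → ExcludedMiddle ℓ)
                     (PS : BatchRecovery.ProbabilitySpace R) (n : ℕ) where

  open OrderedField R
  open Integration R em
  open Probability R em PS

  Point : Set
  Point = Vec Cantor n

  -- Subsets of Ω × Cantorⁿ, by their sections.
  Region : Set₁
  Region = Point → Pred Ω 0ℓ

  record Elementary : Set₁ where
    field
      level   : ℕ
      set     : Region
      event   : ∀ x → IsEvent (set x)
      decides : ∀ {x y} → Agree level x y → set x ⊆ set y

    Pr-dep : Dep level (Pr ∘ set)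
    Pr-dep {x} ag = Pr-respects (event x) (decides ag , decides (Agree-sym ag))

  open Elementary public

  vol : Elementary → ℝ
  vol F = ∫ (Avg n (level F)) (Pr ∘ set F)

  vol-at : ∀ F {k} → level F ℕ.≤ k → vol F ≈ ∫ (Avg n k) (Pr ∘ set F)
  vol-at F le = Avg-level le (Pr-dep F)

  vol≤1 : ∀ F → vol F ≤ 1#
  vol≤1 F = ≤-trans (∫-mono (Avg n (level F)) λ x → Pr≤1 (event F x)) (≤-reflexive (Avg-const n (level F) 1#))

  elementary : (E : Pred Ω 0ℓ) → IsEvent E → Elementary
  elementary E e = record { level = 0 ; set = λ _ → E ; event = λ _ → e ; decides = λ _ p → p }

  infixr 6 _∪ᴱ_
  _∪ᴱ_ : Elementary → Elementary → Elementary
  F ∪ᴱ G = record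
    { level   = level F ℕ.⊔ level G
    ; set     = λ x → set F x ∪ set G x
    ; event   = λ x → ∪-event (event F x) (event G x)
    ; decides = λ ag → [ inj₁ ∘ decides F (Agree-anti (ℕₚ.m≤m⊔n (level F) (level G)) ag)
                       , inj₂ ∘ decides G (Agree-anti (ℕₚ.m≤n⊔m (level F) (level G)) ag) ]′ }

  ∁ᴱ : Elementary → Elementary
  ∁ᴱ F = record
    { level   = level F
    ; set     = λ x → ∁ (set F x)
    ; event   = λ x → complement (event F x)
    ; decides = λ ag ¬p p → ¬p (decides F (Agree-sym ag) p) }

  infixr 6 _∖ᴱ_
  _∖ᴱ_ : Elementary → Elementary → Elementary
  F ∖ᴱ G = record
    { level   = level F ℕ.⊔ level G
    ; set     = λ x → set F x ∩ ∁ (set G x)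
    ; event   = λ x → ∩-event (event F x) (complement (event G x))
    ; decides = λ ag (p , ¬q) → decides F (Agree-anti (ℕₚ.m≤m⊔n (level F) (level G)) ag) p ,
                  λ q → ¬q (decides G (Agree-sym (Agree-anti (ℕₚ.m≤n⊔m (level F) (level G)) ag)) q) }

  vol-∪ : ∀ F G → vol (F ∪ᴱ G) ≤ vol F + vol G
  vol-∪ F G = begin
    vol (F ∪ᴱ G)                                        ≤⟨ ∫-mono I (λ x → Pr-∪ (event F x) (event G x)) ⟩
    ∫ I (λ x → Pr (set F x) + Pr (set G x))             ≈⟨ ∫-+ I (Pr ∘ set F) (Pr ∘ set G) ⟩
    ∫ I (Pr ∘ set F) + ∫ I (Pr ∘ set G)                 ≈⟨ +-cong (vol-at F (ℕₚ.m≤m⊔n (level F) (level G))) (vol-at G (ℕₚ.m≤n⊔m (level F) (level G))) ⟨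
    vol F + vol G                                       ∎
    where I = Avg n (level F ℕ.⊔ level G)

  vol-∖ : ∀ F G → (∀ x → set G x ⊆ set F x) → vol (F ∖ᴱ G) + vol G ≈ vol F
  vol-∖ F G G⊆F = begin-equality
    vol (F ∖ᴱ G) + vol G                                ≈⟨ +-congˡ (vol-at G (ℕₚ.m≤n⊔m (level F) (level G))) ⟩
    ∫ I (Pr ∘ set (F ∖ᴱ G)) + ∫ I (Pr ∘ set G)          ≈⟨ ∫-+ I (Pr ∘ set (F ∖ᴱ G)) (Pr ∘ set G) ⟨
    ∫ I (λ x → Pr (set (F ∖ᴱ G) x) + Pr (set G x))      ≈⟨ ∫-cong I pointwise ⟩
    ∫ I (Pr ∘ set F)                                    ≈⟨ vol-at F (ℕₚ.m≤m⊔n (level F) (level G)) ⟨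
    vol F                                               ∎
    where
    I = Avg n (level F ℕ.⊔ level G)
    pointwise : ∀ x → Pr (set (F ∖ᴱ G) x) + Pr (set G x) ≈ Pr (set F x)
    pointwise x = begin-equality
      Pr (set (F ∖ᴱ G) x) + Pr (set G x)              ≈⟨ +-comm _ _ ⟩
      Pr (set G x) + Pr (set F x ∩ ∁ (set G x))       ≈⟨ +-congʳ (Pr-respects (event G x) ((λ q → G⊆F x q , q) , proj₂)) ⟩
      Pr (set F x ∩ set G x) + Pr (set F x ∩ ∁ (set G x)) ≈⟨ Pr-split (event G x) (event F x) ⟨
      Pr (set F x)                                    ∎

  vol-elementary : ∀ {E} (e : IsEvent E) → vol (elementary E e) ≈ Pr E
  vol-elementary e = Avg-const n 0 _

  -- A bound `b` on the outer measure of `E`. The covering sets increase instead of forming a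
  -- series, so that only volumes of finite stages have to be bounded.
  record Cover (E : Region) (b : ℝ) : Set₁ where
    field
      part   : ℕ → Elementary
      inc    : ∀ {M N} → M ℕ.≤ N → ∀ x → set (part M) x ⊆ set (part N) x
      covers : ∀ x {ω} → E x ω → ∃ λ N → set (part N) x ω
      small  : ∀ N → vol (part N) ≤ b

  open Cover public

  cover-⊆ : ∀ {D E b} → (∀ x → D x ⊆ E x) → Cover E b → Cover D b
  cover-⊆ D⊆E C = record
    { part = part C ; inc = inc C ; covers = λ x d → covers C x (D⊆E x d) ; small = small C }

  cover-∅ : ∀ {E b} → (∀ x → Empty (E x)) → 0# ≤ b → Cover E b
  cover-∅ empty 0≤b = record
    { part   = λ _ → elementary ∅ ∅-event
    ; inc    = λ _ _ ()
    ; covers = λ x {ω} e → contradiction e (empty x ω)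
    ; small  = λ _ → ≤-trans (≤-reflexive (trans (vol-elementary ∅-event) Pr-∅)) 0≤b }

  cover-∪ : ∀ {D E b c} → Cover D b → Cover E c → Cover (λ x → D x ∪ E x) (b + c)
  cover-∪ C C′ = record
    { part   = λ N → part C N ∪ᴱ part C′ N
    ; inc    = λ M≤N x → [ inj₁ ∘ inc C M≤N x , inj₂ ∘ inc C′ M≤N x ]′
    ; covers = λ x → [ (λ d → let N , p = covers C x d in N , inj₁ p)
                     , (λ e → let N , p = covers C′ x e in N , inj₂ p) ]′
    ; small  = λ N → ≤-trans (vol-∪ (part C N) (part C′ N)) (+-mono-≤ (small C N) (small C′ N)) }

  ⋃ᴱ : (ℕ → Elementary) → ℕ → Elementary
  ⋃ᴱ F zero    = F 0
  ⋃ᴱ F (suc m) = ⋃ᴱ F m ∪ᴱ F (suc m)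

  ∈-⋃ᴱ : ∀ F {m i x ω} → i ℕ.≤ m → set (F i) x ω → set (⋃ᴱ F m) x ω
  ∈-⋃ᴱ F {zero}  ℕ.z≤n p = p
  ∈-⋃ᴱ F {suc m} i≤1+m p with ℕₚ.m≤n⇒m<n∨m≡n i≤1+m
  ... | inj₁ (ℕ.s≤s i≤m) = inj₁ (∈-⋃ᴱ F i≤m p)
  ... | inj₂ ≡.refl      = inj₂ p

  ⋃ᴱ-∈ : ∀ F m {x ω} → set (⋃ᴱ F m) x ω → ∃ λ i → i ℕ.≤ m × set (F i) x ω
  ⋃ᴱ-∈ F zero    p        = 0 , ℕ.z≤n , p
  ⋃ᴱ-∈ F (suc m) (inj₁ p) = let i , i≤m , q = ⋃ᴱ-∈ F m p in i , ℕₚ.m≤n⇒m≤1+n i≤m , q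
  ⋃ᴱ-∈ F (suc m) (inj₂ p) = suc m , ℕₚ.≤-refl , p

  ⋃ᴱ-inc : ∀ F {M N} → M ℕ.≤ N → ∀ x → set (⋃ᴱ F M) x ⊆ set (⋃ᴱ F N) x
  ⋃ᴱ-inc F {M} M≤N x p = let i , i≤M , q = ⋃ᴱ-∈ F M p in ∈-⋃ᴱ F (ℕₚ.≤-trans i≤M M≤N) q

  -- Stage `N` unites the stages `N` of the covers `0` to `N`, so it is elementary and increases in
  -- `N`; its volume is bounded by a geometric series.
  cover-⋃ : ∀ {E : ℕ → Region} p → (∀ i → Cover (E i) (½^ (suc (p ℕ.+ i)))) →
            Cover (λ x → ⋃ ℕ λ i → E i x) (½^ p)
  cover-⋃ {E} p C = record
    { part   = λ N → ⋃ᴱ (λ i → part (C i) N) N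
    ; inc    = λ {M} {N} M≤N x q →
        let i , i≤M , r = ⋃ᴱ-∈ (λ i → part (C i) M) M q
        in ∈-⋃ᴱ (λ i → part (C i) N) (ℕₚ.≤-trans i≤M M≤N) (inc (C i) M≤N x r)
    ; covers = λ x (i , e) →
        let N , q = covers (C i) x e
        in i ℕ.⊔ N , ∈-⋃ᴱ (λ i′ → part (C i′) (i ℕ.⊔ N)) (ℕₚ.m≤m⊔n i N) (inc (C i) (ℕₚ.m≤n⊔m i N) x q)
    ; small  = λ N → ≤-trans (x≤x+y (0≤½^ (suc (p ℕ.+ N)))) (geometric N N) }
    where
    -- The added power of ½ is the unspent rest of the series; with it the bound becomes inductive.
    geometric : ∀ N m → vol (⋃ᴱ (λ i → part (C i) N) m) + ½^ (suc (p ℕ.+ m)) ≤ ½^ p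
    geometric N zero = begin
      vol (part (C 0) N) + ½^ (suc (p ℕ.+ 0))            ≤⟨ +-monoˡ _ (small (C 0) N) ⟩
      ½^ (suc (p ℕ.+ 0)) + ½^ (suc (p ℕ.+ 0))            ≈⟨ ½^-double (p ℕ.+ 0) ⟩
      ½^ (p ℕ.+ 0)                                       ≡⟨ ≡.cong ½^ (ℕₚ.+-identityʳ p) ⟩
      ½^ p                                               ∎
    geometric N (suc m) = begin
      vol (⋃ᴱ S (suc m)) + h                             ≤⟨ +-monoˡ h (≤-trans (vol-∪ (⋃ᴱ S m) (S (suc m))) (+-mono-≤ ≤-refl (small (C (suc m)) N))) ⟩
      (vol (⋃ᴱ S m) + h) + h                             ≈⟨ +-assoc _ _ _ ⟩
      vol (⋃ᴱ S m) + (h + h)                             ≈⟨ +-congˡ (½^-double (p ℕ.+ suc m)) ⟩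
      vol (⋃ᴱ S m) + ½^ (p ℕ.+ suc m)                    ≡⟨ ≡.cong (λ k → vol (⋃ᴱ S m) + ½^ k) (ℕₚ.+-suc p m) ⟩
      vol (⋃ᴱ S m) + ½^ (suc (p ℕ.+ m))                  ≤⟨ geometric N m ⟩
      ½^ p                                               ∎
      where
      S = λ i → part (C i) N
      h = ½^ (suc (p ℕ.+ suc m))

  Difference : Region → Elementary → Region
  Difference E F x = (E x ∩ ∁ (set F x)) ∪ (set F x ∩ ∁ (E x))

  -- These regions are closed under the σ-algebra operations, so they include all preimages of
  -- jointly measurable sets, and no product measure has to be constructed. The sections are
  -- required to be events so that their probabilities make sense.
  Approximable : Region → Set₁
  Approximable E = (∀ x → IsEvent (E x)) × ∀ p → ∃ λ F → Cover (Difference E F) (½^ p)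

  approx-respects : ∀ {D E} → (∀ x → D x ≐ E x) → Approximable D → Approximable E
  approx-respects D≐E (ev , approx) =
    (λ x → respects (D≐E x) (ev x)) , λ p → let F , C = approx p in
      F , cover-⊆ (λ x → [ (λ (e , ¬f) → inj₁ (proj₂ (D≐E x) e , ¬f))
                         , (λ (f , ¬e) → inj₂ (f , ¬e ∘ proj₁ (D≐E x))) ]′) C

  approx-elementary : ∀ F → Approximable (set F)
  approx-elementary F = event F , λ p → F ,
    cover-∅ (λ x ω → [ (λ (f , ¬f) → ¬f f) , (λ (f , ¬f) → ¬f f) ]′) (0≤½^ p)

  approx-const : ∀ {E} → IsEvent E → Approximable (λ _ → E)
  approx-const e = approx-elementary (elementary _ e)

  approx-∁ : ∀ {E} → Approximable E → Approximable (λ x → ∁ (E x))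
  approx-∁ (ev , approx) = (λ x → complement (ev x)) , λ p → let F , C = approx p in
    ∁ᴱ F , cover-⊆ (λ x → [ (λ (¬e , ¬¬f) → inj₂ (stable ¬¬f , ¬e))
                          , (λ (¬f , ¬¬e) → inj₁ (stable ¬¬e , ¬f)) ]′) C

  vol-stabilizes : ∀ (F : ℕ → Elementary) q → ∃ λ M → ∀ N → vol (F N) ≤ vol (F M) + ½^ q
  vol-stabilizes F q = M , λ N → ≤-trans (proj₁ isSup _ (N , refl)) s≤
    where
    supremum = complete (λ x → ∃ λ N → x ≈ vol (F N)) (_ , 0 , refl)
      (1# , λ x (N , x≈) → ≤-trans (≤-reflexive x≈) (vol≤1 (F N)))
    s = proj₁ supremum
    isSup = proj₂ supremum
    attained : ∃ λ M → s ≤ vol (F M) + ½^ q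
    attained with em {P = ∃ λ M → s ≤ vol (F M) + ½^ q}
    ... | yes p = p
    ... | no ¬p = contradiction (+-cancelʳ-≤ s (begin
      ½^ q + s            ≤⟨ +-mono-≤ ≤-refl (proj₂ isSup (s - ½^ q) λ x (N , x≈) → +-cancelʳ-≤ (½^ q) (begin
        x + ½^ q            ≈⟨ +-congʳ x≈ ⟩
        vol (F N) + ½^ q    ≤⟨ <⇒≤ (λ le → ¬p (N , le)) ⟩
        s                   ≈⟨ y-x+x≈y (½^ q) s ⟨
        (s - ½^ q) + ½^ q   ∎)) ⟩
      ½^ q + (s - ½^ q)   ≈⟨ trans (+-comm _ _) (y-x+x≈y (½^ q) s) ⟩
      s                   ≈⟨ +-identityˡ s ⟨
      0# + s              ∎)) (0<½^ q)
    M = proj₁ attained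
    s≤ = proj₂ attained

  -- The volumes of the finite unions increase and are at most 1, so beyond some `M` they gain at
  -- most `½^ q`. What later unions add to the union up to `M` covers the tail.
  cover-tail : ∀ (F : ℕ → Elementary) q → ∃ λ M →
               Cover (λ x → (⋃ ℕ λ N → set (F N) x) ∩ ∁ (set (⋃ᴱ F M) x)) (½^ q)
  cover-tail F q = M , record
    { part   = λ N → ⋃ᴱ F (M ℕ.+ N) ∖ᴱ ⋃ᴱ F M
    ; inc    = λ M≤N x (g , ¬g) → ⋃ᴱ-inc F (ℕₚ.+-monoʳ-≤ M M≤N) x g , ¬g
    ; covers = λ x ((N , f) , ¬g) → N , ∈-⋃ᴱ F (ℕₚ.m≤n+m N M) f , ¬g
    ; small  = λ N → +-cancelʳ-≤ (vol (⋃ᴱ F M)) (begin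
        vol (⋃ᴱ F (M ℕ.+ N) ∖ᴱ ⋃ᴱ F M) + vol (⋃ᴱ F M) ≈⟨ vol-∖ (⋃ᴱ F (M ℕ.+ N)) (⋃ᴱ F M) (⋃ᴱ-inc F (ℕₚ.m≤m+n M N)) ⟩
        vol (⋃ᴱ F (M ℕ.+ N))                          ≤⟨ proj₂ stabilizes (M ℕ.+ N) ⟩
        vol (⋃ᴱ F M) + ½^ q                           ≈⟨ +-comm _ _ ⟩
        ½^ q + vol (⋃ᴱ F M)                           ∎) }
    where
    stabilizes = vol-stabilizes (⋃ᴱ F) q
    M = proj₁ stabilizes

  difference-⋃ : ∀ (E : ℕ → Region) F M x → Difference (λ x → ⋃ ℕ λ i → E i x) (⋃ᴱ F M) x ⊆
    ((⋃ ℕ λ i → Difference (E i) (F i) x) ∪ ((⋃ ℕ λ N → set (F N) x) ∩ ∁ (set (⋃ᴱ F M) x)))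
  difference-⋃ E F M x {ω} (inj₁ ((i , e) , ¬g)) with em {P = set (F i) x ω}
  ... | yes f = inj₂ ((i , f) , ¬g)
  ... | no ¬f = inj₁ (i , inj₁ (e , ¬f))
  difference-⋃ E F M x (inj₂ (g , ¬e)) =
    let i , _ , f = ⋃ᴱ-∈ F M g in inj₁ (i , inj₂ (f , λ e → ¬e (i , e)))

  cover-≤ : ∀ {E b c} → b ≤ c → Cover E b → Cover E c
  cover-≤ b≤c C = record
    { part = part C ; inc = inc C ; covers = covers C ; small = λ N → ≤-trans (small C N) b≤c }

  difference-cover : ∀ (E : ℕ → Region) F p → Cover (λ x → ⋃ ℕ λ i → Difference (E i) (F i) x) (½^ (suc p)) →
                     ∃ λ G → Cover (Difference (λ x → ⋃ ℕ λ i → E i x) G) (½^ p)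
  difference-cover E F p errors =
    let M , tail = cover-tail F (suc p)
    in ⋃ᴱ F M , cover-≤ (≤-reflexive (½^-double p)) (cover-⊆ (difference-⋃ E F M) (cover-∪ errors tail))

  -- Half of the error `½^ p` is shared geometrically among the approximations of the `E i`; the
  -- other half pays for cutting the union off after finitely many sets.
  approx-⋃ : ∀ {E : ℕ → Region} → (∀ i → Approximable (E i)) → Approximable (λ x → ⋃ ℕ λ i → E i x)
  approx-⋃ {E} good = (λ x → union λ i → proj₁ (good i) x) , λ p →
    difference-cover E (λ i → proj₁ (proj₂ (good i) (suc (suc p ℕ.+ i)))) p
      (cover-⋃ (suc p) λ i → proj₂ (proj₂ (good i) (suc (suc p ℕ.+ i))))

  approx-⋂ : ∀ {E : ℕ → Region} → (∀ i → Approximable (E i)) → Approximable (λ x → ⋂ ℕ λ i → E i x)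
  approx-⋂ good = approx-respects
    (λ x → (λ ¬some i → stable λ ¬e → ¬some (i , ¬e)) , λ all (i , ¬e) → ¬e (all i))
    (approx-∁ (approx-⋃ λ i → approx-∁ (good i)))

  approx-∩ : ∀ {D E} → Approximable D → Approximable E → Approximable (λ x → D x ∩ E x)
  approx-∩ {D} {E} d e = approx-respects
    (λ x → (λ all → all 0 , all 1) , λ (p , q) → λ { zero → p ; (suc _) → q })
    (approx-⋂ {pick} λ { zero → d ; (suc _) → e })
    where
    pick : ℕ → Region
    pick zero    = D
    pick (suc _) = E

  -- The set where `s` takes a given value is elementary, and only countably many values occur. This
  -- admits thresholds that vary with `x`.
  approx-piecewise : ∀ {E : ℕ → Region} k (s : Point → ℕ) → (∀ {x y} → Agree k x y → s x ≡ s y) →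
                     (∀ a → Approximable (E a)) → Approximable (λ x → E (s x) x)
  approx-piecewise {E} k s s-dep good = approx-respects
    (λ x → (λ { (_ , ≡.refl , e) → e }) , λ e → s x , ≡.refl , e)
    (approx-⋃ λ a → approx-∩ (approx-elementary (piece a)) (good a))
    where
    piece : ℕ → Elementary
    piece a = record
      { level = k ; set = λ x _ → s x ≡ a ; event = λ x → const-event (s x ≡ a)
      ; decides = λ ag eq → ≡.trans (≡.sym (s-dep ag)) eq }

  -- The half of Fubini that is needed: `greedy` finds one `x` at which all sections of
  -- `F ∪ᴱ part C N` have probability at most the bound on their volumes. These sections increase to
  -- a set that contains `E x`.
  average-section : ∀ {E b c} → (∀ x → IsEvent (E x)) → ∀ F → Cover (Difference E F) c →
                    (∀ x → b ≤ Pr (E x)) → b ≤ vol F + c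
  average-section {E} {b} {c} ev F C b≤ = bounded (greedy (λ N → Pr ∘ set (V N)) (level ∘ V)
      (λ {M} {N} M≤N x → Pr-mono (event (V M) x) (event (V N) x) (V-inc M≤N x))
      (λ N → Pr-dep (V N))
      (λ N → ≤-trans (vol-∪ F (part C N)) (+-mono-≤ ≤-refl (small C N))))
    where
    V : ℕ → Elementary
    V N = F ∪ᴱ part C N
    V-inc : ∀ {M N} → M ℕ.≤ N → ∀ x → set (V M) x ⊆ set (V N) x
    V-inc M≤N x = [ inj₁ , inj₂ ∘ inc C M≤N x ]′
    E⊆V : ∀ x → E x ⊆ ⋃ ℕ λ N → set (V N) x
    E⊆V x {ω} e with em {P = set F x ω}
    ... | yes f = 0 , inj₁ f
    ... | no ¬f = let N , q = covers C x (inj₁ (e , ¬f)) in N , inj₂ q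
    bounded : (∃ λ x → ∀ N → Pr (set (V N) x) ≤ vol F + c) → b ≤ vol F + c
    bounded (x , V≤) = ≤-trans (b≤ x) (≤-trans
      (Pr-mono (ev x) (union λ N → event (V N) x) (E⊆V x))
      (Pr-sup (λ N → event (V N) x) (λ M≤N → V-inc M≤N x) V≤))

-- Volumes of sections at an outcome

module Density (R : RealField) (em : ∀ {ℓ} → ExcludedMiddle ℓ)
               (PS : BatchRecovery.ProbabilitySpace R) (n : ℕ) where

  open OrderedField R
  open Integration R em
  open Indicator R em
  open Probability R em PS
  open Approximation R em PS n

  slice : Elementary → Simple
  slice F = AvgS n (level F) λ x → (1# , set F x , event F x) ∷ []

  𝔼-slice : ∀ F → 𝔼 (slice F) ≈ vol F
  𝔼-slice F = trans (𝔼-AvgS n (level F) _) (∫-cong (Avg n (level F)) λ x → trans (+-identityʳ _) (*-identityˡ _))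

  eval-slice : ∀ F ω → eval (slice F) ω ≈ ∫ (Avg n (level F)) (λ x → 𝟙 (set F x ω))
  eval-slice F ω = trans (eval-AvgS n (level F) _ ω)
    (∫-cong (Avg n (level F)) λ x → trans (+-identityʳ _) (*-identityˡ _))

  slice-nonneg : ∀ F ω → 0# ≤ eval (slice F) ω
  slice-nonneg F ω = begin
    0#                                            ≈⟨ Avg-const n (level F) 0# ⟨
    ∫ (Avg n (level F)) (λ _ → 0#)                ≤⟨ ∫-mono (Avg n (level F)) (λ x → 𝟙-nonneg (set F x ω)) ⟩
    ∫ (Avg n (level F)) (λ x → 𝟙 (set F x ω))     ≈⟨ eval-slice F ω ⟨
    eval (slice F) ω                              ∎

  slice-≤1 : ∀ F ω → eval (slice F) ω ≤ 1#
  slice-≤1 F ω = begin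
    eval (slice F) ω                              ≈⟨ eval-slice F ω ⟩
    ∫ (Avg n (level F)) (λ x → 𝟙 (set F x ω))     ≤⟨ ∫-mono (Avg n (level F)) (λ x → 𝟙≤1 (set F x ω)) ⟩
    ∫ (Avg n (level F)) (λ _ → 1#)                ≈⟨ Avg-const n (level F) 1# ⟩
    1#                                            ∎

  slice-mono : ∀ F G → (∀ x → set F x ⊆ set G x) → ∀ ω → eval (slice F) ω ≤ eval (slice G) ω
  slice-mono F G F⊆G ω = begin
    eval (slice F) ω                              ≈⟨ eval-slice F ω ⟩
    ∫ (Avg n (level F)) (λ x → 𝟙 (set F x ω))     ≤⟨ Avg-mono-level (dep F) (dep G) (λ x → 𝟙-mono (F⊆G x)) ⟩
    ∫ (Avg n (level G)) (λ x → 𝟙 (set G x ω))     ≈⟨ eval-slice G ω ⟨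
    eval (slice G) ω                              ∎
    where
    dep : ∀ F → Dep (level F) (λ x → 𝟙 (set F x ω))
    dep F ag = 𝟙-cong (decides F ag) (decides F (Agree-sym ag))

  -- 2 vol(W_ω) < 2⁻ⁿ vol(F_ω) for the slices at ω, in the form whose expectation
  -- over ω is computed by 𝔼.
  Dominates : Elementary → Elementary → Pred Ω 0ℓ
  Dominates F W ω = eval (slice W ++ slice W) ω < eval (scaleS (½^ n) (slice F)) ω

  dominates-event : ∀ F W → IsEvent (Dominates F W)
  dominates-event F W = <-event (slice W ++ slice W) (scaleS (½^ n) (slice F))

  -- An inequality of Markov type. Where `Dominates` fails, the scaled section of `F` is at most
  -- twice that of `W`; where it holds, the section of `F` is bounded by 1. The two bounds add up to
  -- a pointwise inequality of simple functions, whose expectation is taken.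
  vol-≤-dominates : ∀ F W → ½^ n * vol F ≤ ½^ n * Pr (Dominates F W) + (vol W + vol W)
  vol-≤-dominates F W = begin
    ½^ n * vol F                 ≈⟨ trans (𝔼-scale (½^ n) (slice F)) (*-congˡ (𝔼-slice F)) ⟨
    𝔼 s                          ≤⟨ 𝔼-mono s t s≤t ⟩
    𝔼 t                          ≈⟨ +-congˡ (trans (𝔼-++ (slice W) (slice W)) (+-cong (𝔼-slice W) (𝔼-slice W))) ⟩
    ½^ n * Pr (Dominates F W) + (vol W + vol W) ∎
    where
    s = scaleS (½^ n) (slice F)
    t = (½^ n , Dominates F W , dominates-event F W) ∷ (slice W ++ slice W)
    2W≥0 : ∀ ω → 0# ≤ eval (slice W ++ slice W) ω
    2W≥0 ω = ≤-trans (+-nonneg (slice-nonneg W ω) (slice-nonneg W ω)) (≤-reflexive (sym (eval-++ (slice W) (slice W) ω)))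
    s≤t : ∀ ω → eval s ω ≤ eval t ω
    s≤t ω = by-cases em
      where
      by-cases : Dec (Dominates F W ω) → eval s ω ≤ eval t ω
      by-cases (yes d) = begin
        eval s ω                            ≈⟨ eval-scale (½^ n) (slice F) ω ⟩
        ½^ n * eval (slice F) ω             ≤⟨ *-monoˡ-≤ (0≤½^ n) (slice-≤1 F ω) ⟩
        ½^ n * 1#                           ≈⟨ *-congˡ (𝟙-yes d) ⟨
        ½^ n * 𝟙 (Dominates F W ω)          ≤⟨ x≤x+y (2W≥0 ω) ⟩
        eval t ω                            ∎
      by-cases (no ¬d) = begin
        eval s ω                            ≤⟨ ≮⇒≥ ¬d ⟩
        eval (slice W ++ slice W) ω         ≤⟨ x≤x+y (*-nonneg (0≤½^ n) (𝟙-nonneg (Dominates F W ω))) ⟩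
        eval (slice W ++ slice W) ω + ½^ n * 𝟙 (Dominates F W ω) ≈⟨ +-comm _ _ ⟩
        eval t ω                            ∎

  -- `D` need not be an event and is bounded only through the events inside it. The events
  -- `Dominates F (part C N)` decrease in `N`, their intersection is such an event, and some `N`
  -- comes within `½^ q` of its probability.
  vol-≤-inner : ∀ {E b} F (C : Cover E b) {D : Pred Ω 0ℓ} {c} →
                (∀ ω → (∀ N → Dominates F (part C N) ω) → D ω) →
                (∀ B → IsEvent B → (∀ ω → B ω → D ω) → Pr B ≤ c) → ∀ q →
                ½^ n * vol F ≤ ½^ n * (c + ½^ q) + (b + b)
  vol-≤-inner F C {D} {c} always inner q = conclude (Pr-⋂-approx ev dec q)
    where
    ev : ∀ N → IsEvent (Dominates F (part C N))
    ev N = dominates-event F (part C N)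
    dec : ∀ {M N} → M ℕ.≤ N → Dominates F (part C N) ⊆ Dominates F (part C M)
    dec {M} {N} M≤N {ω} d le = d (≤-trans le (begin
      eval (slice (part C M) ++ slice (part C M)) ω            ≈⟨ eval-++ (slice (part C M)) _ ω ⟩
      eval (slice (part C M)) ω + eval (slice (part C M)) ω    ≤⟨ +-mono-≤ mono mono ⟩
      eval (slice (part C N)) ω + eval (slice (part C N)) ω    ≈⟨ eval-++ (slice (part C N)) _ ω ⟨
      eval (slice (part C N) ++ slice (part C N)) ω            ∎))
      where mono = slice-mono (part C M) (part C N) (inc C M≤N) ω
    conclude : (∃ λ N → Pr (Dominates F (part C N)) ≤ Pr (⋂ ℕ λ N → Dominates F (part C N)) + ½^ q) → _
    conclude (N , le) = ≤-trans (vol-≤-dominates F (part C N)) (+-mono-≤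
      (*-monoˡ-≤ (0≤½^ n) (≤-trans le (+-monoˡ (½^ q) (inner _ (⋂-event ev) always))))
      (+-mono-≤ (small C N) (small C N)))

-- Preimages of jointly measurable sets

module Pullback (R : RealField) (em : ∀ {ℓ} → ExcludedMiddle ℓ)
                (PS : BatchRecovery.ProbabilitySpace R) (n : ℕ) where

  open OrderedField R
  open BinaryExpansion R
  open Probability R em PS
  open Approximation R em PS n
  open BatchRecovery R using (Matrix; Borel; entry≤)

  -- Finitely many digits need not determine `g x`, so a condition on `g x` need not be elementary.
  -- It becomes a countable combination of conditions on these approximations.
  record Dyadic (g : Point → ℝ) : Set where
    field
      digits     : ℕ → Point → ℕ
      digits-dep : ∀ L {x y} → Agree L x y → digits L x ≡ digits L y
      digits≤    : ∀ L x → digits L x • ½^ L ≤ g x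
      ≤digits    : ∀ L x → g x ≤ digits L x • ½^ L + ½^ L

  open Dyadic

  dyadic-0 : Dyadic λ _ → 0#
  dyadic-0 = record
    { digits = λ _ _ → 0 ; digits-dep = λ _ _ → ≡.refl
    ; digits≤ = λ _ _ → ≤-refl ; ≤digits = λ L _ → ≤-trans (0≤½^ L) (≤-reflexive (sym (+-identityˡ _))) }

  dyadic-ρ : ∀ i → Dyadic λ x → ρ (lookup x i)
  dyadic-ρ i = record
    { digits = λ L x → val L (lookup x i)
    ; digits-dep = λ L ag → val-agree (TwoPoints.lookup-agree R em ag i)
    ; digits≤ = λ L x → lower≤ρ L (lookup x i)
    ; ≤digits = λ L x → ρ≤upper L (lookup x i) }

  approx-dyadic≤ : ∀ {g} → Dyadic g → ∀ r → Approximable (λ x _ → g x ≤ r)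
  approx-dyadic≤ {g} d r = approx-respects
    (λ x → (λ all → archimedean-≤ 1# λ L → ≤-trans (≤digits d L x)
              (+-mono-≤ (all L) (≤-reflexive (sym (*-identityʳ (½^ L)))))) ,
           λ g≤r L → ≤-trans (digits≤ d L x) g≤r)
    (approx-⋂ λ L → approx-elementary (record
      { level = L ; set = λ x _ → digits d L x • ½^ L ≤ r ; event = λ x → const-event _
      ; decides = λ ag le → ≡.subst (λ a → a • ½^ L ≤ r) (digits-dep d L ag) le }))

  module _ {f : Point → Ω → ℝ} (f≤ : ∀ r → Approximable (λ x ω → f x ω ≤ r)) {g} (d : Dyadic g) where

    -- The hypothesis `f≤` has constant thresholds while `g x` varies. The upper dyadic
    -- approximations of `g x` depend on finitely many digits and decide the inequality in the
    -- limit.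
    approx-≤ : Approximable (λ x ω → f x ω ≤ g x)
    approx-≤ = approx-respects
      (λ x → (λ all → archimedean-≤ 1# λ L → ≤-trans (all L)
                (+-mono-≤ (digits≤ d L x) (≤-reflexive (sym (*-identityʳ (½^ L)))))) ,
             λ f≤g L → ≤-trans f≤g (≤digits d L x))
      (approx-⋂ λ L → approx-piecewise {E = λ a x ω → f x ω ≤ a • ½^ L + ½^ L} L (digits d L) (digits-dep d L)
        λ a → f≤ (a • ½^ L + ½^ L))

    below : ∀ {x ω} L → f x ω ≤ digits d L x • ½^ L - ½^ L → f x ω < g x
    below {x} {ω} L f≤ g≤f = 0<½^ L (linear (≤-trans (digits≤ d L x) (≤-trans g≤f f≤)) (begin-equality
      ½^ L + (D - ½^ L)  ≈⟨ trans (+-comm _ _) (y-x+x≈y (½^ L) D) ⟩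
      D                  ≈⟨ +-identityˡ D ⟨
      0# + D             ∎))
      where D = digits d L x • ½^ L

    -- Otherwise `g x` would exceed `f x ω` by at most `½^ L * (1# + 1#)` for every `L`: one `½^ L`
    -- is the error of the digits, the other the margin subtracted.
    far-below : ∀ {x ω} → f x ω < g x → ∃ λ L → f x ω ≤ digits d L x • ½^ L - ½^ L
    far-below {x} {ω} f<g with em {P = ∃ λ L → f x ω ≤ digits d L x • ½^ L - ½^ L}
    ... | yes p = p
    ... | no ¬p = contradiction (archimedean-≤ (1# + 1#) λ L → begin
      g x                                            ≤⟨ ≤digits d L x ⟩
      digits d L x • ½^ L + ½^ L                     ≈⟨ +-congʳ (y-x+x≈y (½^ L) (digits d L x • ½^ L)) ⟨
      ((digits d L x • ½^ L - ½^ L) + ½^ L) + ½^ L   ≤⟨ +-monoˡ _ (+-monoˡ _ (<⇒≤ λ le → ¬p (L , le))) ⟩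
      (f x ω + ½^ L) + ½^ L                          ≈⟨ solve 2 (λ a h → (a :+ h) :+ h := a :+ h :* (con 1 :+ con 1)) refl (f x ω) (½^ L) ⟩
      f x ω + ½^ L * (1# + 1#)                       ∎) f<g

    -- Only upper bounds on `f` are available, so the complement is described: `f` is below `g`
    -- exactly if it stays under some dyadic approximation with a margin of `½^ L`.
    approx-≥ : Approximable (λ x ω → g x ≤ f x ω)
    approx-≥ = approx-respects
      (λ x → (λ ¬below → ≮⇒≥ (¬below ∘ far-below)) , λ g≤f (L , le) → below L le g≤f)
      (approx-∁ (approx-⋃ λ L → approx-piecewise {E = λ a x ω → f x ω ≤ a • ½^ L - ½^ L} L (digits d L) (digits-dep d L)
        λ a → f≤ (a • ½^ L - ½^ L)))

    approx-≈ : Approximable (λ x ω → f x ω ≈ g x)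
    approx-≈ = approx-respects
      (λ x → (λ (p , q) → antisym p q) , λ eq → ≤-reflexive eq , ≤-reflexive (sym eq))
      (approx-∩ approx-≤ approx-≥)

  approx-∀ : ∀ k {E : Fin k → Region} → (∀ i → Approximable (E i)) → Approximable (λ x ω → ∀ i → E i x ω)
  approx-∀ zero    good = approx-respects (λ x → (λ _ ()) , λ _ → tt) (approx-const whole)
  approx-∀ (suc k) good = approx-respects
    (λ x → (λ { (p , q) Fin.zero → p ; (p , q) (Fin.suc i) → q i }) , λ all → all Fin.zero , all ∘ Fin.suc)
    (approx-∩ (good Fin.zero) (approx-∀ k (good ∘ Fin.suc)))

  module _ {m} (Θ : Point → Matrix n m) (Θ-dyadic : ∀ i j → Dyadic λ x → Θ x i j) where

    approx-Borel : ∀ {B} → MeasurableSpace.IsMeasurable (Borel n m) B → Approximable (λ x _ → B (Θ x))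
    approx-Borel (generator (entry≤ i j r)) = approx-dyadic≤ (Θ-dyadic i j) r
    approx-Borel (gen-respects (to , from) b) = approx-respects (λ x → to , from) (approx-Borel b)
    approx-Borel gen-whole = approx-const whole
    approx-Borel (gen-complement b) = approx-∁ (approx-Borel b)
    approx-Borel (gen-union b) = approx-⋃ λ i → approx-Borel (b i)

    approx-pullback : ∀ {A} → MeasurableSpace.IsMeasurable (space ⊗ Borel n m) A → Approximable (λ x ω → A (ω , Θ x))
    approx-pullback (generator (left a)) = approx-const a
    approx-pullback (generator (right b)) = approx-Borel b
    approx-pullback (gen-respects (to , from) a) = approx-respects (λ x → to , from) (approx-pullback a)
    approx-pullback gen-whole = approx-const whole
    approx-pullback (gen-complement a) = approx-∁ (approx-pullback a)
    approx-pullback (gen-union a) = approx-⋃ λ i → approx-pullback (a i)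


-- Counting nonzero entries and fully measured columns

sumℕ-ones : ∀ n {f : Fin n → ℕ} → (∀ i → f i ℕ.≤ 1) → sumℕ f ℕ.≤ n
sumℕ-ones zero    f≤1 = z≤n
sumℕ-ones (suc n) f≤1 = ℕₚ.+-mono-≤ (f≤1 Fin.zero) (sumℕ-ones n (f≤1 ∘ Fin.suc))

sumℕ-zero : ∀ n {f : Fin n → ℕ} → (∀ i → f i ≡ 0) → sumℕ f ≡ 0
sumℕ-zero zero    f≡0 = ≡.refl
sumℕ-zero (suc n) f≡0 = ≡.cong₂ ℕ._+_ (f≡0 Fin.zero) (sumℕ-zero n (f≡0 ∘ Fin.suc))

sumℕ-single : ∀ n {f : Fin n → ℕ} j → (∀ i → f i ℕ.≤ 1) → (∀ i → i ≢ j → f i ≡ 0) → sumℕ f ℕ.≤ 1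
sumℕ-single (suc n) {f} Fin.zero f≤1 f≡0 = ≡.subst (ℕ._≤ 1) (≡.sym (≡.trans
  (≡.cong (f Fin.zero ℕ.+_) (sumℕ-zero n λ i → f≡0 (Fin.suc i) λ ())) (ℕₚ.+-identityʳ (f Fin.zero)))) (f≤1 Fin.zero)
sumℕ-single (suc n) {f} (Fin.suc j) f≤1 f≡0 = ≡.subst (λ a → a ℕ.+ sumℕ (f ∘ Fin.suc) ℕ.≤ 1)
  (≡.sym (f≡0 Fin.zero λ ())) (sumℕ-single n j (f≤1 ∘ Fin.suc) λ i i≢j → f≡0 (Fin.suc i) (i≢j ∘ Finₚ.suc-injective))

count : ∀ n {m} → (Fin m → ℕ) → ℕ
count n t = sumℕ λ j → if does (n ℕₚ.≤? t j) then 1 else 0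

count-* : ∀ n m (t : Fin m → ℕ) → count n t ℕ.* n ℕ.≤ sumℕ t
count-* n zero    t = z≤n
count-* n (suc m) t = begin
  (b ℕ.+ count n (t ∘ Fin.suc)) ℕ.* n       ≡⟨ ℕₚ.*-distribʳ-+ n b (count n (t ∘ Fin.suc)) ⟩
  b ℕ.* n ℕ.+ count n (t ∘ Fin.suc) ℕ.* n   ≤⟨ ℕₚ.+-mono-≤ (one (n ℕₚ.≤? t Fin.zero)) (count-* n m (t ∘ Fin.suc)) ⟩
  t Fin.zero ℕ.+ sumℕ (t ∘ Fin.suc)         ∎
  where
  open ℕₚ.≤-Reasoning
  b = if does (n ℕₚ.≤? t Fin.zero) then 1 else 0
  one : (d : Dec (n ℕ.≤ t Fin.zero)) → (if does d then 1 else 0) ℕ.* n ℕ.≤ t Fin.zero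
  one (yes n≤t) = ≡.subst (ℕ._≤ t Fin.zero) (≡.sym (ℕₚ.+-identityʳ n)) n≤t
  one (no  _)   = z≤n

few-full : ∀ {n m T} (t : Fin m → ℕ) → sumℕ t ℕ.≤ T → ¬ (m ℕ.* n ℕ.≤ 4 ℕ.* T) → count n t ℕ.* 4 ℕ.< m
few-full {n} {m} {T} t t≤T mn≰4T = ℕₚ.*-cancelʳ-< n _ m (begin-strict
  count n t ℕ.* 4 ℕ.* n     ≡⟨ ≡.cong (ℕ._* n) (ℕₚ.*-comm (count n t) 4) ⟩
  4 ℕ.* count n t ℕ.* n     ≡⟨ ℕₚ.*-assoc 4 (count n t) n ⟩
  4 ℕ.* (count n t ℕ.* n)   ≤⟨ ℕₚ.*-monoʳ-≤ 4 (ℕₚ.≤-trans (count-* n m t) t≤T) ⟩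
  4 ℕ.* T                   <⟨ ℕₚ.≰⇒> mn≰4T ⟩
  m ℕ.* n                   ∎)
  where open ℕₚ.≤-Reasoning

-- Norms and exact recovery

module Norms (R : RealField) where

  open OrderedField R
  open BatchRecovery R
  open SemiringSum semiring using (sum)
  open LinearAlgebra R using (sum-zero)

  abs-nonneg : ∀ x → 0# ≤ ∣ x ∣
  abs-nonneg x with 0# ≤? x
  ... | yes 0≤x = 0≤x
  ... | no  0≰x = ≤-trans (≤-reflexive (sym -0#≈0#)) (neg-mono (<⇒≤ 0≰x))

  abs-zero : ∀ {x} → x ≈ 0# → ∣ x ∣ ≈ 0#
  abs-zero {x} x≈0 with 0# ≤? x
  ... | yes _ = x≈0
  ... | no  _ = trans (-‿cong x≈0) -0#≈0#

  abs-≤0 : ∀ {x} → ∣ x ∣ ≤ 0# → x ≈ 0#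
  abs-≤0 {x} ≤0 with 0# ≤? x
  ... | yes 0≤x = antisym ≤0 0≤x
  ... | no  0≰x = antisym (<⇒≤ 0≰x) (≤-trans (≤-reflexive (sym -0#≈0#)) (≤-trans (neg-mono ≤0) (≤-reflexive (-‿involutive x))))

  sum-nonneg : ∀ n {f : Fin n → ℝ} → (∀ i → 0# ≤ f i) → 0# ≤ sum f
  sum-nonneg zero    f≥0 = ≤-refl
  sum-nonneg (suc n) f≥0 = +-nonneg (f≥0 Fin.zero) (sum-nonneg n (f≥0 ∘ Fin.suc))

  sum-≤0 : ∀ n {f : Fin n → ℝ} → (∀ i → 0# ≤ f i) → sum f ≤ 0# → ∀ i → f i ≤ 0#
  sum-≤0 (suc n) f≥0 le Fin.zero    = ≤-trans (x≤x+y (sum-nonneg n (f≥0 ∘ Fin.suc))) le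
  sum-≤0 (suc n) f≥0 le (Fin.suc i) =
    sum-≤0 n (f≥0 ∘ Fin.suc) (≤-trans (x≤x+y (f≥0 Fin.zero)) (≤-trans (≤-reflexive (+-comm _ _)) le)) i

  norm-nonneg : ∀ {n m} (A : Matrix n m) → 0# ≤ ‖ A ‖₁
  norm-nonneg {n} {m} A = sum-nonneg n λ i → sum-nonneg m λ j → abs-nonneg (A i j)

  norm-⊖-zero : ∀ {n m} (A B : Matrix n m) → (∀ i j → A i j ≈ B i j) → ‖ A ⊖ B ‖₁ ≈ 0#
  norm-⊖-zero {n} {m} A B A≈B = sum-zero n λ i → sum-zero m λ j →
    abs-zero (trans (+-congʳ (A≈B i j)) (-‿inverseʳ (B i j)))

  norm-⊖-≤0 : ∀ {n m} (A B : Matrix n m) → ‖ A ⊖ B ‖₁ ≤ 0# → ∀ i j → A i j ≈ B i j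
  norm-⊖-≤0 {n} {m} A B le i j = trans (sym (y-x+x≈y (B i j) (A i j)))
    (trans (+-congʳ (abs-≤0 (sum-≤0 m (λ j → abs-nonneg _)
      (sum-≤0 n (λ i → sum-nonneg m λ j → abs-nonneg _) le i) j))) (+-identityˡ (B i j)))

  sparse⇒best-error-0 : ∀ k {n m} (A : Matrix n m) → IsSparse (k ℕ.* m) A → IsBestError k A 0#
  sparse⇒best-error-0 k A sparse =
    (A , sparse , sym (norm-⊖-zero A A λ _ _ → refl)) , λ A* _ → norm-nonneg (A ⊖ A*)

-- Inputs supported on a single column

module DenseColumn (R : RealField) (em : ∀ {ℓ} → ExcludedMiddle ℓ) {n m : ℕ} (j : Fin m) where

  open OrderedField R
  open BatchRecovery R
  open BinaryExpansion R
  open Norms R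
  open SemiringSum semiring using (sum; sum-cong-≋; ∑-distrib-+; *-distribˡ-sum)

  Θ : Vec Cantor n → Matrix n m
  Θ x i j′ = if does (j′ Finₚ.≟ j) then ρ (lookup x i) else 0#

  Θ-on : ∀ x i → Θ x i j ≡ ρ (lookup x i)
  Θ-on x i with j Finₚ.≟ j
  ... | yes _ = ≡.refl
  ... | no j≢j = contradiction ≡.refl j≢j

  Θ-sparse : ∀ {k} → n ℕ.≤ k ℕ.* m → ∀ x → IsSparse (k ℕ.* m) (Θ x)
  Θ-sparse n≤km x = ℕₚ.≤-trans (sumℕ-ones n λ i → sumℕ-single m j (≤one i) (off i)) n≤km
    where
    ≤one : ∀ i j′ → (if does (Θ x i j′ ≟ 0#) then 0 else 1) ℕ.≤ 1
    ≤one i j′ with does (Θ x i j′ ≟ 0#)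
    ... | true  = z≤n
    ... | false = ℕₚ.≤-refl
    off : ∀ i j′ → j′ ≢ j → (if does (Θ x i j′ ≟ 0#) then 0 else 1) ≡ 0
    off i j′ j′≢j with j′ Finₚ.≟ j
    ... | yes j′≡j = contradiction j′≡j j′≢j
    ... | no _ with 0# ≟ 0#
    ...   | yes _  = ≡.refl
    ...   | no 0≉0 = contradiction refl 0≉0

  measure-shifted : ∀ {t} (S : Matrix t n) (x y : Vec Cantor n) (e : ℝ) (v : Fin n → ℝ) →
    (∀ i → ρ (lookup x i) ≈ ρ (lookup y i) + e * v i) → (∀ r → sum (λ l → S r l * v l) ≈ 0#) →
    ∀ r → (S · λ i → ρ (lookup x i)) r ≈ (S · λ i → ρ (lookup y i)) r
  measure-shifted S x y e v x≈ Sv≈0 r = begin-equality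
    sum (λ l → S r l * ρ (lookup x l))                        ≈⟨ sum-cong-≋ (λ l → trans (*-congˡ (x≈ l))
                                                                   (solve 4 (λ s p e v → s :* (p :+ e :* v) := s :* p :+ e :* (s :* v)) refl _ _ e (v l))) ⟩
    sum (λ l → S r l * ρ (lookup y l) + e * (S r l * v l))    ≈⟨ ∑-distrib-+ (λ l → S r l * ρ (lookup y l)) (λ l → e * (S r l * v l)) ⟩
    sum (λ l → S r l * ρ (lookup y l)) + sum (λ l → e * (S r l * v l)) ≈⟨ +-congˡ (*-distribˡ-sum e (λ l → S r l * v l)) ⟨
    sum (λ l → S r l * ρ (lookup y l)) + e * sum (λ l → S r l * v l)   ≈⟨ +-congˡ (trans (*-congˡ (Sv≈0 r)) (zeroʳ e)) ⟩
    sum (λ l → S r l * ρ (lookup y l)) + 0#                   ≈⟨ +-identityʳ _ ⟩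
    sum (λ l → S r l * ρ (lookup y l))                        ∎

  module _ (D : DeterministicScheme n m) where

    open DeterministicScheme D

    Recovers : Vec Cantor n → Set
    Recovers x = ∀ i j → output (Θ x) i j ≈ Θ x i j

    -- The two inputs differ only in column `j`, and there by a kernel vector of `S j`. All
    -- measurement results coincide, and `recover-cong` makes the outputs equal.
    kernel-collision : ∀ {x y e} (v : Fin n → ℝ) → (∀ r → sum (λ l → S j r l * v l) ≈ 0#) →
      (∀ i → ρ (lookup x i) ≈ ρ (lookup y i) + e * v i) →
      Recovers x → Recovers y → ∀ i → ρ (lookup x i) ≈ ρ (lookup y i)
    kernel-collision {x} {y} {e} v Sv≈0 x≈ rx ry i = begin-equality
      ρ (lookup x i)     ≡⟨ Θ-on x i ⟨
      Θ x i j            ≈⟨ rx i j ⟨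
      output (Θ x) i j   ≈⟨ recover-cong same i j ⟩
      output (Θ y) i j   ≈⟨ ry i j ⟩
      Θ y i j            ≡⟨ Θ-on y i ⟩
      ρ (lookup y i)     ∎
      where
      same : ∀ j′ r → (S j′ · column (Θ x) j′) r ≈ (S j′ · column (Θ y) j′) r
      same j′ = by-column (j′ Finₚ.≟ j)
        where
        by-column : (d : Dec (j′ ≡ j)) → ∀ r →
          (S j′ · λ i → if does d then ρ (lookup x i) else 0#) r ≈
          (S j′ · λ i → if does d then ρ (lookup y i) else 0#) r
        by-column (yes ≡.refl) = measure-shifted (S j) x y e v x≈ Sv≈0
        by-column (no _)     r = refl

    cancel-shift : ∀ {a e v} → a ≈ a + ½^ e * v → v ≈ 0#
    cancel-shift {a} {e} {v} a≈ = begin-equality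
      v                    ≈⟨ *-identityˡ v ⟨
      1# * v               ≈⟨ *-congʳ (trans (*-comm _ _) (proj₂ inv)) ⟨
      (proj₁ inv * ½^ e) * v ≈⟨ *-assoc _ _ _ ⟩
      proj₁ inv * (½^ e * v) ≈⟨ *-congˡ (+-cancelʳ a _ _ (trans (+-comm _ _) (trans (sym a≈) (sym (+-identityˡ a))))) ⟩
      proj₁ inv * 0#       ≈⟨ zeroʳ _ ⟩
      0#                   ∎
      where inv = inverse (½^ e) (λ eq → 0<½^ e (≤-reflexive eq))

    full-measurement : ∀ {x y e} (v : Fin n → ℝ) → (∃ λ i → ¬ (v i ≈ 0#)) →
      (∀ r → sum (λ l → S j r l * v l) ≈ 0#) → (∀ i → ρ (lookup x i) ≈ ρ (lookup y i) + ½^ e * v i) →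
      Recovers x → ¬ Recovers y
    full-measurement {x} {y} {e} v (i , vi≉0) Sv≈0 x≈ rx ry =
      vi≉0 (cancel-shift {e = e} (trans (sym (kernel-collision {x} {y} {½^ e} v Sv≈0 x≈ rx ry i)) (x≈ i)))

-- From a randomized scheme to the lower bound

module Scheme (R : RealField) (em : ∀ {ℓ} → ExcludedMiddle ℓ) {n m : ℕ}
              (𝒮 : BatchRecovery.RandomizedScheme R n m) where

  open OrderedField R
  open Integration R em
  open Indicator R em
  open BatchRecovery R
  open Norms R
  open LinearAlgebra R
  open BinaryExpansion R
  open RandomizedScheme 𝒮 using (probabilitySpace; scheme; output; measurements; output-measurable)
  open Probability R em probabilitySpace

  t : Ω → Fin m → ℕ
  t ω = DeterministicScheme.t (scheme ω)

  Full : Fin m → Pred Ω 0ℓ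
  Full j ω = n ℕ.≤ t ω j

  -- The inner probability of `Full j` is at most one quarter. Measurability is known for the output
  -- only, so `Full j` itself need not have a probability.
  Negligible : Fin m → Set₁
  Negligible j = ∀ B → IsEvent B → (∀ ω → B ω → Full j ω) → Pr B ≤ ½^ 2

  simple-sum : ∀ k → (Fin k → ∃ IsEvent) → Simple
  simple-sum zero    B = []
  simple-sum (suc k) B = (1# , B Fin.zero) ∷ simple-sum k (B ∘ Fin.suc)

  eval-simple-sum : ∀ k (B : Fin k → ∃ IsEvent) (t : Fin k → ℕ) ω → (∀ j → proj₁ (B j) ω → n ℕ.≤ t j) →
                    eval (simple-sum k B) ω ≤ count n t • 1#
  eval-simple-sum zero    B t ω full = ≤-refl
  eval-simple-sum (suc k) B t ω full = begin
    1# * 𝟙 (proj₁ (B Fin.zero) ω) + eval (simple-sum k (B ∘ Fin.suc)) ω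
      ≤⟨ +-mono-≤ (≤-trans (≤-reflexive (*-identityˡ _)) (one (n ℕₚ.≤? t Fin.zero))) (eval-simple-sum k (B ∘ Fin.suc) (t ∘ Fin.suc) ω (full ∘ Fin.suc)) ⟩
    b • 1# + count n (t ∘ Fin.suc) • 1#          ≈⟨ •-homo-+ 1# b (count n (t ∘ Fin.suc)) ⟨
    count n t • 1#                               ∎
    where
    b = if does (n ℕₚ.≤? t Fin.zero) then 1 else 0
    one : (d : Dec (n ℕ.≤ t Fin.zero)) → 𝟙 (proj₁ (B Fin.zero) ω) ≤ (if does d then 1 else 0) • 1#
    one (yes _)   = ≤-trans (𝟙≤1 _) (≤-reflexive (sym (+-identityʳ 1#)))
    one (no  n≰t) = ≤-reflexive (𝟙-no (n≰t ∘ full Fin.zero))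

  𝔼-simple-sum : ∀ k (B : Fin k → ∃ IsEvent) {c} → (∀ j → c ≤ Pr (proj₁ (B j))) → k • c ≤ 𝔼 (simple-sum k B)
  𝔼-simple-sum zero    B c≤ = ≤-refl
  𝔼-simple-sum (suc k) B c≤ = +-mono-≤ (≤-trans (c≤ Fin.zero) (≤-reflexive (sym (*-identityˡ _)))) (𝔼-simple-sum k (B ∘ Fin.suc) (c≤ ∘ Fin.suc))

  •-monoˡ : ∀ {a b x} → a ℕ.≤ b → 0# ≤ x → a • x ≤ b • x
  •-monoˡ {b = b} z≤n   0≤x = •-nonneg b 0≤x
  •-monoˡ (s≤s a≤b) 0≤x = +-mono-≤ ≤-refl (•-monoˡ a≤b 0≤x)

  negligible-column : ∀ {T} → (∀ ω → measurements ω ℕ.≤ T) → ¬ (m ℕ.* n ℕ.≤ 4 ℕ.* T) → ∃ Negligible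
  negligible-column {T} t≤T mn≰4T with em {P = ∃ Negligible}
  ... | yes p = p
  ... | no ¬p = contradiction (linear ½²+M≤M (sym (+-identityˡ _))) (0<½^ 2)
    where
    bad : ∀ j → ∃ λ B → IsEvent B × (∀ ω → B ω → Full j ω) × ½^ 2 < Pr B
    bad j with em {P = ∃ λ B → IsEvent B × (∀ ω → B ω → Full j ω) × ½^ 2 < Pr B}
    ... | yes b = b
    ... | no ¬b = contradiction (j , negligible) ¬p
      where
      negligible : Negligible j
      negligible B ev B⊆ = ≮⇒≥ λ lt → ¬b (B , ev , B⊆ , lt)
    B : Fin m → ∃ IsEvent
    B j = proj₁ (bad j) , proj₁ (proj₂ (bad j))
    -- In `ℕ` the bound `count n (t ω) ℕ.* 4 < m` leaves a gap of one. Scaled by one quarter, this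
    -- is the extra term `½^ 2`, which remains strictly positive after expectations are taken.
    pointwise : ∀ ω → eval ((½^ 2 , U , whole) ∷ simple-sum m B) ω ≤ eval ((m • ½^ 2 , U , whole) ∷ []) ω
    pointwise ω = begin
      ½^ 2 * 𝟙 (U ω) + eval (simple-sum m B) ω    ≤⟨ +-mono-≤ (≤-reflexive (trans (*-congˡ (𝟙-yes tt)) (*-identityʳ _)))
                                                       (eval-simple-sum m B (t ω) ω λ j → proj₁ (proj₂ (proj₂ (bad j))) ω) ⟩
      ½^ 2 + c • 1#                               ≈⟨ +-congˡ (•-cong (≡.refl {x = c}) (sym (2^•½^ 2 0))) ⟩
      ½^ 2 + c • (4 • ½^ 2)                       ≈⟨ +-congˡ (•-assocˡ (½^ 2) c 4) ⟩
      suc (c ℕ.* 4) • ½^ 2                        ≤⟨ •-monoˡ (few-full (t ω) (t≤T ω) mn≰4T) (0≤½^ 2) ⟩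
      m • ½^ 2                                    ≈⟨ trans (+-identityʳ _) (trans (*-congˡ (𝟙-yes tt)) (*-identityʳ _)) ⟨
      (m • ½^ 2) * 𝟙 (U ω) + 0#                     ∎
      where c = count n (t ω)
    ½²+M≤M : ½^ 2 + m • ½^ 2 ≤ m • ½^ 2
    ½²+M≤M = begin
      ½^ 2 + m • ½^ 2                      ≤⟨ +-mono-≤ ≤-refl (𝔼-simple-sum m B λ j → <⇒≤ (proj₂ (proj₂ (proj₂ (bad j))))) ⟩
      ½^ 2 + 𝔼 (simple-sum m B)            ≈⟨ +-congʳ (trans (*-congˡ Pr-whole) (*-identityʳ _)) ⟨
      ½^ 2 * Pr U + 𝔼 (simple-sum m B)     ≤⟨ 𝔼-mono ((½^ 2 , U , whole) ∷ simple-sum m B) ((m • ½^ 2 , U , whole) ∷ []) pointwise ⟩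
      (m • ½^ 2) * Pr U + 0#               ≈⟨ trans (+-identityʳ _) (trans (*-congˡ Pr-whole) (*-identityʳ _)) ⟩
      m • ½^ 2                             ∎

  -- In units of `½^ (4 ℕ.+ n)`, the number `½^ n * ½` is 8. The upper bound contributes 5 for
  -- `½^ 2 + ½^ 4` and 1 for the two covers, and the error in the lower bound is at most 1. The
  -- conclusion is the impossible `8 ≤ 7`.
  arithmetic : ∀ {V} → ½ ≤ V + ½^ (5 ℕ.+ n) →
               ½^ n * V ≤ ½^ n * (½^ 2 + ½^ 4) + (½^ (5 ℕ.+ n) + ½^ (5 ℕ.+ n)) → ½^ (4 ℕ.+ n) ≤ 0#
  arithmetic {V} lower upper = linear {r = 0# + ((a * (½^ 2 + u) + h) + h)} (begin
      a * ½                                    ≤⟨ *-monoˡ-≤ (0≤½^ n) lower ⟩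
      a * (V + ε)                              ≈⟨ distribˡ a V ε ⟩
      a * V + a * ε                            ≤⟨ +-mono-≤ (≤-trans upper (+-mono-≤ ≤-refl (≤-reflexive (½^-double (4 ℕ.+ n))))) aε≤h ⟩
      (a * (½^ 2 + u) + h) + h                 ≈⟨ +-identityˡ _ ⟨
      0# + ((a * (½^ 2 + u) + h) + h)          ∎)
    (begin-equality
      h + (0# + ((a * (½^ 2 + u) + h) + h))
        ≈⟨ +-cong h≈ (+-congˡ (+-cong (+-cong (*-congˡ (+-congʳ ½²≈)) h≈) h≈)) ⟩
      u * a + (0# + ((a * (((u + u) + (u + u)) + u) + u * a) + u * a))
        ≈⟨ solve 2 (λ u a → u :* a :+ (con 0 :+ ((a :* (((u :+ u) :+ (u :+ u)) :+ u) :+ u :* a) :+ u :* a)) :=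
             con 0 :+ a :* (((u :+ u) :+ (u :+ u)) :+ ((u :+ u) :+ (u :+ u)))) refl u a ⟩
      0# + a * (((u + u) + (u + u)) + ((u + u) + (u + u)))
        ≈⟨ +-congˡ (*-congˡ (trans (+-cong (sym ½²≈) (sym ½²≈)) (trans (½^-double 1) (*-identityʳ ½)))) ⟩
      0# + a * ½ ∎)
    where
    a = ½^ n
    u = ½^ 4
    h = ½^ (4 ℕ.+ n)
    ε = ½^ (5 ℕ.+ n)
    h≈ : h ≈ u * a
    h≈ = ½^-+ 4 n
    ½²≈ : ½^ 2 ≈ (u + u) + (u + u)
    ½²≈ = sym (trans (+-cong (½^-double 3) (½^-double 3)) (½^-double 2))
    aε≤h : a * ε ≤ h
    aε≤h = begin
      a * ε   ≈⟨ *-comm a ε ⟩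
      ε * a   ≤⟨ *-monoˡ-≤ (0≤½^ (5 ℕ.+ n)) (½^≤1 n) ⟩
      ε * 1#  ≈⟨ *-identityʳ ε ⟩
      ε       ≤⟨ ½^-suc-≤ (4 ℕ.+ n) ⟩
      h       ∎

  module _ (j : Fin m) where

    open DenseColumn R em {n} {m} j
    open Approximation R em probabilitySpace n
    open Density R em probabilitySpace n
    open Pullback R em probabilitySpace n
    open TwoPoints R em using (two-points)

    Success : Region
    Success x ω = Recovers (scheme ω) x

    Θ-dyadic : ∀ i j′ → Dyadic λ x → Θ x i j′
    Θ-dyadic i j′ = by-column (j′ Finₚ.≟ j)
      where
      by-column : (d : Dec (j′ ≡ j)) → Dyadic λ x → if does d then ρ (lookup x i) else 0#
      by-column (yes _) = dyadic-ρ i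
      by-column (no _)  = dyadic-0

    approx-success : Approximable Success
    approx-success = approx-∀ n λ i → approx-∀ m λ j′ →
      approx-≈ {f = λ x ω → output ω (Θ x) i j′}
        (λ r → approx-pullback Θ Θ-dyadic (output-measurable (generator (entry≤ i j′ r))))
        (Θ-dyadic i j′)

    -- With best error 0 the tolerance `C * 0#` vanishes, so success means exact recovery whatever
    -- `C` is.
    half-≤-success : ∀ {C k} → n ℕ.≤ k ℕ.* m → SolvesNoiseFree C k 𝒮 → ∀ x → ½ ≤ Pr (Success x)
    half-≤-success {C} {k} n≤km solves x = begin
      ½                                           ≈⟨ *-identityʳ ½ ⟨
      ½ * 1#                                      ≤⟨ *-monoˡ-≤ 0≤½ (solves (Θ x) best 0# best) ⟩
      ½ * (p + p)                                 ≈⟨ trans (distribˡ ½ p p) (halve p) ⟩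
      p                                           ≈⟨ Pr-respects (proj₁ approx-success x)
                                                       ((λ {ω} → to ω) , (λ {ω} → from ω)) ⟨
      Pr (Success x)                              ∎
      where
      best : IsBestError k (Θ x) 0#
      best = sparse⇒best-error-0 k (Θ x) (Θ-sparse {k} n≤km x)
      succeeded : Pred Ω 0ℓ
      succeeded ω = ‖ Θ x ⊖ output ω (Θ x) ‖₁ ≤ C * 0#
      p = Pr succeeded
      to : ∀ ω → Success x ω → succeeded ω
      to ω r = ≤-reflexive (trans (norm-⊖-zero (Θ x) (output ω (Θ x)) λ i j′ → sym (r i j′)) (sym (zeroʳ C)))
      from : ∀ ω → succeeded ω → Success x ω
      from ω le i j′ = sym (norm-⊖-≤0 (Θ x) (output ω (Θ x)) (≤-trans le (≤-reflexive (zeroʳ C))) i j′)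

    -- A point of `F` that is not recovered lies in the difference of `Success` and `F`, hence in
    -- some part of the cover. So the two points of `F` outside all parts, which `two-points` yields
    -- for a kernel vector of `S j`, would both be recovered although their measurements coincide.
    dominates⇒full : ∀ F {b} (C : Cover (Difference Success F) b) ω →
                     (∀ N → Dominates F (part C N) ω) → Full j ω
    dominates⇒full F C ω dom with n ℕₚ.≤? t ω j
    ... | yes n≤t = n≤t
    ... | no  n≰t = contradiction (collide (kernel-vector (ℕₚ.≰⇒> n≰t) (DeterministicScheme.S (scheme ω) j))) id
      where
      recovered : ∀ {x} → set F x ω → (∀ N → ¬ set (part C N) x ω) → Recovers (scheme ω) x
      recovered {x} f ¬w = stable λ ¬r → let N , w = covers C x (inj₂ (f , ¬r)) in ¬w N w
      sparse : ∀ N → let w = ∫ (Avg n (level (part C N))) (λ x → 𝟙 (set (part C N) x ω)) in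
               w + w < ½^ n * ∫ (Avg n (level F)) (λ x → 𝟙 (set F x ω))
      sparse N le = dom N (begin
        eval (scaleS (½^ n) (slice F)) ω            ≈⟨ trans (eval-scale (½^ n) (slice F) ω) (*-congˡ (eval-slice F ω)) ⟩
        ½^ n * ∫ (Avg n (level F)) (λ x → 𝟙 (set F x ω)) ≤⟨ le ⟩
        w + w                                       ≈⟨ trans (eval-++ (slice W) (slice W) ω) (+-cong (eval-slice W ω) (eval-slice W ω)) ⟨
        eval (slice W ++ slice W) ω                 ∎)
        where
        W = part C N
        w = ∫ (Avg n (level W)) (λ x → 𝟙 (set W x ω))
      collide : _ → _
      collide (v , nonzero , Sv≈0) =
        let x , y , fx , fy , ¬wx , ¬wy , e , x≈ =
              two-points {F = λ x → set F x ω} (λ ag → decides F ag)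
                {W = λ N x → set (part C N) x ω} (λ N → level (part C N)) (λ N ag → decides (part C N) ag)
                (λ {_} {_} {x} M≤N → inc C M≤N x) sparse v
        in full-measurement (scheme ω) {x} {y} {e} v nonzero Sv≈0 x≈ (recovered fx ¬wx) (recovered fy ¬wy)

    negligible⇒fails : ∀ {C k} → Negligible j → n ℕ.≤ k ℕ.* m → ¬ SolvesNoiseFree C k 𝒮
    negligible⇒fails {k = k} negligible n≤km solves = 0<½^ (4 ℕ.+ n) (contradict (proj₂ approx-success (5 ℕ.+ n)))
      where
      contradict : (∃ λ F → Cover (Difference Success F) (½^ (5 ℕ.+ n))) → ½^ (4 ℕ.+ n) ≤ 0#
      contradict (F , C) = arithmetic
        (average-section (proj₁ approx-success) F C (half-≤-success {k = k} n≤km solves))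
        (vol-≤-inner F C (dominates⇒full F C) negligible 4)

  solves⇒measurements : ∀ {C k T} → n ℕ.≤ k ℕ.* m → SolvesNoiseFree C k 𝒮 → WorstCaseAtMost 𝒮 T → m ℕ.* n ℕ.≤ 4 ℕ.* T
  solves⇒measurements {k = k} {T} n≤km solves t≤T with m ℕ.* n ℕₚ.≤? 4 ℕ.* T
  ... | yes le = le
  ... | no ¬le = let j , negligible = negligible-column t≤T ¬le
                 in contradiction solves (negligible⇒fails j {k = k} negligible n≤km)

open import Data.Nat.Base using (_≤_; _*_)

-- d is the reciprocal of the constant hidden in Ω(mn).  The scheme is given
-- k, so it is a family indexed by k.
theorem1p3 : (∀ {ℓ} → ExcludedMiddle ℓ) →
  ∃ λ (d : ℕ) →
  ∀ (R : RealField) → let open BatchRecovery R in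
  ∀ (m n : ℕ) (C : RealField.ℝ R) → RealField._≤_ R (RealField.1# R) C →
  ∀ (𝒮 : ℕ → RandomizedScheme n m) →
    -- worst case over all inputs, including k
    ((∀ k → 1 ≤ k → k ≤ n → SolvesNoiseFree C k (𝒮 k)) →
      ∀ T → (∀ k → 1 ≤ k → k ≤ n → WorstCaseAtMost (𝒮 k) T) → m * n ≤ d * T)
    ×
    -- each k separately, as soon as the sparsity budget km allows a dense column
    (∀ k → 1 ≤ k → k ≤ n → n ≤ k * m → SolvesNoiseFree C k (𝒮 k) →
      ∀ T → WorstCaseAtMost (𝒮 k) T → m * n ≤ d * T)
-- Any d > 2 would do: an event within the full measurement of column j has
-- probability at most 1/d, which only has to be less than the ½ of success.
theorem1p3 em = 4 , λ R m n C _ 𝒮 → all-k R m n C 𝒮 , each-k R m n C 𝒮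
  where
  each-k : ∀ R m n C (𝒮 : ℕ → BatchRecovery.RandomizedScheme R n m) k → 1 ℕ.≤ k → k ℕ.≤ n → n ℕ.≤ k ℕ.* m →
           BatchRecovery.SolvesNoiseFree R C k (𝒮 k) →
           ∀ T → BatchRecovery.WorstCaseAtMost R (𝒮 k) T → m ℕ.* n ℕ.≤ 4 ℕ.* T
  each-k R m n C 𝒮 k _ _ n≤km solves T t≤T = Scheme.solves⇒measurements R em (𝒮 k) {k = k} n≤km solves t≤T
  all-k : ∀ R m n C (𝒮 : ℕ → BatchRecovery.RandomizedScheme R n m) →
          (∀ k → 1 ℕ.≤ k → k ℕ.≤ n → BatchRecovery.SolvesNoiseFree R C k (𝒮 k)) →
          ∀ T → (∀ k → 1 ℕ.≤ k → k ℕ.≤ n → BatchRecovery.WorstCaseAtMost R (𝒮 k) T) → m ℕ.* n ℕ.≤ 4 ℕ.* T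
  all-k R zero    n       C 𝒮 solves T t≤T = z≤n
  all-k R (suc m) zero    C 𝒮 solves T t≤T = ≡.subst (ℕ._≤ 4 ℕ.* T) (≡.sym (ℕₚ.*-zeroʳ m)) z≤n
  -- The choice `k = n` leaves room for a dense column as soon as there is a column at all.
  all-k R (suc m) (suc n) C 𝒮 solves T t≤T = each-k R (suc m) (suc n) C 𝒮 (suc n) (s≤s z≤n) ℕₚ.≤-refl
    (ℕₚ.m≤m*n (suc n) (suc m)) (solves (suc n) (s≤s z≤n) ℕₚ.≤-refl) T (t≤T (suc n) (s≤s z≤n) ℕₚ.≤-refl)
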